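{- In the theory of three groups $\mathsf{3G}$, every first-order formula of the language $\langle Z,L,+,0,1,{<}\rangle$ is equivalent (provably in $\mathsf{3G}$) to a special formula.
   Context: All groups are abelian and all orders are total. An integer part of an ordered group $G$ is a subgroup $Z\subseteq G$ having a least positive element $1$, such that every $x\in G$ satisfies $|x-n|\le1$ for some $n\in Z$; then for every $x\in G$ there is a unique $\lfloor x\rfloor\in Z$ with $\lfloor x\rfloor\le x<\lfloor x\rfloor+1$, and $\{x\}:=x-\lfloor x\rfloor$. The theory of three groups $\mathsf{3G}$ is the first-order theory in the language $\langle Z,L,+,0,1,<\rangle$, where $Z$ and $L$ are unary predicates (also treated as sets) and the whole universe is denoted $Q$, with axioms: (i) $\langle Q,+,0,<\rangle$ is a divisible ordered group; (ii) $Z$ is an integer part of $Q$ with least positive element $1$; (iii) $L$ is a convex subgroup of $Q$ containing $1$. An integer $n\in\mathbb Z$ also denotes the element $n\cdot1$ of $Q$, and for $m\in\mathbb N_{>0}$, $x\equiv y\pmod m$ means $x-y\in mZ$. A special formula is a Boolean combination of formulas of the forms $$\textstyle\sum_in_i\{x_i\}\ge n,\qquad\sum_in_i\lfloor x_i\rfloor\ge n,\qquad\lfloor x_i\rfloor\equiv k\pmod m,\qquad\sum_in_ix_i\in L,\qquad Q=L,$$ where the sums are finite, the $x_i$ are variables, $n_i,n,k,m\in\mathbb Z$, $0\le k<m$, and $Q=L$ stands for the sentence $\forall x\,L(x)$. -}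

module Defs where

open import Data.Fin using (Fin; zero; suc; toℕ; _↑ˡ_; _↑ʳ_)
open import Data.Integer using (ℤ; +_; -[1+_]; -_)
open import Data.List using (List; _∷_; []; map)
open import Data.List.Membership.Propositional using (_∈_)
open import Data.Nat as ℕ using (ℕ; zero; suc)
open import Data.Vec.Functional using (Vector; foldr)
open import Function using (_∘_)

infix  9 _[_]
infixr 8 _·_
infixl 7 _+_
infix  6 _≐_ _<_ _≤_
infixr 5 _∧_
infixr 4 _∨_
infixr 3 _⇒_
infix  2 _⇔_
infix  1 _∣_⊢_
infix  7 ¬_
infix  3 ∀̇_ ∃̇_

-- First-order logic with equality over the language ⟨Z, L, +, 0, 1, <⟩, with
-- well-scoped de Bruijn indices: the free variables of a `Formula n` are
-- among n many, and index zero is the innermost one.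

data Term (n : ℕ) : Set where
  var     : Fin n → Term n
  `0 `1   : Term n
  _+_     : Term n → Term n → Term n

data Formula (n : ℕ) : Set where
  _≐_ _<_     : Term n → Term n → Formula n
  Z L         : Term n → Formula n
  ⊥           : Formula n
  _∧_ _∨_ _⇒_ : Formula n → Formula n → Formula n
  ∀̇_ ∃̇_       : Formula (suc n) → Formula n

Sentence : Set
Sentence = Formula 0

¬_ : ∀ {n} → Formula n → Formula n
¬ φ = φ ⇒ ⊥

⊤ : ∀ {n} → Formula n
⊤ = ¬ ⊥

_⇔_ : ∀ {n} → Formula n → Formula n → Formula n
φ ⇔ ψ = (φ ⇒ ψ) ∧ (ψ ⇒ φ)

_≤_ : ∀ {n} → Term n → Term n → Formula n
s ≤ t = s < t ∨ s ≐ t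

Subst : ℕ → ℕ → Set
Subst m n = Fin m → Term n

subT : ∀ {m n} → Subst m n → Term m → Term n
subT σ (var i) = σ i
subT σ `0      = `0
subT σ `1      = `1
subT σ (s + t) = subT σ s + subT σ t

wkT : ∀ {n} → Term n → Term (suc n)
wkT = subT (var ∘ suc)

lift : ∀ {m n} → Subst m n → Subst (suc m) (suc n)
lift σ zero    = var zero
lift σ (suc i) = wkT (σ i)

sub : ∀ {m n} → Subst m n → Formula m → Formula n
sub σ (s ≐ t) = subT σ s ≐ subT σ t
sub σ (s < t) = subT σ s < subT σ t
sub σ (Z t)   = Z (subT σ t)
sub σ (L t)   = L (subT σ t)
sub σ ⊥       = ⊥
sub σ (φ ∧ ψ) = sub σ φ ∧ sub σ ψ
sub σ (φ ∨ ψ) = sub σ φ ∨ sub σ ψ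
sub σ (φ ⇒ ψ) = sub σ φ ⇒ sub σ ψ
sub σ (∀̇ φ)   = ∀̇ sub (lift σ) φ
sub σ (∃̇ φ)   = ∃̇ sub (lift σ) φ

wk : ∀ {n} → Formula n → Formula (suc n)
wk = sub (var ∘ suc)

inst : ∀ {n} → Term n → Subst (suc n) n
inst t zero    = t
inst t (suc i) = var i

_[_] : ∀ {n} → Formula (suc n) → Term n → Formula n
φ [ t ] = sub (inst t) φ

-- Classical natural deduction from a theory T, with free variables among n
-- and local hypotheses Γ.

data _∣_⊢_ (T : Sentence → Set) : ∀ {n} → List (Formula n) → Formula n → Set where
  axiom  : ∀ {n} {Γ : List (Formula n)} {σ} → T σ → T ∣ Γ ⊢ sub (λ ()) σ
  hyp    : ∀ {n} {Γ : List (Formula n)} {φ} → φ ∈ Γ → T ∣ Γ ⊢ φ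
  raa    : ∀ {n} {Γ : List (Formula n)} {φ} → T ∣ ¬ φ ∷ Γ ⊢ ⊥ → T ∣ Γ ⊢ φ
  ∧I     : ∀ {n} {Γ : List (Formula n)} {φ ψ} → T ∣ Γ ⊢ φ → T ∣ Γ ⊢ ψ → T ∣ Γ ⊢ φ ∧ ψ
  ∧E₁    : ∀ {n} {Γ : List (Formula n)} {φ ψ} → T ∣ Γ ⊢ φ ∧ ψ → T ∣ Γ ⊢ φ
  ∧E₂    : ∀ {n} {Γ : List (Formula n)} {φ ψ} → T ∣ Γ ⊢ φ ∧ ψ → T ∣ Γ ⊢ ψ
  ∨I₁    : ∀ {n} {Γ : List (Formula n)} {φ ψ} → T ∣ Γ ⊢ φ → T ∣ Γ ⊢ φ ∨ ψ
  ∨I₂    : ∀ {n} {Γ : List (Formula n)} {φ ψ} → T ∣ Γ ⊢ ψ → T ∣ Γ ⊢ φ ∨ ψ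
  ∨E     : ∀ {n} {Γ : List (Formula n)} {φ ψ χ} →
           T ∣ Γ ⊢ φ ∨ ψ → T ∣ φ ∷ Γ ⊢ χ → T ∣ ψ ∷ Γ ⊢ χ → T ∣ Γ ⊢ χ
  ⇒I     : ∀ {n} {Γ : List (Formula n)} {φ ψ} → T ∣ φ ∷ Γ ⊢ ψ → T ∣ Γ ⊢ φ ⇒ ψ
  ⇒E     : ∀ {n} {Γ : List (Formula n)} {φ ψ} → T ∣ Γ ⊢ φ ⇒ ψ → T ∣ Γ ⊢ φ → T ∣ Γ ⊢ ψ
  ∀I     : ∀ {n} {Γ : List (Formula n)} {φ} → T ∣ map wk Γ ⊢ φ → T ∣ Γ ⊢ ∀̇ φ
  ∀E     : ∀ {n} {Γ : List (Formula n)} {φ} → T ∣ Γ ⊢ ∀̇ φ → ∀ t → T ∣ Γ ⊢ φ [ t ]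
  ∃I     : ∀ {n} {Γ : List (Formula n)} φ t → T ∣ Γ ⊢ φ [ t ] → T ∣ Γ ⊢ ∃̇ φ
  ∃E     : ∀ {n} {Γ : List (Formula n)} {φ χ} →
           T ∣ Γ ⊢ ∃̇ φ → T ∣ φ ∷ map wk Γ ⊢ wk χ → T ∣ Γ ⊢ χ
  ≐refl  : ∀ {n} {Γ : List (Formula n)} t → T ∣ Γ ⊢ t ≐ t
  ≐subst : ∀ {n} {Γ : List (Formula n)} φ {s t} →
           T ∣ Γ ⊢ s ≐ t → T ∣ Γ ⊢ φ [ s ] → T ∣ Γ ⊢ φ [ t ]

_·_ : ∀ {n} → ℕ → Term n → Term n
zero  · t = `0
suc m · t = t + m · t

x₀ : ∀ {n} → Term (1 ℕ.+ n)
x₀ = var zero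

x₁ : ∀ {n} → Term (2 ℕ.+ n)
x₁ = var (suc zero)

x₂ : ∀ {n} → Term (3 ℕ.+ n)
x₂ = var (suc (suc zero))

-- The theory of three groups. The language has no subtraction, so -x is
-- expressed as the y with x + y = 0, and |x - n| ≤ 1 as the conjunction of
-- x ≤ n + 1 and n ≤ x + 1.

data 3G : Sentence → Set where
  Q-assoc      : 3G (∀̇ ∀̇ ∀̇ ((x₂ + x₁) + x₀ ≐ x₂ + (x₁ + x₀)))
  Q-comm       : 3G (∀̇ ∀̇ (x₁ + x₀ ≐ x₀ + x₁))
  Q-identity   : 3G (∀̇ (x₀ + `0 ≐ x₀))
  Q-inverse    : 3G (∀̇ ∃̇ (x₁ + x₀ ≐ `0))
  Q-irrefl     : 3G (∀̇ ¬ (x₀ < x₀))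
  Q-trans      : 3G (∀̇ ∀̇ ∀̇ (x₂ < x₁ ∧ x₁ < x₀ ⇒ x₂ < x₀))
  Q-total      : 3G (∀̇ ∀̇ (x₁ < x₀ ∨ x₁ ≐ x₀ ∨ x₀ < x₁))
  Q-mono       : 3G (∀̇ ∀̇ ∀̇ (x₂ < x₁ ⇒ x₂ + x₀ < x₁ + x₀))
  Q-divisible  : ∀ m → 3G (∀̇ ∃̇ (suc m · x₀ ≐ x₁))
  Z-zero       : 3G (Z `0)
  Z-+          : 3G (∀̇ ∀̇ (Z x₁ ∧ Z x₀ ⇒ Z (x₁ + x₀)))
  Z-inverse    : 3G (∀̇ ∀̇ (Z x₁ ∧ x₁ + x₀ ≐ `0 ⇒ Z x₀))
  Z-one        : 3G (Z `1)
  0<1          : 3G (`0 < `1)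
  Z-least      : 3G (∀̇ (Z x₀ ∧ `0 < x₀ ⇒ `1 ≤ x₀))
  Z-integer    : 3G (∀̇ ∃̇ (Z x₀ ∧ x₁ ≤ x₀ + `1 ∧ x₀ ≤ x₁ + `1))
  L-zero       : 3G (L `0)
  L-+          : 3G (∀̇ ∀̇ (L x₁ ∧ L x₀ ⇒ L (x₁ + x₀)))
  L-inverse    : 3G (∀̇ ∀̇ (L x₁ ∧ x₁ + x₀ ≐ `0 ⇒ L x₀))
  L-convex     : 3G (∀̇ ∀̇ ∀̇ (L x₂ ∧ L x₀ ∧ x₂ ≤ x₁ ∧ x₁ ≤ x₀ ⇒ L x₁))
  L-one        : 3G (L `1)

-- Integer linear combinations are split into positive and negative parts,
-- a = a ⁺ - a ⁻, with the negative parts moved to the other side of a relation.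

_⁺ _⁻ : ℤ → ℕ
(+ n)    ⁺ = n
-[1+ n ] ⁺ = 0
a ⁻ = (- a) ⁺

Σ⁺ Σ⁻ : ∀ {k n} → Vector ℤ k → Vector (Term n) k → Term n
Σ⁺ a t = foldr _+_ `0 (λ i → (a i ⁺) · t i)
Σ⁻ a t = foldr _+_ `0 (λ i → (a i ⁻) · t i)

-- ∑ᵢ aᵢ tᵢ ≥ c
Σ[_,_]≥_ : ∀ {k n} → Vector ℤ k → Vector (Term n) k → ℤ → Formula n
Σ[ a , t ]≥ c = Σ⁻ a t + (c ⁺) · `1 ≤ Σ⁺ a t + (c ⁻) · `1

-- ∑ᵢ aᵢ tᵢ ∈ L
Σ[_,_]∈L : ∀ {k n} → Vector ℤ k → Vector (Term n) k → Formula n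
Σ[ a , t ]∈L = ∃̇ (L x₀ ∧ x₀ + wkT (Σ⁻ a t) ≐ wkT (Σ⁺ a t))

-- s = ⌊ t ⌋
_≐⌊_⌋ : ∀ {n} → Term n → Term n → Formula n
s ≐⌊ t ⌋ = Z s ∧ s ≤ t ∧ t < s + `1

-- s = { t } = t - ⌊ t ⌋
_≐｛_｝ : ∀ {n} → Term n → Term n → Formula n
s ≐｛ t ｝ = ∃̇ (x₀ ≐⌊ wkT t ⌋ ∧ wkT s + x₀ ≐ wkT t)

-- t ≡ k (mod m), that is, t - k ∈ mZ
_≡_mod_ : ∀ {n} → Term n → ℕ → ℕ → Formula n
t ≡ k mod m = ∃̇ (Z x₀ ∧ wkT t ≐ m · x₀ + k · `1)

⋀ : ∀ {k n} → Vector (Formula n) k → Formula n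
⋀ = foldr _∧_ ⊤

∃^ : ∀ k {n} → Formula (k ℕ.+ n) → Formula n
∃^ zero    φ = φ
∃^ (suc k) φ = ∃^ k (∃̇ φ)

-- ⌊_⌋ and {_} are not symbols of the language: an inequality between their
-- values at x₁, …, xₙ is written with fresh variables y₁, …, yₙ for these values.
-- Among n + n variables, xᵢ is `old n i` and yᵢ is `new n i`.

old new : ∀ n → Vector (Term (n ℕ.+ n)) n
new n i = var (i ↑ˡ n)
old n i = var (n ↑ʳ i)

-- A sum over finitely many of the variables in scope is given by
-- coefficients for all of them, possibly zero. The condition 0 ≤ k < m on a
-- congruence is k : Fin m, which also makes m positive.

data Special {n : ℕ} : Formula n → Set where
  fractional : (a : Vector ℤ n) (c : ℤ) →
               Special (∃^ n (⋀ (λ i → new n i ≐｛ old n i ｝) ∧ Σ[ a , new n ]≥ c))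
  integral   : (a : Vector ℤ n) (c : ℤ) →
               Special (∃^ n (⋀ (λ i → new n i ≐⌊ old n i ⌋) ∧ Σ[ a , new n ]≥ c))
  congruence : (i : Fin n) (m : ℕ) (k : Fin m) →
               Special (∃̇ (x₀ ≐⌊ wkT (var i) ⌋ ∧ x₀ ≡ toℕ k mod m))
  in-L       : (a : Vector ℤ n) → Special Σ[ a , var ]∈L
  Q=L        : Special (∀̇ L x₀)
  not        : ∀ {φ} → Special φ → Special (¬ φ)
  and        : ∀ {φ ψ} → Special φ → Special ψ → Special (φ ∧ ψ)
  or         : ∀ {φ ψ} → Special φ → Special ψ → Special (φ ∨ ψ)

{-# OPTIONS --safe #-}

-- Derivability reduces to validity by a constructive completeness theorem in the style of Krivine:
-- a Henkin term model in which falsity is read as an arbitrary type R, and disjunctions and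
-- existentials as double negations relative to R. In such a model negation, division by m and
-- ⌊_⌋ become functions, because the Henkin construction provides witnesses.
--
-- Writing x = ⌊x⌋ + {x}, every atomic formula becomes a Boolean combination of conditions on the
-- floors and conditions on the fractional parts, since a sum of the nᵢ{xᵢ} is bounded by a standard
-- integer. So ∃x splits into a quantifier over the fractional part and one over the floor.
-- For the former, between consecutive roots p, q of the affine forms in x all truth values are
-- constant, and (p + q) / 2 is a test point (Ferrante and Rackoff). For the latter, let N be a
-- common multiple of the moduli. If x is in the L-coset of a root, an integer congruent to x mod N
-- with the same truth values lies near that root; if not, but x lies between two roots, one lies
-- near the midpoint of the neighbouring roots, whose distance is not in L; if x lies beyond
-- all roots, then Q ≠ L and only the limits of the atoms at ± ∞ along a residue class matter.

module Submission where

open import Defs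
open import Data.Nat using (ℕ)
open import Data.List using ([])
open import Data.Product using (∃-syntax; _×_)

open import Algebra.Bundles using (AbelianGroup)
import Algebra.Properties.AbelianGroup as AbelianGroupProperties
import Algebra.Properties.CommutativeMonoid.Mult as Mult
open import Data.Fin using (Fin; zero; suc; toℕ; fromℕ; inject₁; _↑ˡ_; _↑ʳ_)
import Data.Fin.Properties as Fin
open import Data.Integer as ℤ using (ℤ; +_; -[1+_]; 0ℤ; 1ℤ)
import Data.Integer.DivMod as ℤ
import Data.Integer.Properties as ℤ
open import Data.List using (List; _∷_; map; _++_; concat; cartesianProductWith; allFin)
open import Data.List.Membership.Propositional using (_∈_)
open import Data.List.Membership.Propositional.Properties
  using (∈-map⁺; ∈-map⁻; ∈-concat⁺′; ∈-cartesianProductWith⁺; ∈-allFin; ∈-++⁺ˡ; ∈-++⁺ʳ)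
open import Data.List.Properties using (map-++)
open import Data.List.Relation.Unary.All as All using (All; []; _∷_)
import Data.List.Relation.Unary.All.Properties as All
open import Data.List.Relation.Unary.Any using (here; there)
open import Data.Maybe using (Maybe; just; nothing; maybe′)
open import Data.Nat as ℕ using (zero; suc; s≤s; z≤n)
open import Data.Nat.Divisibility using (_∣_; divides; m∣m*n; n∣m*n; ∣-refl; ∣-trans)
import Data.Nat.Properties as ℕ
open import Data.Product using (Σ; _,_; proj₁; proj₂)
open import Data.Sum using (_⊎_; inj₁; inj₂)
open import Data.Vec as Vec using (Vec; []; _∷_)
import Data.Vec.Properties as Vec
open import Data.Vec.Functional using (Vector)
import Data.Vec.Functional as F
open import Function using (_∘_; id)
open import Level using (0ℓ)
open import Relation.Binary.PropositionalEquality as ≡ using (_≡_; _≗_)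
import Relation.Binary.Reasoning.Setoid as ≈-Reasoning
import Relation.Binary.Reflection as Reflection
open import Relation.Nullary using (yes; no; contradiction)

-- `eliminate` computes the special formula from the syntax alone; models enter only when the
-- equivalence is verified. Every case distinction in it must therefore be a finite disjunction
-- fixed in advance, although models order the roots differently and may have nonstandard integers.
-- The unknown order is met by trying all pairs of roots, a pair of equal roots giving the root
-- itself. The nonstandard integers are met by discreteness: an integer between two standard ones is
-- standard, so a standard bound on the distance leaves finitely many candidates. As midpoints are
-- fractions in general, the candidates are listed by their numerators, with divisibility by the
-- denominator as a side condition; so the atoms allow divisibility of whole affine forms, and
-- residues of single floors come back only in the last translation. Truth in the models is not
-- decidable: arguments by cases take place under a double negation relative to R, which the
-- stability of the goal removes.

module Completeness where
  open ≡ using (refl; sym; trans; cong; cong₂; subst)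

  -- Substitution and derivations

  subT-cong : ∀ {m n} {σ τ : Subst m n} → σ ≗ τ → subT σ ≗ subT τ
  subT-cong σ≗τ (var i) = σ≗τ i
  subT-cong σ≗τ `0      = refl
  subT-cong σ≗τ `1      = refl
  subT-cong σ≗τ (s + t) = cong₂ _+_ (subT-cong σ≗τ s) (subT-cong σ≗τ t)

  lift-cong : ∀ {m n} {σ τ : Subst m n} → σ ≗ τ → lift σ ≗ lift τ
  lift-cong σ≗τ zero    = refl
  lift-cong σ≗τ (suc i) = cong wkT (σ≗τ i)

  sub-cong : ∀ {m n} {σ τ : Subst m n} → σ ≗ τ → sub σ ≗ sub τ
  sub-cong e (s ≐ t) = cong₂ _≐_ (subT-cong e s) (subT-cong e t)
  sub-cong e (s < t) = cong₂ _<_ (subT-cong e s) (subT-cong e t)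
  sub-cong e (Z t)   = cong Z (subT-cong e t)
  sub-cong e (L t)   = cong L (subT-cong e t)
  sub-cong e ⊥       = refl
  sub-cong e (φ ∧ ψ) = cong₂ _∧_ (sub-cong e φ) (sub-cong e ψ)
  sub-cong e (φ ∨ ψ) = cong₂ _∨_ (sub-cong e φ) (sub-cong e ψ)
  sub-cong e (φ ⇒ ψ) = cong₂ _⇒_ (sub-cong e φ) (sub-cong e ψ)
  sub-cong e (∀̇ φ)   = cong ∀̇_ (sub-cong (lift-cong e) φ)
  sub-cong e (∃̇ φ)   = cong ∃̇_ (sub-cong (lift-cong e) φ)

  subT-∘ : ∀ {l m n} (τ : Subst m n) (σ : Subst l m) → subT τ ∘ subT σ ≗ subT (subT τ ∘ σ)
  subT-∘ τ σ (var i) = refl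
  subT-∘ τ σ `0      = refl
  subT-∘ τ σ `1      = refl
  subT-∘ τ σ (s + t) = cong₂ _+_ (subT-∘ τ σ s) (subT-∘ τ σ t)

  lift-wkT : ∀ {m n} (σ : Subst m n) → subT (lift σ) ∘ wkT ≗ wkT ∘ subT σ
  lift-wkT σ t = trans (subT-∘ (lift σ) (var ∘ suc) t) (sym (subT-∘ (var ∘ suc) σ t))

  lift-∘ : ∀ {l m n} (τ : Subst m n) (σ : Subst l m) → subT (lift τ) ∘ lift σ ≗ lift (subT τ ∘ σ)
  lift-∘ τ σ zero    = refl
  lift-∘ τ σ (suc i) = lift-wkT τ (σ i)

  sub-∘ : ∀ {l m n} (τ : Subst m n) (σ : Subst l m) → sub τ ∘ sub σ ≗ sub (subT τ ∘ σ)
  sub-∘ τ σ (s ≐ t) = cong₂ _≐_ (subT-∘ τ σ s) (subT-∘ τ σ t)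
  sub-∘ τ σ (s < t) = cong₂ _<_ (subT-∘ τ σ s) (subT-∘ τ σ t)
  sub-∘ τ σ (Z t)   = cong Z (subT-∘ τ σ t)
  sub-∘ τ σ (L t)   = cong L (subT-∘ τ σ t)
  sub-∘ τ σ ⊥       = refl
  sub-∘ τ σ (φ ∧ ψ) = cong₂ _∧_ (sub-∘ τ σ φ) (sub-∘ τ σ ψ)
  sub-∘ τ σ (φ ∨ ψ) = cong₂ _∨_ (sub-∘ τ σ φ) (sub-∘ τ σ ψ)
  sub-∘ τ σ (φ ⇒ ψ) = cong₂ _⇒_ (sub-∘ τ σ φ) (sub-∘ τ σ ψ)
  sub-∘ τ σ (∀̇ φ)   = cong ∀̇_ (trans (sub-∘ (lift τ) (lift σ) φ) (sub-cong (lift-∘ τ σ) φ))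
  sub-∘ τ σ (∃̇ φ)   = cong ∃̇_ (trans (sub-∘ (lift τ) (lift σ) φ) (sub-cong (lift-∘ τ σ) φ))

  subT-id : ∀ {n} (t : Term n) → subT var t ≡ t
  subT-id (var i) = refl
  subT-id `0      = refl
  subT-id `1      = refl
  subT-id (s + t) = cong₂ _+_ (subT-id s) (subT-id t)

  lift-var : ∀ {n} → lift {n} var ≗ var
  lift-var zero    = refl
  lift-var (suc i) = refl

  sub-id : ∀ {n} (φ : Formula n) → sub var φ ≡ φ
  sub-id (s ≐ t) = cong₂ _≐_ (subT-id s) (subT-id t)
  sub-id (s < t) = cong₂ _<_ (subT-id s) (subT-id t)
  sub-id (Z t)   = cong Z (subT-id t)
  sub-id (L t)   = cong L (subT-id t)
  sub-id ⊥       = refl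
  sub-id (φ ∧ ψ) = cong₂ _∧_ (sub-id φ) (sub-id ψ)
  sub-id (φ ∨ ψ) = cong₂ _∨_ (sub-id φ) (sub-id ψ)
  sub-id (φ ⇒ ψ) = cong₂ _⇒_ (sub-id φ) (sub-id ψ)
  sub-id (∀̇ φ)   = cong ∀̇_ (trans (sub-cong lift-var φ) (sub-id φ))
  sub-id (∃̇ φ)   = cong ∃̇_ (trans (sub-cong lift-var φ) (sub-id φ))

  wk-[] : ∀ {n} (t : Term n) (φ : Formula n) → wk φ [ t ] ≡ φ
  wk-[] t φ = trans (sub-∘ (inst t) (var ∘ suc) φ) (sub-id φ)

  lift-wk : ∀ {m n} (σ : Subst m n) (φ : Formula m) → sub (lift σ) (wk φ) ≡ wk (sub σ φ)
  lift-wk σ φ = trans (sub-∘ (lift σ) (var ∘ suc) φ) (sym (sub-∘ (var ∘ suc) σ φ))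

  inst-lift : ∀ {m n} (σ : Subst m n) (t : Term n) → subT (inst t) ∘ lift σ ≗ t F.∷ σ
  inst-lift σ t zero    = refl
  inst-lift σ t (suc i) = trans (subT-∘ (inst t) (var ∘ suc) (σ i)) (subT-id (σ i))

  lift-[] : ∀ {m n} (σ : Subst m n) (t : Term n) (φ : Formula (suc m)) →
            sub (lift σ) φ [ t ] ≡ sub (t F.∷ σ) φ
  lift-[] σ t φ = trans (sub-∘ (inst t) (lift σ) φ) (sub-cong (inst-lift σ t) φ)

  sub-[] : ∀ {m n} (σ : Subst m n) (t : Term m) (φ : Formula (suc m)) →
           sub σ (φ [ t ]) ≡ sub (lift σ) φ [ subT σ t ]
  sub-[] σ t φ = trans (sub-∘ σ (inst t) φ)
    (trans (sub-cong (λ { zero → refl ; (suc i) → refl }) φ) (sym (lift-[] σ (subT σ t) φ)))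

  lift-x₀ : ∀ {n} (φ : Formula (suc n)) → sub (lift (var ∘ suc)) φ [ x₀ ] ≡ φ
  lift-x₀ φ = trans (lift-[] (var ∘ suc) x₀ φ)
    (trans (sub-cong (λ { zero → refl ; (suc i) → refl }) φ) (sub-id φ))

  Maps : ∀ {m n} → Subst m n → List (Formula m) → List (Formula n) → Set
  Maps σ Γ Δ = ∀ {ψ} → ψ ∈ Γ → sub σ ψ ∈ Δ

  maps-∷ : ∀ {m n} {σ : Subst m n} {Γ Δ} χ → Maps σ Γ Δ → Maps σ (χ ∷ Γ) (sub σ χ ∷ Δ)
  maps-∷ χ f (here refl) = here refl
  maps-∷ χ f (there ψ∈Γ) = there (f ψ∈Γ)

  maps-wk : ∀ {m n} {σ : Subst m n} {Γ Δ} → Maps σ Γ Δ → Maps (lift σ) (map wk Γ) (map wk Δ)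
  maps-wk {σ = σ} {Δ = Δ} f ψ∈ with ∈-map⁻ wk ψ∈
  ... | ψ , ψ∈Γ , refl = subst (_∈ map wk Δ) (sym (lift-wk σ ψ)) (∈-map⁺ wk (f ψ∈Γ))

  module _ {T : Sentence → Set} where

    cast : ∀ {n} {Γ : List (Formula n)} {φ ψ} → φ ≡ ψ → T ∣ Γ ⊢ φ → T ∣ Γ ⊢ ψ
    cast refl d = d

    substitute : ∀ {m n} {Γ Δ} {φ} (σ : Subst m n) → Maps σ Γ Δ → T ∣ Γ ⊢ φ → T ∣ Δ ⊢ sub σ φ
    substitute σ f (axiom {σ = θ} a) =
      cast (sym (trans (sub-∘ σ (λ ()) θ) (sub-cong (λ ()) θ))) (axiom a)
    substitute σ f (hyp φ∈Γ)    = hyp (f φ∈Γ)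
    substitute σ f (raa d)      = raa (substitute σ (maps-∷ _ f) d)
    substitute σ f (∧I d e)     = ∧I (substitute σ f d) (substitute σ f e)
    substitute σ f (∧E₁ d)      = ∧E₁ (substitute σ f d)
    substitute σ f (∧E₂ d)      = ∧E₂ (substitute σ f d)
    substitute σ f (∨I₁ d)      = ∨I₁ (substitute σ f d)
    substitute σ f (∨I₂ d)      = ∨I₂ (substitute σ f d)
    substitute σ f (∨E d e e′)  =
      ∨E (substitute σ f d) (substitute σ (maps-∷ _ f) e) (substitute σ (maps-∷ _ f) e′)
    substitute σ f (⇒I d)       = ⇒I (substitute σ (maps-∷ _ f) d)
    substitute σ f (⇒E d e)     = ⇒E (substitute σ f d) (substitute σ f e)
    substitute σ f (∀I d)       = ∀I (substitute (lift σ) (maps-wk f) d)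
    substitute σ f (∀E {φ = φ} d t) = cast (sym (sub-[] σ t φ)) (∀E (substitute σ f d) (subT σ t))
    substitute σ f (∃I φ t d)   =
      ∃I (sub (lift σ) φ) (subT σ t) (cast (sub-[] σ t φ) (substitute σ f d))
    substitute σ f (∃E {χ = χ} d e) =
      ∃E (substitute σ f d) (cast (lift-wk σ χ) (substitute (lift σ) (maps-∷ _ (maps-wk f)) e))
    substitute σ f (≐refl t)    = ≐refl (subT σ t)
    substitute σ f (≐subst φ {s} {t} d e) =
      cast (sym (sub-[] σ t φ)) (≐subst (sub (lift σ) φ) (substitute σ f d)
        (cast (sub-[] σ s φ) (substitute σ f e)))

    weaken : ∀ {n} {Γ Δ : List (Formula n)} {φ} →
             (∀ {ψ} → ψ ∈ Γ → ψ ∈ Δ) → T ∣ Γ ⊢ φ → T ∣ Δ ⊢ φ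
    weaken {Δ = Δ} {φ} f d = cast (sub-id φ)
      (substitute var (λ {ψ} ψ∈Γ → subst (_∈ Δ) (sym (sub-id ψ)) (f ψ∈Γ)) d)

    wk-der : ∀ {n} {Γ : List (Formula n)} {φ} → T ∣ Γ ⊢ φ → T ∣ map wk Γ ⊢ wk φ
    wk-der = substitute (var ∘ suc) (∈-map⁺ wk)

    -- The language has a closed term to put in place of the variable that does not occur.
    strengthen : ∀ {n} {Γ : List (Formula n)} {φ} → T ∣ map wk Γ ⊢ wk φ → T ∣ Γ ⊢ φ
    strengthen {φ = φ} d = cast (wk-[] `0 φ) (∀E (∀I d) `0)

    ⊥E : ∀ {n} {Γ : List (Formula n)} {φ} → T ∣ Γ ⊢ ⊥ → T ∣ Γ ⊢ φ
    ⊥E d = raa (weaken there d)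

    henkin-conservative : ∀ {n} {Γ : List (Formula n)} {ψ} →
                          T ∣ (ψ ⇒ wk (∀̇ ψ)) ∷ map wk Γ ⊢ ⊥ → T ∣ Γ ⊢ ⊥
    henkin-conservative {Γ = Γ} {ψ} d = ⇒E (strengthen ¬∀) (∀I all)
      where
      ¬∀ : T ∣ map wk Γ ⊢ wk (¬ (∀̇ ψ))
      ¬∀ = ⇒I (⇒E (weaken there (⇒I d)) (⇒I (hyp (there (here refl)))))
      all : T ∣ map wk Γ ⊢ ψ
      all = raa (⇒E (weaken there (⇒I d))
        (⇒I (⊥E (⇒E (hyp (there (here refl))) (hyp (here refl))))))

  -- Holding from some stage on. A parameter has its intended reading only after its constants have
  -- been introduced, and speaking of late stages spares the bookkeeping.
  Ev : (ℕ → Set) → Set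
  Ev P = ∃[ K ] (∀ k → K ℕ.≤ k → P k)

  ev-map : ∀ {P Q : ℕ → Set} → (∀ k → P k → Q k) → Ev P → Ev Q
  ev-map f (K , p) = K , λ k le → f k (p k le)

  ev-map₂ : ∀ {P Q S : ℕ → Set} → (∀ k → P k → Q k → S k) → Ev P → Ev Q → Ev S
  ev-map₂ f (K , p) (K′ , q) = K ℕ.⊔ K′ , λ k le →
    f k (p k (ℕ.≤-trans (ℕ.m≤m⊔n K K′) le)) (q k (ℕ.≤-trans (ℕ.m≤n⊔m K K′) le))

  ev-suc : ∀ {P Q : ℕ → Set} → (∀ k → P k → Q (suc k)) → Ev P → Ev Q
  ev-suc f (K , p) = suc K , λ { (suc k) (s≤s le) → f k (p k le) }

  ev-suc₂ : ∀ {P Q S : ℕ → Set} → (∀ k → P k → Q k → S (suc k)) → Ev P → Ev Q → Ev S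
  ev-suc₂ {P} {Q} {S} f p q =
    ev-suc {λ k → P k × Q k} {S} (λ { k (x , y) → f k x y }) (ev-map₂ (λ _ → _,_) p q)

  ev-at : ∀ {P : ℕ → Set} → Ev P → ∀ K → ∃[ k ] (K ℕ.≤ k × P k)
  ev-at (K′ , p) K = K ℕ.⊔ K′ , ℕ.m≤m⊔n K K′ , p _ (ℕ.m≤n⊔m K K′)

  ev-always : ∀ {P : ℕ → Set} → (∀ k → P (suc k)) → Ev P
  ev-always p = 1 , λ { (suc k) le → p k }

  -- Elements of the term model: closed terms over constants c₀, c₁, …

  data Con : Set where
    lv    : ℕ → Con
    `0ᶜ `1ᶜ : Con
    _+ᶜ_  : Con → Con → Con

  -- At stage k the constants c₀, …, cₖ₋₁ are the free variables, the last one
  -- introduced being x₀. Later constants are read as 0.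
  cutV : ∀ k → ℕ → Term k
  cutV zero    l = `0
  cutV (suc k) l with l ℕ.≟ k
  ... | yes _ = x₀
  ... | no  _ = wkT (cutV k l)

  cut : ∀ k → Con → Term k
  cut k (lv l)   = cutV k l
  cut k `0ᶜ      = `0
  cut k `1ᶜ      = `1
  cut k (s +ᶜ t) = cut k s + cut k t

  cutV-x₀ : ∀ k → cutV (suc k) k ≡ x₀
  cutV-x₀ k with k ℕ.≟ k
  ... | yes _  = refl
  ... | no k≢k = contradiction refl k≢k

  cutV-suc : ∀ k l → l ℕ.< k → cutV (suc k) l ≡ wkT (cutV k l)
  cutV-suc k l l<k with l ℕ.≟ k
  ... | yes refl = contradiction l<k (ℕ.<-irrefl refl)
  ... | no  _    = refl

  -- For a constant this fails only at the stage that introduces it, where its reading jumps from 0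
  -- to `x₀`.
  cut-suc : ∀ t → Ev (λ k → cut (suc k) t ≡ wkT (cut k t))
  cut-suc (lv l)   = suc l , λ k → cutV-suc k l
  cut-suc `0ᶜ      = 0 , λ _ _ → refl
  cut-suc `1ᶜ      = 0 , λ _ _ → refl
  cut-suc (s +ᶜ t) = ev-map₂ (λ k → cong₂ _+_) (cut-suc s) (cut-suc t)

  ev-Fin : ∀ {m} {P : Fin m → ℕ → Set} → (∀ i → Ev (P i)) → Ev (λ k → ∀ i → P i k)
  ev-Fin {zero}  p = 0 , λ _ _ ()
  ev-Fin {suc m} p = ev-map₂ (λ { k a b zero → a ; k a b (suc i) → b i }) (p zero)
    (ev-Fin (p ∘ suc))

  Env : ℕ → Set
  Env m = Fin m → Con

  cut-env : ∀ {m} (ρ : Env m) → Ev (λ k → ∀ i → cut (suc k) (ρ i) ≡ wkT (cut k (ρ i)))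
  cut-env ρ = ev-Fin (cut-suc ∘ ρ)

  infixl 9 _at_
  _at_ : ∀ {m} → Formula m → Env m → ∀ k → Formula k
  (φ at ρ) k = sub (cut k ∘ ρ) φ

  -- Enumeration of formulas with parameters

  mutual
    terms : ℕ → ∀ n → List (Term n)
    terms zero    n = []
    terms (suc d) n = concat (termLayers d n)

    termLayers : ℕ → ∀ n → List (List (Term n))
    termLayers d n =
      (`0 ∷ `1 ∷ []) ∷ map var (allFin n) ∷ cartesianProductWith _+_ (terms d n) (terms d n) ∷ []

  mutual
    cons : ℕ → List Con
    cons zero    = []
    cons (suc d) = concat (conLayers d)

    conLayers : ℕ → List (List Con)
    conLayers d =
      -- `lv d` is contributed at this depth only, so the earlier list is carried along to make
      -- membership last.
      (`0ᶜ ∷ `1ᶜ ∷ lv d ∷ []) ∷ cons d ∷ cartesianProductWith _+ᶜ_ (cons d) (cons d) ∷ []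

  mutual
    formulas : ℕ → ∀ n → List (Formula n)
    formulas zero    n = []
    formulas (suc d) n = concat (formulaLayers d n)

    formulaLayers : ℕ → ∀ n → List (List (Formula n))
    formulaLayers d n =
        (⊥ ∷ [])
      ∷ cartesianProductWith _≐_ (terms d n) (terms d n)
      ∷ cartesianProductWith _<_ (terms d n) (terms d n)
      ∷ map Z (terms d n)
      ∷ map L (terms d n)
      ∷ cartesianProductWith _∧_ (formulas d n) (formulas d n)
      ∷ cartesianProductWith _∨_ (formulas d n) (formulas d n)
      ∷ cartesianProductWith _⇒_ (formulas d n) (formulas d n)
      ∷ map ∀̇_ (formulas d (suc n))
      ∷ map ∃̇_ (formulas d (suc n))
      ∷ []

  envs : ℕ → ∀ m → List (Vec Con m)
  envs d zero    = [] ∷ []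
  envs d (suc m) = cartesianProductWith _∷_ (cons d) (envs d m)

  -- A code is a formula together with the constants substituted for its free variables.
  Code : Set
  Code = Σ ℕ λ m → Formula m × Vec Con m

  mutual
    codes : ℕ → ℕ → List Code
    codes d zero    = []
    codes d (suc m) = concat (codeLayers d m)

    codeLayers : ℕ → ℕ → List (List Code)
    codeLayers d m =
      map (m ,_) (cartesianProductWith _,_ (formulas d m) (envs d m)) ∷ codes d m ∷ []

  private
    p₀ : ∀ {A : Set} {x : A} {xs} → x ∈ x ∷ xs
    p₀ = here refl
    p₁ : ∀ {A : Set} {x y : A} {xs} → x ∈ y ∷ x ∷ xs
    p₁ = there p₀
    p₂ : ∀ {A : Set} {x y z : A} {xs} → x ∈ y ∷ z ∷ x ∷ xs
    p₂ = there p₁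

  ∈-terms : ∀ {n} (t : Term n) → Ev (λ d → t ∈ terms d n)
  ∈-terms (var i) = ev-always λ d → ∈-concat⁺′ {xss = termLayers d _} (∈-map⁺ var (∈-allFin i)) p₁
  ∈-terms `0      = ev-always λ d → here refl
  ∈-terms `1      = ev-always λ d → there (here refl)
  ∈-terms (s + t) = ev-suc₂
    (λ d p q → ∈-concat⁺′ {xss = termLayers d _} (∈-cartesianProductWith⁺ _+_ p q) p₂)
                      (∈-terms s) (∈-terms t)

  ∈-lv : ∀ {l d} → l ℕ.<′ d → lv l ∈ cons d
  ∈-lv ℕ.<′-base       = there (there (here refl))
  ∈-lv (ℕ.≤′-step l<d) = ∈-concat⁺′ {xss = conLayers _} (∈-lv l<d) p₁

  ∈-cons : ∀ t → Ev (λ d → t ∈ cons d)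
  ∈-cons (lv l)   = suc l , λ d le → ∈-lv (ℕ.<⇒<′ le)
  ∈-cons `0ᶜ      = ev-always λ d → here refl
  ∈-cons `1ᶜ      = ev-always λ d → there (here refl)
  ∈-cons (s +ᶜ t) = ev-suc₂
    (λ d p q → ∈-concat⁺′ {xss = conLayers d} (∈-cartesianProductWith⁺ _+ᶜ_ p q) p₂)
                      (∈-cons s) (∈-cons t)

  ∈-formulas : ∀ {n} (φ : Formula n) → Ev (λ d → φ ∈ formulas d n)
  ∈-formulas (s ≐ t) = ev-suc₂
    (λ d p q → ∈-concat⁺′ {xss = formulaLayers d _} (∈-cartesianProductWith⁺ _≐_ p q)
    p₁) (∈-terms s) (∈-terms t)
  ∈-formulas (s < t) = ev-suc₂
    (λ d p q → ∈-concat⁺′ {xss = formulaLayers d _} (∈-cartesianProductWith⁺ _<_ p q)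
    p₂) (∈-terms s) (∈-terms t)
  ∈-formulas (Z t)   = ev-suc
    (λ d p → ∈-concat⁺′ {xss = formulaLayers d _} (∈-map⁺ Z p) (there p₂)) (∈-terms t)
  ∈-formulas (L t)   = ev-suc
    (λ d p → ∈-concat⁺′ {xss = formulaLayers d _} (∈-map⁺ L p) (there (there p₂))) (∈-terms t)
  ∈-formulas ⊥       = ev-always λ d → here refl
  ∈-formulas (φ ∧ ψ) = ev-suc₂
    (λ d p q → ∈-concat⁺′ {xss = formulaLayers d _} (∈-cartesianProductWith⁺ _∧_ p q)
    (there (there (there p₂)))) (∈-formulas φ) (∈-formulas ψ)
  ∈-formulas (φ ∨ ψ) = ev-suc₂
    (λ d p q → ∈-concat⁺′ {xss = formulaLayers d _} (∈-cartesianProductWith⁺ _∨_ p q)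
    (there (there (there (there p₂))))) (∈-formulas φ) (∈-formulas ψ)
  ∈-formulas (φ ⇒ ψ) = ev-suc₂
    (λ d p q → ∈-concat⁺′ {xss = formulaLayers d _} (∈-cartesianProductWith⁺ _⇒_ p q)
    (there (there (there (there (there p₂)))))) (∈-formulas φ) (∈-formulas ψ)
  ∈-formulas (∀̇ φ)   = ev-suc (λ d p → ∈-concat⁺′ {xss = formulaLayers d _} (∈-map⁺ ∀̇_ p)
    (there (there (there (there (there (there p₂))))))) (∈-formulas φ)
  ∈-formulas (∃̇ φ)   = ev-suc (λ d p → ∈-concat⁺′ {xss = formulaLayers d _} (∈-map⁺ ∃̇_ p)
    (there (there (there (there (there (there (there p₂)))))))) (∈-formulas φ)

  ∈-envs : ∀ {m} (ts : Vec Con m) → Ev (λ d → ts ∈ envs d m)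
  ∈-envs []       = 0 , λ _ _ → here refl
  ∈-envs (t ∷ ts) = ev-map₂ (λ d → ∈-cartesianProductWith⁺ _∷_) (∈-cons t) (∈-envs ts)

  ∈-codes : ∀ {d m n c} → m ℕ.<′ n → c ∈ cartesianProductWith _,_ (formulas d m) (envs d m) →
            (m , c) ∈ codes d n
  ∈-codes {d} {m} ℕ.<′-base p = ∈-concat⁺′ {xss = codeLayers d m} (∈-map⁺ (_ ,_) p) p₀
  ∈-codes {d} (ℕ.≤′-step {n} m<n) p = ∈-concat⁺′ {xss = codeLayers d n} (∈-codes m<n p) p₁

  -- The next round and the codes still to be output. A round has finitely many codes and every code
  -- belongs to all late rounds, so each is output at arbitrarily late stages.
  State : Set
  State = ℕ × List Code

  next : State → State
  next (d , [])     = suc d , codes d d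
  next (d , c ∷ cs) = d , cs

  state : ℕ → State
  state zero    = 0 , []
  state (suc k) = next (state k)

  output : State → Maybe Code
  output (d , [])     = nothing
  output (d , c ∷ cs) = just c

  output-∈ : ∀ {d cs c} k → state k ≡ (d , cs) → c ∈ cs →
             ∃[ l ] (k ℕ.≤ l × output (state l) ≡ just c)
  output-∈ k eq (here refl) = k , ℕ.≤-refl , cong output eq
  output-∈ k eq (there p) with output-∈ (suc k) (cong next eq) p
  ... | l , k<l , o = l , ℕ.<⇒≤ k<l , o

  exhausts : ∀ {d cs} k → state k ≡ (d , cs) →
             ∃[ l ] (k ℕ.< l × state l ≡ (suc d , codes d d))
  exhausts {cs = []}     k eq = suc k , ℕ.≤-refl , cong next eq
  exhausts {cs = c ∷ cs} k eq with exhausts (suc k) (cong next eq)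
  ... | l , k<l , e = l , ℕ.<⇒≤ k<l , e

  reaches : ∀ d → ∃[ k ] (d ℕ.≤ k × state k ≡ (suc d , codes d d))
  reaches zero    with exhausts 0 refl
  ... | l , _ , e = l , z≤n , e
  reaches (suc d) with reaches d
  ... | k , d≤k , e with exhausts k e
  ... | l , k<l , e′ = l , ℕ.≤-trans (s≤s d≤k) k<l , e′

  decode : ∀ k → Code → Formula k
  decode k (m , φ , ts) = (φ at Vec.lookup ts) k

  stage : ∀ k → Formula k
  stage k = maybe′ (decode k) ⊤ (output (state k))

  -- The bound `K` lets the stage be chosen after the constants of `ρ` have received their final
  -- reading, as `stage-at` requires.
  stage-surjective : ∀ {m} (φ : Formula m) (ρ : Env m) K → ∃[ k ] (K ℕ.≤ k × stage k ≡ (φ at ρ) k)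
  stage-surjective {m} φ ρ K
    with ev-at (ev-map₂ (λ d → ∈-cartesianProductWith⁺ _,_) (∈-formulas φ)
      (∈-envs (Vec.tabulate ρ))) (K ℕ.⊔ suc m)
  ... | d , K⊔m<d , c∈ with reaches d
  ... | k , d≤k , e
    with output-∈ k e (∈-codes (ℕ.<⇒<′ (ℕ.≤-trans (ℕ.m≤n⊔m K (suc m)) K⊔m<d)) c∈)
  ... | l , k≤l , o =
    l , ℕ.≤-trans (ℕ.m≤m⊔n K (suc m)) (ℕ.≤-trans K⊔m<d (ℕ.≤-trans d≤k k≤l))
    , trans (cong (maybe′ (decode l) ⊤) o)
        (sub-cong (λ i → cong (cut l) (Vec.lookup∘tabulate ρ i)) φ)

  ε : ∀ {A : Set} → Fin 0 → A
  ε ()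

  -- Structures in which falsity is read as an arbitrary type R, and disjunction and
  -- existence as their double negations relative to R.
  record Structure : Set₁ where
    field
      D     : Set
      R     : Set
      0# 1# : D
      plus  : D → D → D
      Eq Lt : D → D → Set
      IsZ IsL : D → Set

  module Semantics (M : Structure) where
    open Structure M

    ⟦_⟧ₜ : ∀ {n} → Term n → (Fin n → D) → D
    ⟦ var i ⟧ₜ ρ = ρ i
    ⟦ `0 ⟧ₜ    ρ = 0#
    ⟦ `1 ⟧ₜ    ρ = 1#
    ⟦ s + t ⟧ₜ ρ = plus (⟦ s ⟧ₜ ρ) (⟦ t ⟧ₜ ρ)

    ⟦_⟧ : ∀ {n} → Formula n → (Fin n → D) → Set
    ⟦ s ≐ t ⟧ ρ = Eq (⟦ s ⟧ₜ ρ) (⟦ t ⟧ₜ ρ)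
    ⟦ s < t ⟧ ρ = Lt (⟦ s ⟧ₜ ρ) (⟦ t ⟧ₜ ρ)
    ⟦ Z t ⟧   ρ = IsZ (⟦ t ⟧ₜ ρ)
    ⟦ L t ⟧   ρ = IsL (⟦ t ⟧ₜ ρ)
    ⟦ ⊥ ⟧     ρ = R
    ⟦ φ ∧ ψ ⟧ ρ = ⟦ φ ⟧ ρ × ⟦ ψ ⟧ ρ
    ⟦ φ ∨ ψ ⟧ ρ = (⟦ φ ⟧ ρ → R) → (⟦ ψ ⟧ ρ → R) → R
    ⟦ φ ⇒ ψ ⟧ ρ = ⟦ φ ⟧ ρ → ⟦ ψ ⟧ ρ
    ⟦ ∀̇ φ ⟧   ρ = ∀ d → ⟦ φ ⟧ (d F.∷ ρ)
    ⟦ ∃̇ φ ⟧   ρ = (∀ d → ⟦ φ ⟧ (d F.∷ ρ) → R) → R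

  -- In `witness` the element comes before any proof that one exists, so it depends on `φ` and `ρ`
  -- alone and not on that proof.
  record IsModel (T : Sentence → Set) (M : Structure) : Set where
    open Structure M
    open Semantics M
    field
      stable  : ∀ {n} (φ : Formula n) ρ → ((⟦ φ ⟧ ρ → R) → R) → ⟦ φ ⟧ ρ
      eq-refl : ∀ d → Eq d d
      leibniz : ∀ {n} (φ : Formula (suc n)) ρ {d e} → Eq d e → ⟦ φ ⟧ (d F.∷ ρ) → ⟦ φ ⟧ (e F.∷ ρ)
      witness : ∀ {n} (φ : Formula (suc n)) ρ → ∃[ d ] (⟦ ∃̇ φ ⟧ ρ → ⟦ φ ⟧ (d F.∷ ρ))
      axioms  : ∀ {θ} → T θ → ∀ ρ → ⟦ θ ⟧ ρ

  -- The term model of a maximal theory extending ¬ χ. Whether a formula is consistent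
  -- with a theory is undecidable, so it is added at its stage on condition that it is.

  module TermModel (T : Sentence → Set) (χ : Sentence) where

    DerivableFrom : ∀ {k} → (Formula k → Set) → Formula k → Set
    DerivableFrom Θ φ = ∃[ Γ ] (All Θ Γ × (T ∣ Γ ⊢ φ))

    -- Universal formulas suffice: a witness for `∃̇ φ` is the constant introduced for `∀̇ (¬ φ)`.
    henkin : ∀ {k} → Formula k → Formula (suc k)
    henkin (∀̇ ψ) = ψ ⇒ wk (∀̇ ψ)
    henkin _     = ⊤

    -- Consistency relative to `Θ`. As an implication between derivabilities it makes sense without
    -- knowing that `Θ` is consistent, and it is just what removes the formula again in
    -- `equiconsistent`.
    Consistent : ∀ {k} → (Formula k → Set) → Set
    Consistent {k} Θ = DerivableFrom Θ (¬ stage k) → DerivableFrom Θ ⊥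

    data Next {k} (Θ : Formula k → Set) : Formula (suc k) → Set where
      kept     : ∀ {φ} → Θ φ → Next Θ (wk φ)
      added    : Consistent Θ → Next Θ (wk (stage k))
      witness  : Next Θ (henkin (stage k))

    Theory : ∀ k → Formula k → Set
    Theory zero    φ = φ ≡ ¬ χ
    Theory (suc k) φ = Next (Theory k) φ

    Der : ∀ k → Formula k → Set
    Der k = DerivableFrom (Theory k)

    der-suc : ∀ {k φ} → Der k φ → Der (suc k) (wk φ)
    der-suc (Γ , Γ⊆ , d) = map wk Γ , All.map⁺ (All.map kept Γ⊆) , wk-der d

    der-map : ∀ {k φ ψ} → (∀ {Γ} → T ∣ Γ ⊢ φ → T ∣ Γ ⊢ ψ) → Der k φ → Der k ψ
    der-map f (Γ , Γ⊆ , d) = Γ , Γ⊆ , f d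

    der-map₂ : ∀ {k φ ψ θ} → (∀ {Γ} → T ∣ Γ ⊢ φ → T ∣ Γ ⊢ ψ → T ∣ Γ ⊢ θ) →
               Der k φ → Der k ψ → Der k θ
    der-map₂ f (Γ , Γ⊆ , d) (Δ , Δ⊆ , e) =
      Γ ++ Δ , All.++⁺ Γ⊆ Δ⊆ , f (weaken ∈-++⁺ˡ d) (weaken (∈-++⁺ʳ Γ) e)

    der-pure : ∀ {k φ} → T ∣ [] ⊢ φ → Der k φ
    der-pure d = [] , [] , d

    der-hyp : ∀ {k φ} → Theory k φ → Der k φ
    der-hyp p = _ , p ∷ [] , hyp (here refl)

    henkin-elim : ∀ {k} (θ : Formula k) {Γ} → T ∣ henkin θ ∷ map wk Γ ⊢ ⊥ → T ∣ Γ ⊢ ⊥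
    henkin-elim (∀̇ ψ)   d = henkin-conservative d
    -- `henkin` reduces only on a constructor, so each remaining one repeats the removal of a
    -- hypothesis `⊤`.
    henkin-elim (_ ≐ _) d = strengthen (⇒E (⇒I d) (⇒I (hyp (here refl))))
    henkin-elim (_ < _) d = strengthen (⇒E (⇒I d) (⇒I (hyp (here refl))))
    henkin-elim (Z _)   d = strengthen (⇒E (⇒I d) (⇒I (hyp (here refl))))
    henkin-elim (L _)   d = strengthen (⇒E (⇒I d) (⇒I (hyp (here refl))))
    henkin-elim ⊥       d = strengthen (⇒E (⇒I d) (⇒I (hyp (here refl))))
    henkin-elim (_ ∧ _) d = strengthen (⇒E (⇒I d) (⇒I (hyp (here refl))))
    henkin-elim (_ ∨ _) d = strengthen (⇒E (⇒I d) (⇒I (hyp (here refl))))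
    henkin-elim (_ ⇒ _) d = strengthen (⇒E (⇒I d) (⇒I (hyp (here refl))))
    henkin-elim (∃̇ _)   d = strengthen (⇒E (⇒I d) (⇒I (hyp (here refl))))

    -- Whether the stage formula is used can be read off the finite list of hypotheses. If it is,
    -- the list also contains the proof of its consistency, so consistency itself never has to be
    -- decided.
    Base : ∀ {k} → (Formula k → Set) → List (Formula (suc k)) → Set
    Base {k} Θ Δ = ∃[ Γ ] (All Θ Γ ×
      (  (∀ {ψ} → ψ ∈ Δ → ψ ∈ henkin (stage k) ∷ map wk Γ)
       ⊎ Consistent Θ × (∀ {ψ} → ψ ∈ Δ → ψ ∈ henkin (stage k) ∷ map wk (stage k ∷ Γ))))

    base : ∀ {k} {Θ : Formula k → Set} Δ → All (Next Θ) Δ → Base Θ Δ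
    base [] [] = [] , [] , inj₁ (λ ())
    base (_ ∷ Δ) (p ∷ ps) with base Δ ps
    base (_ ∷ Δ) (kept {φ} q ∷ ps) | Γ , Γ⊆ , inj₁ f = φ ∷ Γ , q ∷ Γ⊆ , inj₁ λ
      { (here refl) → there (here refl)
      ; (there r)   → weak (f r) }
      where weak : ∀ {ψ χ} {Γ : List (Formula _)} → ψ ∈ χ ∷ map wk Γ → ψ ∈ χ ∷ map wk (φ ∷ Γ)
            weak (here e) = here e
            weak (there r) = there (there r)
    base (_ ∷ Δ) (kept {φ} q ∷ ps) | Γ , Γ⊆ , inj₂ (c , f) = φ ∷ Γ , q ∷ Γ⊆ , inj₂ (c , λ
      { (here refl) → there (there (here refl))
      ; (there r)   → weak (f r) })
      where weak : ∀ {ψ χ χ′} {Γ : List (Formula _)} → ψ ∈ χ ∷ χ′ ∷ map wk Γ → ψ ∈ χ ∷ χ′ ∷ map wk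
              (φ ∷ Γ)
            weak (here e) = here e
            weak (there (here e)) = there (here e)
            weak (there (there r)) = there (there (there r))
    base (_ ∷ Δ) (added c ∷ ps) | Γ , Γ⊆ , inj₁ f = Γ , Γ⊆ , inj₂ (c , λ
      { (here refl) → there (here refl)
      ; (there r)   → weak (f r) })
      where weak : ∀ {ψ χ χ′} {Γ : List (Formula _)} → ψ ∈ χ ∷ Γ → ψ ∈ χ ∷ χ′ ∷ Γ
            weak (here e) = here e
            weak (there r) = there (there r)
    base (_ ∷ Δ) (added c ∷ ps) | Γ , Γ⊆ , inj₂ (_ , f) = Γ , Γ⊆ , inj₂ (c , λ
      { (here refl) → there (here refl) ; (there r) → f r })
    base (_ ∷ Δ) (witness ∷ ps) | Γ , Γ⊆ , inj₁ f = Γ , Γ⊆ , inj₁ λ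
      { (here refl) → here refl ; (there r) → f r }
    base (_ ∷ Δ) (witness ∷ ps) | Γ , Γ⊆ , inj₂ (c , f) = Γ , Γ⊆ , inj₂ (c , λ
      { (here refl) → here refl ; (there r) → f r })

    equiconsistent : ∀ k → Der k ⊥ → Der 0 ⊥
    equiconsistent zero    d = d
    equiconsistent (suc k) (Δ , Δ⊆ , d) with base Δ Δ⊆
    ... | Γ , Γ⊆ , inj₁ f       = equiconsistent k (Γ , Γ⊆ , henkin-elim (stage k) (weaken f d))
    -- Discharging the stage formula refutes it, and the consistency proof `c` turns this into
    -- falsity one stage earlier.
    ... | Γ , Γ⊆ , inj₂ (c , f) =
      equiconsistent k (c (Γ , Γ⊆ , ⇒I (henkin-elim (stage k) (weaken f d))))

    -- The type `R` of the term model: it entails every formula at every stage, as falsity must, and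
    -- it yields a derivation of `χ`.
    Refuted : Set
    Refuted = Der 0 ⊥

    refuted : ∀ k {φ : Formula k} → Refuted → Der k φ
    refuted k r = der-map ⊥E (falsum k)
      where falsum : ∀ k → Der k ⊥
            falsum zero    = r
            falsum (suc k) = der-suc (falsum k)

    Holds : ∀ {m} → Formula m → Env m → Set
    Holds φ ρ = Ev λ k → Der k ((φ at ρ) k)

    Coherent : ∀ {m} → Env m → ℕ → Set
    Coherent ρ K = ∀ k → K ℕ.≤ k → ∀ i → cut (suc k) (ρ i) ≡ wkT (cut k (ρ i))

    at-suc : ∀ {m} (ρ : Env m) {K} → Coherent ρ K →
             ∀ k → K ℕ.≤ k → ∀ φ → (φ at ρ) (suc k) ≡ wk ((φ at ρ) k)
    at-suc ρ c k K≤k φ = trans (sub-cong (c k K≤k) φ) (sym (sub-∘ (var ∘ suc) (cut k ∘ ρ) φ))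

    persists : ∀ {m} (ρ : Env m) {K} → Coherent ρ K → ∀ φ → Der K ((φ at ρ) K) → Holds φ ρ
    persists ρ {K} c φ d = K , λ l K≤l → up (ℕ.≤⇒≤′ K≤l)
      where
      up : ∀ {l} → K ℕ.≤′ l → Der l ((φ at ρ) l)
      up ℕ.≤′-refl           = d
      up (ℕ.≤′-step {l} K≤l) =
        subst (Der (suc l)) (sym (at-suc ρ c l (ℕ.≤′⇒≤ K≤l) φ)) (der-suc (up K≤l))

    holds-⊥ : ∀ {m} {ρ : Env m} → Holds ⊥ ρ → Refuted
    holds-⊥ (K , d) = equiconsistent K (d K ℕ.≤-refl)

    stage-at : ∀ {m} (φ : Formula m) ρ → ∃[ k ] (Coherent ρ k × stage k ≡ (φ at ρ) k)
    stage-at φ ρ with cut-env ρ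
    ... | K , c with stage-surjective φ ρ K
    ... | k , K≤k , e = k , (λ l k≤l → c l (ℕ.≤-trans K≤k k≤l)) , e

    -- If `¬ φ` leads to falsity, then `φ` is consistent at every stage late enough for its
    -- constants, in particular at one that considers it, and is added there.
    maximality : ∀ {m} (φ : Formula m) ρ → (Holds (¬ φ) ρ → Refuted) → Holds φ ρ
    maximality φ ρ f with stage-at φ ρ
    ... | k , c , s = persists ρ (λ l k<l → c l (ℕ.<⇒≤ k<l)) φ
      (subst (Der (suc k)) (trans (cong wk s) (sym (at-suc ρ c k ℕ.≤-refl φ)))
        (der-hyp (added consistent)))
      where
      consistent : Consistent (Theory k)
      consistent d = refuted k (f (persists ρ c (¬ φ) (subst (λ ψ → Der k (¬ ψ)) s d)))

    stable-holds : ∀ {m} (φ : Formula m) ρ → ((Holds φ ρ → Refuted) → Refuted) → Holds φ ρ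
    stable-holds φ ρ f = maximality φ ρ λ h → f λ h′ →
      holds-⊥ {ρ = ρ} (ev-map₂ (λ k → der-map₂ ⇒E) h h′)

    holds-⇒ : ∀ {m} (φ ψ : Formula m) ρ → (Holds φ ρ → Holds ψ ρ) → Holds (φ ⇒ ψ) ρ
    holds-⇒ φ ψ ρ f = stable-holds (φ ⇒ ψ) ρ λ ¬h →
      ¬h (ev-map (λ k → der-map (λ d → ⇒I (⊥E (⇒E (weaken there d) (hyp (here refl))))))
        (maximality (¬ φ) ρ λ h → ¬h (ev-map (λ k → der-map (λ d → ⇒I (weaken there d)))
          (f (ev-map (λ k → der-map (λ d → raa (⇒E (weaken there d) (hyp (here refl))))) h)))))

    -- The stage `k` that treats `∀̇ φ` adds a Henkin axiom about the variable introduced at that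
    -- very moment, which is the constant `lv k`.
    fresh : ∀ {m} (φ : Formula (suc m)) (ρ : Env m) → ∃[ l ] (Holds φ (lv l F.∷ ρ) → Holds (∀̇ φ) ρ)
    fresh {m} φ ρ with stage-at (∀̇ φ) ρ
    ... | k , c , s = k , λ h → ev-map (λ l → subst (Der l) (wk-at l))
        (ev-map₂ (λ l → der-map₂ ⇒E) (persists ρ′ c′ (φ ⇒ wk (∀̇ φ)) axiom′) h)
      where
      ρ′ : Env (suc m)
      ρ′ = lv k F.∷ ρ
      c′ : Coherent ρ′ (suc k)
      c′ l k<l zero    = cutV-suc l k k<l
      c′ l k<l (suc i) = c l (ℕ.<⇒≤ k<l) i
      wk-at : ∀ l → (wk (∀̇ φ) at ρ′) l ≡ ((∀̇ φ) at ρ) l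
      wk-at l = sub-∘ (cut l ∘ ρ′) (var ∘ suc) (∀̇ φ)
      lift-cut : lift (cut k ∘ ρ) ≗ cut (suc k) ∘ ρ′
      lift-cut zero    = sym (cutV-x₀ k)
      lift-cut (suc i) = sym (c k ℕ.≤-refl i)
      axiom′ : Der (suc k) (((φ ⇒ wk (∀̇ φ)) at ρ′) (suc k))
      axiom′ = subst (Der (suc k))
        (cong₂ _⇒_ (sub-cong lift-cut φ)
          (trans (sym (at-suc ρ c k ℕ.≤-refl (∀̇ φ))) (sym (wk-at (suc k)))))
        (subst (λ θ → Der (suc k) (henkin θ)) s (der-hyp witness))

    model : Structure
    model = record
      { D = Con ; R = Refuted ; 0# = `0ᶜ ; 1# = `1ᶜ ; plus = _+ᶜ_
      ; Eq  = λ s t → Holds (x₁ ≐ x₀) (t F.∷ s F.∷ ε)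
      ; Lt  = λ s t → Holds (x₁ < x₀) (t F.∷ s F.∷ ε)
      ; IsZ = λ t → Holds (Z x₀) (t F.∷ ε)
      ; IsL = λ t → Holds (L x₀) (t F.∷ ε)
      }

    open Semantics model

    cut-⟦⟧ : ∀ {m} k (ρ : Env m) t → cut k (⟦ t ⟧ₜ ρ) ≡ subT (cut k ∘ ρ) t
    cut-⟦⟧ k ρ (var i) = refl
    cut-⟦⟧ k ρ `0      = refl
    cut-⟦⟧ k ρ `1      = refl
    cut-⟦⟧ k ρ (s + t) = cong₂ _+_ (cut-⟦⟧ k ρ s) (cut-⟦⟧ k ρ t)

    lift-cut : ∀ {m} (φ : Formula (suc m)) ρ d k →
               sub (lift (cut k ∘ ρ)) φ [ cut k d ] ≡ (φ at (d F.∷ ρ)) k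
    lift-cut φ ρ d k = trans (lift-[] (cut k ∘ ρ) (cut k d) φ)
      (sub-cong (λ { zero → refl ; (suc i) → refl }) φ)

    mutual
      -- One half of the truth lemma. The other half, `complete`, is proved simultaneously because
      -- the premise of an implication changes direction.
      sound : ∀ {m} (φ : Formula m) ρ → ⟦ φ ⟧ ρ → Holds φ ρ
      sound (s ≐ t) ρ h = ev-map (λ k → subst (Der k) (cong₂ _≐_ (cut-⟦⟧ k ρ s) (cut-⟦⟧ k ρ t))) h
      sound (s < t) ρ h = ev-map (λ k → subst (Der k) (cong₂ _<_ (cut-⟦⟧ k ρ s) (cut-⟦⟧ k ρ t))) h
      sound (Z t)   ρ h = ev-map (λ k → subst (Der k) (cong Z (cut-⟦⟧ k ρ t))) h
      sound (L t)   ρ h = ev-map (λ k → subst (Der k) (cong L (cut-⟦⟧ k ρ t))) h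
      sound ⊥       ρ r = 0 , λ k _ → refuted k r
      sound (φ ∧ ψ) ρ (h , h′) = ev-map₂ (λ k → der-map₂ ∧I) (sound φ ρ h) (sound ψ ρ h′)
      sound (φ ∨ ψ) ρ h = stable-holds (φ ∨ ψ) ρ λ ¬h →
        h (λ a → ¬h (ev-map (λ k → der-map ∨I₁) (sound φ ρ a)))
          (λ b → ¬h (ev-map (λ k → der-map ∨I₂) (sound ψ ρ b)))
      sound (φ ⇒ ψ) ρ h = holds-⇒ φ ψ ρ λ a → sound ψ ρ (h (complete φ ρ a))
      sound (∀̇ φ)   ρ h = proj₂ (fresh φ ρ) (sound φ _ (h (lv (proj₁ (fresh φ ρ)))))
      sound (∃̇ φ)   ρ h = stable-holds (∃̇ φ) ρ λ ¬h → h λ d a →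
        ¬h (ev-map (λ k → der-map λ p → ∃I _ (cut k d) (cast (sym (lift-cut φ ρ d k)) p))
          (sound φ _ a))

      complete : ∀ {m} (φ : Formula m) ρ → Holds φ ρ → ⟦ φ ⟧ ρ
      complete (s ≐ t) ρ h = ev-map
        (λ k → subst (Der k) (sym (cong₂ _≐_ (cut-⟦⟧ k ρ s) (cut-⟦⟧ k ρ t)))) h
      complete (s < t) ρ h = ev-map
        (λ k → subst (Der k) (sym (cong₂ _<_ (cut-⟦⟧ k ρ s) (cut-⟦⟧ k ρ t)))) h
      complete (Z t)   ρ h = ev-map (λ k → subst (Der k) (sym (cong Z (cut-⟦⟧ k ρ t)))) h
      complete (L t)   ρ h = ev-map (λ k → subst (Der k) (sym (cong L (cut-⟦⟧ k ρ t)))) h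
      complete ⊥       ρ h = holds-⊥ {ρ = ρ} h
      complete (φ ∧ ψ) ρ h =
        complete φ ρ (ev-map (λ k → der-map ∧E₁) h) , complete ψ ρ (ev-map (λ k → der-map ∧E₂) h)
      complete (φ ∨ ψ) ρ h f g = holds-⊥ {ρ = ρ} (ev-map₂ (λ k → der-map₂ ⇒E)
        (ev-map₂ (λ k → der-map₂ λ d e → ⇒I (∨E (hyp (here refl))
            (⇒E (weaken (there ∘ there) d) (hyp (here refl)))
              (⇒E (weaken (there ∘ there) e) (hyp (here refl)))))
          (holds-⇒ φ ⊥ ρ λ a → sound ⊥ ρ (f (complete φ ρ a)))
            (holds-⇒ ψ ⊥ ρ λ b → sound ⊥ ρ (g (complete ψ ρ b)))) h)
      complete (φ ⇒ ψ) ρ h a = complete ψ ρ (ev-map₂ (λ k → der-map₂ ⇒E) h (sound φ ρ a))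
      complete (∀̇ φ)   ρ h d = complete φ _
        (ev-map (λ k → der-map λ p → cast (lift-cut φ ρ d k) (∀E p (cut k d))) h)
      complete (∃̇ φ)   ρ h f = holds-⊥ {ρ = ρ} (ev-map₂ (λ k → der-map₂ λ d e →
        ∃E d (⇒E (cast (lift-x₀ _) (∀E (weaken there (wk-der e)) x₀)) (hyp (here refl)))) h
        (proj₂ (fresh (¬ φ) ρ) (holds-⇒ φ ⊥ ρ′ λ a → sound ⊥ ρ′ (f (lv l) (complete φ ρ′ a)))))
        where l = proj₁ (fresh (¬ φ) ρ)
              ρ′ = lv l F.∷ ρ

    isModel : IsModel T model
    isModel = record
      { stable  = λ φ ρ f → complete φ ρ (stable-holds φ ρ λ g → f (g ∘ sound φ ρ))
      ; eq-refl = λ d → 0 , λ k _ → der-pure (≐refl (cut k d))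
      ; leibniz = λ φ ρ {d} {e} d≈e h → complete φ (e F.∷ ρ) (ev-map₂
          (λ k → der-map₂ λ p q → cast (lift-cut φ ρ e k)
            (≐subst _ p (cast (sym (lift-cut φ ρ d k)) q))) d≈e (sound φ (d F.∷ ρ) h))
      ; witness = wit
      ; axioms  = λ {θ} t ρ → complete θ ρ (0 , λ k _ →
          der-pure (cast (sub-cong (λ ()) θ) (axiom t)))
      }
      where
      wit : ∀ {m} (φ : Formula (suc m)) ρ → ∃[ d ] (⟦ ∃̇ φ ⟧ ρ → ⟦ φ ⟧ (d F.∷ ρ))
      wit φ ρ = lv l , λ h → complete φ ρ′ (stable-holds φ ρ′ λ ¬h → h λ d a →
        complete (∀̇ (¬ φ)) ρ (proj₂ (fresh (¬ φ) ρ) (holds-⇒ φ ⊥ ρ′ λ b → sound ⊥ ρ′ (¬h b))) d a)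
        where l = proj₁ (fresh (¬ φ) ρ)
              ρ′ = lv l F.∷ ρ

    -- The initial theory consists of `¬ χ` alone, so a derivation of falsity from it has no other
    -- hypotheses and `raa` finishes.
    refute : ⟦ χ ⟧ ε → T ∣ [] ⊢ χ
    refute h with equiconsistent 0
      (holds-⊥ {ρ = ε} (ev-map₂ (λ k → der-map₂ ⇒E)
        (persists ε {0} (λ _ _ ()) (¬ χ) (der-hyp (cong ¬_ (sub-0 χ)))) (sound χ ε h)))
      where sub-0 : ∀ φ → sub (cut 0 ∘ ε) φ ≡ φ
            sub-0 φ = trans (sub-cong (λ ()) φ) (sub-id φ)
    ... | Γ , Γ⊆ , d = raa (weaken (λ p → here (All.lookup Γ⊆ p)) d)

  completeness : ∀ {T n} (χ : Formula n) →
                 (∀ M → IsModel T M → ∀ ρ → Semantics.⟦_⟧ M χ ρ) → T ∣ [] ⊢ χ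
  completeness {T} {zero}  χ valid = refute (valid model isModel ε)
    where open TermModel T χ
  completeness {T} {suc n} χ valid = subst (T ∣ [] ⊢_) (lift-x₀ χ)
    (∀E (wk-der (completeness (∀̇ χ) λ M isM ρ d → valid M isM (d F.∷ ρ))) x₀)

open Completeness using (Structure; IsModel; module Semantics; ε; completeness)

-- Integer linear combinations in abelian groups, with a solver

unit : ∀ {n} → Fin n → Vector ℤ n
unit zero    zero    = 1ℤ
unit zero    (suc j) = 0ℤ
unit (suc i) zero    = 0ℤ
unit (suc i) (suc j) = unit i j

module IntegerAction (G : AbelianGroup 0ℓ 0ℓ) where
  open AbelianGroup G public
    using (_≈_; setoid; refl; sym; trans; reflexive)
    renaming ( Carrier to D; _∙_ to infixl 6 _⊕_; ε to 𝟘; _⁻¹ to ⊖_; ∙-cong to ⊕-cong; ∙-congˡ to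
      ⊕-congˡ
             ; ∙-congʳ to ⊕-congʳ; ⁻¹-cong to ⊖-cong; assoc to ⊕-assoc; comm to ⊕-comm
             ; identityˡ to ⊕-identityˡ; identityʳ to ⊕-identityʳ; inverseˡ to ⊕-inverseˡ
             ; inverseʳ to ⊕-inverseʳ; _-_ to infixl 6 _⊝_)
  open AbelianGroup G using (commutativeMonoid)
  open AbelianGroupProperties G using (⁻¹-involutive; ε⁻¹≈ε; ⁻¹-∙-comm)
  open Mult commutativeMonoid using (×-congʳ; ×-homo-+; ×-distrib-+) renaming (_×_ to _⋆_)
  open ≈-Reasoning setoid

  infixr 7 _•_
  _•_ : ℤ → D → D
  (+ n)    • x = n ⋆ x
  -[1+ n ] • x = ⊖ (suc n ⋆ x)

  •-congˡ : ∀ k {x y} → x ≈ y → k • x ≈ k • y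
  •-congˡ (+ n)    e = ×-congʳ n e
  •-congˡ -[1+ n ] e = ⊖-cong (×-congʳ (suc n) e)

  •-congʳ : ∀ {k l} x → k ≡ l → k • x ≈ l • x
  •-congʳ x ≡.refl = refl

  private
    cancel : ∀ a b c → (a ⊕ b) ⊕ ⊖ (a ⊕ c) ≈ b ⊕ ⊖ c
    cancel a b c = begin
      (a ⊕ b) ⊕ ⊖ (a ⊕ c)       ≈⟨ ⊕-cong (⊕-comm a b) (sym (⁻¹-∙-comm a c)) ⟩
      (b ⊕ a) ⊕ (⊖ a ⊕ ⊖ c)     ≈⟨ ⊕-assoc b a _ ⟩
      b ⊕ (a ⊕ (⊖ a ⊕ ⊖ c))     ≈⟨ ⊕-congˡ (⊕-assoc a (⊖ a) (⊖ c)) ⟨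
      b ⊕ ((a ⊕ ⊖ a) ⊕ ⊖ c)     ≈⟨ ⊕-congˡ (⊕-congʳ (⊕-inverseʳ a)) ⟩
      b ⊕ (𝟘 ⊕ ⊖ c)             ≈⟨ ⊕-congˡ (⊕-identityˡ (⊖ c)) ⟩
      b ⊕ ⊖ c                   ∎

  ⊖-• : ∀ m n x → (m ℤ.⊖ n) • x ≈ m ⋆ x ⊕ ⊖ (n ⋆ x)
  ⊖-• m       zero    x = sym (trans (⊕-congˡ ε⁻¹≈ε) (⊕-identityʳ (m ⋆ x)))
  ⊖-• zero    (suc n) x = sym (⊕-identityˡ _)
  ⊖-• (suc m) (suc n) x = begin
    (suc m ℤ.⊖ suc n) • x               ≈⟨ •-congʳ x (ℤ.[1+m]⊖[1+n]≡m⊖n m n) ⟩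
    (m ℤ.⊖ n) • x                       ≈⟨ ⊖-• m n x ⟩
    m ⋆ x ⊕ ⊖ (n ⋆ x)                   ≈⟨ cancel x (m ⋆ x) (n ⋆ x) ⟨
    suc m ⋆ x ⊕ ⊖ (suc n ⋆ x)           ∎

  +-• : ∀ k l x → (k ℤ.+ l) • x ≈ k • x ⊕ l • x
  +-• (+ m)    (+ n)    x = ×-homo-+ x m n
  +-• (+ m)    -[1+ n ] x = ⊖-• m (suc n) x
  +-• -[1+ m ] (+ n)    x = trans (⊖-• n (suc m) x) (⊕-comm _ _)
  +-• -[1+ m ] -[1+ n ] x = begin
    ⊖ (suc (suc (m ℕ.+ n)) ⋆ x)         ≈⟨ ⊖-cong (⊕-congˡ (×-homo-+ x (suc m) n)) ⟩
    ⊖ (x ⊕ (suc m ⋆ x ⊕ n ⋆ x))         ≈⟨ ⊖-cong (swap x (suc m ⋆ x) (n ⋆ x)) ⟩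
    ⊖ (suc m ⋆ x ⊕ suc n ⋆ x)           ≈⟨ ⁻¹-∙-comm (suc m ⋆ x) (suc n ⋆ x) ⟨
    ⊖ (suc m ⋆ x) ⊕ ⊖ (suc n ⋆ x)       ∎
    where
    swap : ∀ a b c → a ⊕ (b ⊕ c) ≈ b ⊕ (a ⊕ c)
    swap a b c = trans (sym (⊕-assoc a b c)) (trans (⊕-congʳ (⊕-comm a b)) (⊕-assoc b a c))

  neg-• : ∀ k x → (ℤ.- k) • x ≈ ⊖ (k • x)
  neg-• (+ zero)  x = sym ε⁻¹≈ε
  neg-• (+ suc n) x = refl
  neg-• -[1+ n ]  x = sym (⁻¹-involutive _)

  1-• : ∀ x → 1ℤ • x ≈ x
  1-• = ⊕-identityʳ

  •-⊕ : ∀ k x y → k • (x ⊕ y) ≈ k • x ⊕ k • y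
  •-⊕ (+ n)    x y = ×-distrib-+ x y n
  •-⊕ -[1+ n ] x y = trans (⊖-cong (×-distrib-+ x y (suc n))) (sym (⁻¹-∙-comm _ _))

  *-× : ∀ n l x → (+ n ℤ.* l) • x ≈ n ⋆ (l • x)
  *-× zero    l x = refl
  *-× (suc n) l x = begin
    (+ suc n ℤ.* l) • x               ≈⟨ •-congʳ x (ℤ.suc-* (+ n) l) ⟩
    (l ℤ.+ + n ℤ.* l) • x             ≈⟨ +-• l (+ n ℤ.* l) x ⟩
    l • x ⊕ (+ n ℤ.* l) • x           ≈⟨ ⊕-congˡ (*-× n l x) ⟩
    l • x ⊕ n ⋆ (l • x)               ∎

  *-• : ∀ k l x → (k ℤ.* l) • x ≈ k • (l • x)
  *-• (+ n)    l x = *-× n l x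
  *-• -[1+ n ] l x = begin
    (-[1+ n ] ℤ.* l) • x              ≈⟨ •-congʳ x (≡.sym (ℤ.neg-distribˡ-* (+ suc n) l)) ⟩
    (ℤ.- (+ suc n ℤ.* l)) • x         ≈⟨ neg-• (+ suc n ℤ.* l) x ⟩
    ⊖ ((+ suc n ℤ.* l) • x)           ≈⟨ ⊖-cong (*-× (suc n) l x) ⟩
    ⊖ (suc n ⋆ (l • x))               ∎

  •-𝟘 : ∀ k → k • 𝟘 ≈ 𝟘
  •-𝟘 k = trans (sym (*-• k 0ℤ 𝟘)) (•-congʳ 𝟘 (ℤ.*-zeroʳ k))

  •-⊖ : ∀ k x → k • (⊖ x) ≈ ⊖ (k • x)
  •-⊖ k x = begin
    k • (⊖ x)               ≈⟨ •-congˡ k (trans (neg-• 1ℤ x) (⊖-cong (1-• x))) ⟨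
    k • (ℤ.-1ℤ • x)         ≈⟨ *-• k ℤ.-1ℤ x ⟨
    (k ℤ.* ℤ.-1ℤ) • x       ≈⟨ •-congʳ x (ℤ.*-comm k ℤ.-1ℤ) ⟩
    (ℤ.-1ℤ ℤ.* k) • x       ≈⟨ •-congʳ x (ℤ.-1*i≡-i k) ⟩
    (ℤ.- k) • x             ≈⟨ neg-• k x ⟩
    ⊖ (k • x)               ∎

  ev : ∀ {n} → Vector ℤ n → (Fin n → D) → D
  ev {zero}  a z = 𝟘
  ev {suc n} a z = a zero • z zero ⊕ ev (a ∘ suc) (z ∘ suc)

  ev-cong : ∀ {n} {a b : Vector ℤ n} {z w : Fin n → D} →
            a ≗ b → (∀ i → z i ≈ w i) → ev a z ≈ ev b w
  ev-cong {zero}  e f = refl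
  ev-cong {suc n} {a} {b} {z} e f = ⊕-cong
    (trans (•-congʳ (z zero) (e zero)) (•-congˡ (b zero) (f zero))) (ev-cong (e ∘ suc) (f ∘ suc))

  interchange : ∀ a b c d → (a ⊕ b) ⊕ (c ⊕ d) ≈ (a ⊕ c) ⊕ (b ⊕ d)
  interchange a b c d = begin
    (a ⊕ b) ⊕ (c ⊕ d)   ≈⟨ ⊕-assoc a b _ ⟩
    a ⊕ (b ⊕ (c ⊕ d))   ≈⟨ ⊕-congˡ (⊕-assoc b c d) ⟨
    a ⊕ ((b ⊕ c) ⊕ d)   ≈⟨ ⊕-congˡ (⊕-congʳ (⊕-comm b c)) ⟩
    a ⊕ ((c ⊕ b) ⊕ d)   ≈⟨ ⊕-congˡ (⊕-assoc c b d) ⟩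
    a ⊕ (c ⊕ (b ⊕ d))   ≈⟨ ⊕-assoc a c _ ⟨
    (a ⊕ c) ⊕ (b ⊕ d)   ∎

  ev-+ : ∀ {n} (a b : Vector ℤ n) z → ev (λ i → a i ℤ.+ b i) z ≈ ev a z ⊕ ev b z
  ev-+ {zero}  a b z = sym (⊕-identityˡ 𝟘)
  ev-+ {suc n} a b z = trans
    (⊕-cong (+-• (a zero) (b zero) (z zero)) (ev-+ (a ∘ suc) (b ∘ suc) (z ∘ suc)))
    (interchange _ _ _ _)

  ev-* : ∀ {n} k (a : Vector ℤ n) z → ev (λ i → k ℤ.* a i) z ≈ k • ev a z
  ev-* {zero}  k a z = sym (•-𝟘 k)
  ev-* {suc n} k a z = trans (⊕-cong (*-• k (a zero) (z zero)) (ev-* k (a ∘ suc) (z ∘ suc)))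
    (sym (•-⊕ k _ _))

  ev-0 : ∀ {n} (z : Fin n → D) → ev (λ _ → 0ℤ) z ≈ 𝟘
  ev-0 {zero}  z = refl
  ev-0 {suc n} z = trans (⊕-identityˡ _) (ev-0 (z ∘ suc))

  ev-unit : ∀ {n} (i : Fin n) z → ev (unit i) z ≈ z i
  ev-unit {suc n} zero    z = trans (⊕-cong (1-• (z zero)) (ev-0 (z ∘ suc))) (⊕-identityʳ _)
  ev-unit {suc n} (suc i) z = trans (⊕-identityˡ _) (ev-unit i (z ∘ suc))

  infixl 6 _:+_ _:-_
  infixr 7 _:•_
  infix 8 :-_
  -- Terms for the solver. The scalars in its uses are closed integers, other multiples being
  -- treated as variables; so both sides of a valid identity compute to the same coefficients and
  -- `refl` closes the goal.
  data Expr (n : ℕ) : Set where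
    varₑ :  Fin n → Expr n
    :0   : Expr n
    _:+_ : Expr n → Expr n → Expr n
    _:•_ : ℤ → Expr n → Expr n
    :-_  : Expr n → Expr n

  _:-_ : ∀ {n} → Expr n → Expr n → Expr n
  e :- f = e :+ :- f

  evalₑ : ∀ {n} → Expr n → Vec D n → D
  evalₑ (varₑ i)  ρ = Vec.lookup ρ i
  evalₑ :0        ρ = 𝟘
  evalₑ (e :+ f)  ρ = evalₑ e ρ ⊕ evalₑ f ρ
  evalₑ (k :• e)  ρ = k • evalₑ e ρ
  evalₑ (:- e)    ρ = ⊖ evalₑ e ρ

  coeffs : ∀ {n} → Expr n → Vector ℤ n
  coeffs (varₑ i)  = unit i
  coeffs :0        = λ _ → 0ℤ
  coeffs (e :+ f)  = λ i → coeffs e i ℤ.+ coeffs f i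
  coeffs (k :• e)  = λ i → k ℤ.* coeffs e i
  coeffs (:- e)    = λ i → ℤ.-1ℤ ℤ.* coeffs e i

  coeffs-correct : ∀ {n} (e : Expr n) ρ → ev (coeffs e) (Vec.lookup ρ) ≈ evalₑ e ρ
  coeffs-correct (varₑ i)  ρ = ev-unit i (Vec.lookup ρ)
  coeffs-correct :0        ρ = ev-0 (Vec.lookup ρ)
  coeffs-correct (e :+ f)  ρ = trans (ev-+ (coeffs e) (coeffs f) _)
    (⊕-cong (coeffs-correct e ρ) (coeffs-correct f ρ))
  coeffs-correct (k :• e)  ρ = trans (ev-* k (coeffs e) _) (•-congˡ k (coeffs-correct e ρ))
  coeffs-correct (:- e)    ρ = trans (ev-* ℤ.-1ℤ (coeffs e) _)
    (⊖-cong (trans (⊕-identityʳ _) (coeffs-correct e ρ)))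

  open Reflection setoid varₑ evalₑ
    (λ e ρ → ev (Vec.lookup (Vec.tabulate (coeffs e))) (Vec.lookup ρ))
    (λ e ρ → trans (ev-cong (Vec.lookup∘tabulate (coeffs e)) (λ _ → refl)) (coeffs-correct e ρ))
    public using (solve; _⊜_)

-- Consequences of the axioms in a model

module ThreeGroups (M : Structure) (isM : IsModel 3G M) where
  open Structure M public
  open Semantics M public
  open IsModel isM public

  -- Double negation relative to `R`: case distinctions are available under it, and stable goals can
  -- leave it.
  T : Set → Set
  T A = (A → R) → R

  em : ∀ (A : Set) → T (A ⊎ (A → R))
  em A k = k (inj₂ λ a → k (inj₁ a))

  Eq-sym : ∀ {x y} → Eq x y → Eq y x
  Eq-sym {x} p = leibniz (x₀ ≐ x₁) (x F.∷ ε) p (eq-refl x)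

  Eq-trans : ∀ {x y z} → Eq x y → Eq y z → Eq x z
  Eq-trans {x} p q = leibniz (x₁ ≐ x₀) (x F.∷ ε) q p

  plus-cong : ∀ {x x′ y y′} → Eq x x′ → Eq y y′ → Eq (plus x y) (plus x′ y′)
  plus-cong {x} {x′} {y} {y′} p q = Eq-trans
    (leibniz (x₁ + x₂ ≐ x₀ + x₂) (x F.∷ y F.∷ ε) p (eq-refl _))
    (leibniz (x₁ + x₂ ≐ x₁ + x₀) (x′ F.∷ y F.∷ ε) q (eq-refl _))

  abstract
    negate : D → D
    negate x = proj₁ (witness (x₁ + x₀ ≐ `0) (x F.∷ ε))

    negate-inverse : ∀ x → Eq (plus x (negate x)) 0#
    negate-inverse x = proj₂ (witness (x₁ + x₀ ≐ `0) (x F.∷ ε)) (axioms Q-inverse ε x)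

  negate-cong : ∀ {x y} → Eq x y → Eq (negate x) (negate y)
  negate-cong {x} {y} p = Eq-trans (Eq-sym (identity (negate x)))
    (Eq-trans (plus-cong (eq-refl _) (Eq-sym (negate-inverse y)))
    (Eq-trans (Eq-sym (axioms Q-assoc ε _ _ _))
    (Eq-trans (plus-cong (Eq-trans (plus-cong (eq-refl _) (Eq-sym p))
        (Eq-trans (comm _ _) (negate-inverse x))) (eq-refl _))
    (Eq-trans (comm _ _) (identity _)))))
    where identity = axioms Q-identity ε
          comm = axioms Q-comm ε

  group : AbelianGroup 0ℓ 0ℓ
  group = record
    { Carrier = D ; _≈_ = Eq ; _∙_ = plus ; ε = 0# ; _⁻¹ = negate
    ; isAbelianGroup = record
      { isGroup = record
        { isMonoid = record
          { isSemigroup = record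
            { isMagma = record
              { isEquivalence = record { refl = eq-refl _ ; sym = Eq-sym ; trans = Eq-trans }
              ; ∙-cong = plus-cong }
            ; assoc = axioms Q-assoc ε }
          ; identity = (λ x → Eq-trans (comm 0# x) (identity x)) , identity }
        ; inverse = (λ x → Eq-trans (comm _ x) (negate-inverse x)) , negate-inverse
        ; ⁻¹-cong = negate-cong }
      ; comm = comm } }
    where identity = axioms Q-identity ε
          comm = axioms Q-comm ε

  open IntegerAction group public hiding (D)

  𝟙 : D
  𝟙 = 1#

  -- Nonnegativity, put negatively so that it is stable by its form. Inequalities are expressed as
  -- `N` of a difference, which reduces most order arguments to `N-⊕` and the solver.
  N : D → Set
  N x = Lt x 𝟘 → R

  stable-N : ∀ {x} → T (N x) → N x
  stable-N f lt = f λ n → n lt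

  stable-Eq : ∀ {x y} → T (x ≈ y) → x ≈ y
  stable-Eq {x} {y} = stable (x₀ ≐ x₁) (x F.∷ y F.∷ ε)

  stable-Z : ∀ {x} → T (IsZ x) → IsZ x
  stable-Z {x} = stable (Z x₀) (x F.∷ ε)

  stable-L : ∀ {x} → T (IsL x) → IsL x
  stable-L {x} = stable (L x₀) (x F.∷ ε)

  Z-resp : ∀ {x y} → x ≈ y → IsZ x → IsZ y
  Z-resp = leibniz (Z x₀) ε

  L-resp : ∀ {x y} → x ≈ y → IsL x → IsL y
  L-resp = leibniz (L x₀) ε

  Lt-resp : ∀ {x x′ y y′} → x ≈ x′ → y ≈ y′ → Lt x y → Lt x′ y′
  Lt-resp {x} {x′} {y} p q lt = leibniz (x₁ < x₀) (x′ F.∷ ε) q (leibniz (x₀ < x₁) (y F.∷ ε) p lt)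

  N-resp : ∀ {x y} → x ≈ y → N x → N y
  N-resp p n lt = n (Lt-resp (sym p) refl lt)

  irrefl : ∀ {x} → Lt x x → R
  irrefl = axioms Q-irrefl ε _

  Lt-trans : ∀ {x y z} → Lt x y → Lt y z → Lt x z
  Lt-trans p q = axioms Q-trans ε _ _ _ (p , q)

  Lt-mono : ∀ {x y} z → Lt x y → Lt (x ⊕ z) (y ⊕ z)
  Lt-mono z = axioms Q-mono ε _ _ z

  compare : ∀ x y → (Lt x y → R) → (x ≈ y → R) → (Lt y x → R) → R
  compare x y f g h = axioms Q-total ε x y f λ k → k g h

  N-⊕ : ∀ {x y} → N x → N y → N (x ⊕ y)
  N-⊕ {x} {y} nx ny lt = compare y 𝟘 ny
    (λ y≈0 → nx (Lt-resp (trans (⊕-congˡ y≈0) (⊕-identityʳ x)) refl lt))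
    (λ 0<y → nx (Lt-trans (Lt-resp (⊕-identityˡ x) (⊕-comm y x) (Lt-mono x 0<y)) lt))

  N-𝟘 : N 𝟘
  N-𝟘 = irrefl

  Lt-⊖ : ∀ {x} → Lt x 𝟘 → Lt 𝟘 (⊖ x)
  Lt-⊖ {x} lt = Lt-resp (⊕-inverseʳ x) (⊕-identityˡ _) (Lt-mono (⊖ x) lt)

  N-total : ∀ x → T (N x ⊎ N (⊖ x))
  N-total x k = em (N x) λ
    { (inj₁ n) → k (inj₁ n)
    ; (inj₂ ¬n) → k (inj₂ λ lt → ¬n λ lt′ → irrefl (Lt-trans lt (Lt-⊖ lt′))) }

  N-antisym : ∀ {x} → N x → N (⊖ x) → x ≈ 𝟘
  N-antisym {x} n n′ = stable-Eq λ k → compare x 𝟘 n k λ 0<x →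
    n′ (Lt-resp (⊕-identityˡ _) (⊕-inverseʳ x) (Lt-mono (⊖ x) 0<x))

  Lt⇒¬N : ∀ {x y} → Lt x y → N (x ⊝ y) → R
  Lt⇒¬N {x} {y} lt n = n (Lt-resp refl (⊕-inverseʳ y) (Lt-mono (⊖ y) lt))

  ¬N⇒Lt : ∀ {x y} → (N (x ⊝ y) → R) → Lt x y
  ¬N⇒Lt {x} {y} ¬n = stable (x₀ < x₁) (x F.∷ y F.∷ ε) λ k → ¬n λ lt → k
    (Lt-resp (solve 2 (λ x y → (x :- y) :+ y ⊜ x) refl x y) (⊕-identityˡ y) (Lt-mono y lt))

  Le : D → D → Set
  Le x y = (Lt x y → R) → (x ≈ y → R) → R

  N-≈ : ∀ {x y} → x ≈ y → N (y ⊝ x)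
  N-≈ {x} {y} e = N-resp (trans (sym (⊕-inverseʳ x)) (⊕-congʳ e)) N-𝟘

  Le⇒N : ∀ {x y} → Le x y → N (y ⊝ x)
  Le⇒N {x} {y} le lt = le
    (λ lt′ → irrefl (Lt-trans lt′
      (Lt-resp (solve 2 (λ x y → (y :- x) :+ x ⊜ y) refl x y) (⊕-identityˡ x) (Lt-mono x lt))))
    (λ e → N-≈ e lt)

  N⇒Le : ∀ {x y} → N (y ⊝ x) → Le x y
  N⇒Le {x} {y} n f g = compare x y f g λ lt → Lt⇒¬N lt n

  pos-⊖𝟙 : N (⊖ 𝟙) → R
  pos-⊖𝟙 n = Lt⇒¬N (axioms 0<1 ε) (N-resp (sym (⊕-identityˡ _)) n)

  N-𝟙 : N 𝟙
  N-𝟙 lt = irrefl (Lt-trans (axioms 0<1 ε) lt)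

  Z-𝟘 : IsZ 𝟘
  Z-𝟘 = axioms Z-zero ε

  Z-𝟙 : IsZ 𝟙
  Z-𝟙 = axioms Z-one ε

  Z-⊕ : ∀ {x y} → IsZ x → IsZ y → IsZ (x ⊕ y)
  Z-⊕ p q = axioms Z-+ ε _ _ (p , q)

  Z-⊖ : ∀ {x} → IsZ x → IsZ (⊖ x)
  Z-⊖ {x} p = axioms Z-inverse ε x (⊖ x) (p , ⊕-inverseʳ x)

  L-𝟘 : IsL 𝟘
  L-𝟘 = axioms L-zero ε

  L-𝟙 : IsL 𝟙
  L-𝟙 = axioms L-one ε

  L-⊕ : ∀ {x y} → IsL x → IsL y → IsL (x ⊕ y)
  L-⊕ p q = axioms L-+ ε _ _ (p , q)

  L-⊖ : ∀ {x} → IsL x → IsL (⊖ x)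
  L-⊖ {x} p = axioms L-inverse ε x (⊖ x) (p , ⊕-inverseʳ x)

  •-closed : (P : D → Set) → P 𝟘 → (∀ {x y} → P x → P y → P (x ⊕ y)) → ∀ n {x} → P x → P (+ n • x)
  •-closed P p0 p+ zero    p = p0
  •-closed P p0 p+ (suc n) p = p+ p (•-closed P p0 p+ n p)

  N-• : ∀ n {x} → N x → N (+ n • x)
  N-• = •-closed N N-𝟘 N-⊕

  Z-• : ∀ k {x} → IsZ x → IsZ (k • x)
  Z-• (+ n)    p = •-closed IsZ Z-𝟘 Z-⊕ n p
  Z-• -[1+ n ] p = Z-⊖ (•-closed IsZ Z-𝟘 Z-⊕ (suc n) p)

  L-• : ∀ k {x} → IsL x → IsL (k • x)
  L-• (+ n)    p = •-closed IsL L-𝟘 L-⊕ n p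
  L-• -[1+ n ] p = L-⊖ (•-closed IsL L-𝟘 L-⊕ (suc n) p)

  L-convex′ : ∀ {x y} → N x → N (y ⊝ x) → IsL y → IsL x
  L-convex′ {x} {y} n n′ p = axioms L-convex ε 𝟘 x y
    (L-𝟘 , p , N⇒Le (N-resp (solve 1 (λ x → x ⊜ x :- :0) refl x) n) , N⇒Le n′)

  Z-least′ : ∀ {x} → IsZ x → (N (⊖ x) → R) → N (x ⊝ 𝟙)
  Z-least′ {x} p ¬n = Le⇒N (axioms Z-least ε x (p , ¬N⇒Lt λ n → ¬n (N-resp (⊕-identityˡ _) n)))

  -- If `x ≤ 0`, adding `n` times `- x` to the nonnegative multiple leaves `x` itself nonnegative.
  N-cancel : ∀ n {x} → N (+ suc n • x) → N x
  N-cancel n {x} h = stable-N λ k → N-total x λ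
    { (inj₁ p) → k p
    ; (inj₂ p) → k (N-resp (trans (⊕-congˡ (•-⊖ (+ n) x))
        (solve 2 (λ x y → (x :+ y) :- y ⊜ x) refl x (+ n • x))) (N-⊕ h (N-• n p))) }

  •-cancel : ∀ n {x y} → + suc n • x ≈ + suc n • y → x ≈ y
  •-cancel n {x} {y} e = trans (solve 2 (λ x y → x ⊜ (x :- y) :+ y) refl x y)
    (trans (⊕-congʳ (N-antisym (below x y e)
      (N-resp (solve 2 (λ x y → y :- x ⊜ :- (x :- y)) refl x y) (below y x (sym e)))))
        (⊕-identityˡ y))
    where
    below : ∀ x y → + suc n • x ≈ + suc n • y → N (x ⊝ y)
    below x y e = N-cancel n
      (N-resp (sym (trans (•-⊕ (+ suc n) x (⊖ y)) (⊕-congˡ (•-⊖ (+ suc n) y))))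
        (N-≈ (sym e)))

  -- By convexity, as `0 ≤ x ≤ (n + 1) x` for nonnegative `x`.
  L-cancel : ∀ n {x} → IsL (+ suc n • x) → IsL x
  L-cancel n {x} h = stable-L λ k → N-total x λ
    { (inj₁ p) → k (pos p h)
    ; (inj₂ p) → k (L-resp (solve 1 (λ x → :- :- x ⊜ x) refl x)
      (L-⊖ (pos p (L-resp (sym (•-⊖ (+ suc n) x)) (L-⊖ h))))) }
    where
    pos : ∀ {x} → N x → IsL (+ suc n • x) → IsL x
    pos {x} p = L-convex′ p
      (N-resp (solve 2 (λ x y → y ⊜ (x :+ y) :- x) refl x (+ n • x)) (N-• n p))

  ⟦·⟧ : ∀ m {n} (t : Term n) ρ → ⟦ m · t ⟧ₜ ρ ≡ + m • ⟦ t ⟧ₜ ρ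
  ⟦·⟧ zero    t ρ = ≡.refl
  ⟦·⟧ (suc m) t ρ = ≡.cong (⟦ t ⟧ₜ ρ ⊕_) (⟦·⟧ m t ρ)

  abstract
    div : ℕ → D → D
    div m x = proj₁ (witness (suc m · x₀ ≐ x₁) (x F.∷ ε))

    div-correct : ∀ m x → + suc m • div m x ≈ x
    div-correct m x = trans (reflexive (≡.sym (⟦·⟧ (suc m) x₀ (div m x F.∷ x F.∷ ε))))
      (proj₂ (witness (suc m · x₀ ≐ x₁) (x F.∷ ε)) (axioms (Q-divisible m) ε x))

  Floor : D → D → Set
  Floor z x = IsZ z × N (x ⊝ z) × (N ((x ⊝ z) ⊝ 𝟙) → R)

  Floor⇐ : ∀ {z x} → IsZ z × Le z x × Lt x (z ⊕ 𝟙) → Floor z x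
  Floor⇐ {z} {x} (p , le , lt) = p , Le⇒N le , λ n → Lt⇒¬N lt
    (N-resp (solve 3 (λ x z o → x :- z :- o ⊜ x :- (z :+ o)) refl x z 𝟙) n)

  Floor⇒ : ∀ {z x} → Floor z x → IsZ z × Le z x × Lt x (z ⊕ 𝟙)
  Floor⇒ {z} {x} (p , n , ¬n) = p , N⇒Le n , ¬N⇒Lt λ n → ¬n
    (N-resp (solve 3 (λ x z o → x :- (z :+ o) ⊜ x :- z :- o) refl x z 𝟙) n)

  -- The floor is `n - 1` or `n`, or else `n + 1` in the boundary case `x = n + 1`.
  floor-near : ∀ {n x} → IsZ n → N ((n ⊕ 𝟙) ⊝ x) → N ((x ⊕ 𝟙) ⊝ n) → T (∃[ z ] Floor z x)
  floor-near {n} {x} p n≥ n≤ k = em (N (x ⊝ n ⊝ 𝟙)) λ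
    { (inj₁ h) → k (n ⊕ 𝟙 , Z-⊕ p Z-𝟙
        , N-resp (solve 3 (λ x z o → x :- z :- o ⊜ x :- (z :+ o)) refl x n 𝟙) h
        , λ h′ → pos-⊖𝟙 (N-resp
          (solve 3 (λ x z o → ((z :+ o) :- x) :+ (x :- (z :+ o) :- o) ⊜ :- o) refl x n 𝟙)
            (N-⊕ n≥ h′)))
    ; (inj₂ ¬h) → em (N (x ⊝ n)) λ
      { (inj₁ h) → k (n , p , h , ¬h)
      ; (inj₂ ¬h′) → k (n ⊝ 𝟙 , Z-⊕ p (Z-⊖ Z-𝟙)
          , N-resp (solve 3 (λ x z o → x :+ o :- z ⊜ x :- (z :- o)) refl x n 𝟙) n≤
          , λ h → ¬h′ (N-resp (solve 3 (λ x z o → x :- (z :- o) :- o ⊜ x :- z) refl x n 𝟙) h)) } }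

  abstract
    fl : D → D
    fl x = proj₁ (witness (x₀ ≐⌊ x₁ ⌋) (x F.∷ ε))

    floor : ∀ x → Floor (fl x) x
    floor x = Floor⇐ (proj₂ (witness (x₀ ≐⌊ x₁ ⌋) (x F.∷ ε)) λ none →
      axioms Z-integer ε x λ { n (p , le , le′) →
        floor-near p (Le⇒N le) (Le⇒N le′) λ { (z , f) → none z (Floor⇒ f) } })

  floor-unique : ∀ {z w x} → Floor z x → Floor w x → z ≈ w
  floor-unique {z} {w} {x} f g = trans (solve 2 (λ z w → z ⊜ (z :- w) :+ w) refl z w)
    (trans (⊕-congʳ (N-antisym (above f g)
      (N-resp (solve 2 (λ z w → w :- z ⊜ :- (z :- w)) refl z w) (above g f)))) (⊕-identityˡ w))
    where
    above : ∀ {z w} → Floor z x → Floor w x → N (z ⊝ w)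
    above {z} {w} (p , n , ¬n) (q , m , ¬m) = stable-N λ k → em (N (z ⊝ w)) λ
      { (inj₁ h) → k h
      ; (inj₂ ¬h) → ¬n (N-resp
        (solve 4 (λ x z w o → (w :- z :- o) :+ (x :- w) ⊜ x :- z :- o) refl x z w 𝟙)
         (N-⊕ (Z-least′ (Z-⊕ q (Z-⊖ p))
           (λ h → ¬h (N-resp (solve 2 (λ z w → :- (w :- z) ⊜ z :- w) refl z w) h))) m)) }

  fr : D → D
  fr x = x ⊝ fl x

-- Syntax of the quantifier elimination

data BF (A : Set) : Set where
  at      : A → BF A
  ff      : BF A
  neg     : BF A → BF A
  and or  : BF A → BF A → BF A

bind : ∀ {A B} → BF A → (A → BF B) → BF B
bind (at a)    f = f a
bind ff        f = ff
bind (neg φ)   f = neg (bind φ f)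
bind (and φ ψ) f = and (bind φ f) (bind ψ f)
bind (or φ ψ)  f = or (bind φ f) (bind ψ f)

atoms : ∀ {A} → BF A → List A
atoms (at a)    = a ∷ []
atoms ff        = []
atoms (neg φ)   = atoms φ
atoms (and φ ψ) = atoms φ ++ atoms ψ
atoms (or φ ψ)  = atoms φ ++ atoms ψ

mapB : ∀ {A B} → (A → B) → BF A → BF B
mapB f φ = bind φ (at ∘ f)

atoms-mapB : ∀ {A B} (f : A → B) φ → atoms (mapB f φ) ≡ map f (atoms φ)
atoms-mapB f (at a)    = ≡.refl
atoms-mapB f ff        = ≡.refl
atoms-mapB f (neg φ)   = atoms-mapB f φ
atoms-mapB f (and φ ψ) = ≡.trans (≡.cong₂ _++_ (atoms-mapB f φ) (atoms-mapB f ψ))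
  (≡.sym (map-++ f (atoms φ) (atoms ψ)))
atoms-mapB f (or φ ψ)  = ≡.trans (≡.cong₂ _++_ (atoms-mapB f φ) (atoms-mapB f ψ))
  (≡.sym (map-++ f (atoms φ) (atoms ψ)))

⋁ : ∀ {A X : Set} → List X → (X → BF A) → BF A
⋁ []       f = ff
⋁ (x ∷ xs) f = or (f x) (⋁ xs f)

-- Affine forms c + Σᵢ aᵢ xᵢ

LF : ℕ → Set
LF p = ℤ × Vector ℤ p

infixl 6 _+L_
infixr 7 _*L_

_+L_ : ∀ {p} → LF p → LF p → LF p
(c , a) +L (d , b) = c ℤ.+ d , λ i → a i ℤ.+ b i

_*L_ : ∀ {p} → ℤ → LF p → LF p
k *L (c , a) = k ℤ.* c , λ i → k ℤ.* a i

constL : ∀ {p} → ℤ → LF p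
constL c = c , λ _ → 0ℤ

varL : ∀ {p} → Fin p → LF p
varL i = 0ℤ , unit i

headL : ∀ {p} → LF (suc p) → ℤ
headL (c , a) = a zero

tailL : ∀ {p} → LF (suc p) → LF p
tailL (c , a) = c , a ∘ suc

-- Denominators and moduli are given by their predecessors.

infixl 7 _⊗_
_⊗_ : ℕ → ℕ → ℕ
m ⊗ n = n ℕ.+ m ℕ.* suc n

-- A multiple of the form at the point τ / d
substL : ∀ {p} → LF p → ℕ → LF (suc p) → LF p
substL τ d ℓ = headL ℓ *L τ +L + suc d *L tailL ℓ

Point : ℕ → Set
Point p = LF p × ℕ

-- The point where h x + s vanishes; 0 if h is 0
root : ∀ {p} → ℤ → LF p → Point p
root (+ zero)  s = constL 0ℤ , 0
root (+ suc n) s = ℤ.-1ℤ *L s , n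
root -[1+ n ]  s = s , n

rootL : ∀ {p} → LF (suc p) → Point p
rootL ℓ = root (headL ℓ) (tailL ℓ)

-- The numerator of the sum of two fractions. The halving is left to the denominator, where it is
-- the final `⊗ 1`.
midForm : ∀ {p} → Point p → Point p → LF p
midForm (τ , d) (τ′ , d′) = + suc d′ *L τ +L + suc d *L τ′

midDenominator : ∀ {p} → Point p → Point p → ℕ
midDenominator (τ , d) (τ′ , d′) = d ⊗ d′ ⊗ 1

-- The p integral variables stand for floors ⌊x⌋, the q fractional ones for {x}: geZ, inL and
-- dvd (divisibility by m + 1) constrain the former, geF the latter.
data Atom (p q : ℕ) : Set where
  geZ inL : LF p → Atom p q
  dvd     : ℕ → LF p → Atom p q
  geF     : LF q → Atom p q
  QL      : Atom p q

-- `substL` multiplies a form by `suc d`. Sign and membership in `L` are unaffected by this; for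
-- divisibility the modulus is multiplied as well.
substZ : ∀ {p q} → LF p → ℕ → Atom (suc p) q → Atom p q
substZ τ d (geZ ℓ)   = geZ (substL τ d ℓ)
substZ τ d (inL ℓ)   = inL (substL τ d ℓ)
substZ τ d (dvd m ℓ) = dvd (m ⊗ d) (substL τ d ℓ)
substZ τ d (geF ℓ)   = geF ℓ
substZ τ d QL        = QL

substF : ∀ {p q} → LF q → ℕ → Atom p (suc q) → Atom p q
substF τ d (geZ ℓ)   = geZ ℓ
substF τ d (inL ℓ)   = inL ℓ
substF τ d (dvd m ℓ) = dvd m ℓ
substF τ d (geF ℓ)   = geF (substL τ d ℓ)
substF τ d QL        = QL

-- Atoms without a form to solve get the default point 0: additional points only refine the
-- subdivision.
rootZ : ∀ {p q} → Atom (suc p) q → Point p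
rootZ (geZ ℓ)   = rootL ℓ
rootZ (inL ℓ)   = rootL ℓ
rootZ (dvd m ℓ) = constL 0ℤ , 0
rootZ (geF ℓ)   = constL 0ℤ , 0
rootZ QL        = constL 0ℤ , 0

rootF : ∀ {p q} → Atom p (suc q) → Point q
rootF (geZ ℓ)   = constL 0ℤ , 0
rootF (inL ℓ)   = constL 0ℤ , 0
rootF (dvd m ℓ) = constL 0ℤ , 0
rootF (geF ℓ)   = rootL ℓ
rootF QL        = constL 0ℤ , 0

-- The eliminated variable ranges over [0, 1).
boxed : ∀ {p q} → BF (Atom p (suc q)) → BF (Atom p (suc q))
boxed φ = and φ (and (at (geF (varL zero))) (neg (at (geF (varL zero +L constL ℤ.-1ℤ)))))

-- Through `boxed` the roots 0 and 1 are among the points, so every element of [0, 1) lies between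
-- two of them and no limits at infinity arise.
pointsF : ∀ {p q} → BF (Atom p (suc q)) → List (Point q)
pointsF φ = map rootF (atoms (boxed φ))

elimF : ∀ {p q} → BF (Atom p (suc q)) → BF (Atom p q)
elimF φ = ⋁ (pointsF φ) λ P → ⋁ (pointsF φ) λ P′ →
  mapB (substF (midForm P P′) (midDenominator P P′)) (boxed φ)

-- The extra 0 keeps the list nonempty. For an `x` beyond all points, being off the L-coset of at
-- least one of them is what shows Q ≠ L.
pointsZ : ∀ {p q} → BF (Atom (suc p) q) → List (Point p)
pointsZ φ = (constL 0ℤ , 0) ∷ map rootZ (atoms φ)

modulus : ∀ {p q} → Atom p q → ℕ
modulus (dvd m ℓ) = m
modulus _         = 0

periodOf : ∀ {p q} → List (Atom p q) → ℕ
periodOf []       = 0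
periodOf (a ∷ as) = modulus a ⊗ periodOf as

period : ∀ {p q} → BF (Atom p q) → ℕ
period φ = periodOf (atoms φ)

-- The distance N + 1, where N is `suc (period φ)`, measured in units of the reciprocal of the
-- denominator. Rounding to a residue class moves by less than N, and 1 more serves to leave a root.
radius : ∀ {p q} → BF (Atom (suc p) q) → Point p → Point p → ℕ
radius φ P P′ = suc (midDenominator P P′) ℕ.* (2 ℕ.+ period φ)

-- As j ranges up to 2 * radius, these are the numerators over midDenominator P P′ of all
-- candidates at distance at most 2 + period φ from (P + P′) / 2.
nearForm : ∀ {p q} → BF (Atom (suc p) q) → Point p → Point p → ℕ → LF p
nearForm φ P P′ j = midForm P P′ +L constL (+ j ℤ.+ ℤ.- + radius φ P P′)

-- The divisibility condition says that the candidate, given as a fraction, is an integer.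
nearPoint : ∀ {p q} → BF (Atom (suc p) q) → Point p → Point p → ℕ → BF (Atom p q)
nearPoint φ P P′ j = and (at (dvd (midDenominator P P′) (nearForm φ P P′ j)))
  (mapB (substZ (nearForm φ P P′ j) (midDenominator P P′)) φ)

nearZ : ∀ {p q} → BF (Atom (suc p) q) → BF (Atom p q)
nearZ φ = ⋁ (pointsZ φ) λ P → ⋁ (pointsZ φ) λ P′ →
  ⋁ (allFin (suc (radius φ P P′ ℕ.+ radius φ P P′))) λ j → nearPoint φ P P′ (toℕ j)

-- Beyond all roots the sign of the leading coefficient decides an inequality, and a form with
-- nonzero leading coefficient is outside `L`, because `x` is outside the L-coset of its root.
infinityGe infinityL : ∀ {p q} → ℤ → LF p → BF (Atom p q)
infinityGe (+ zero)  s = at (geZ s)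
infinityGe (+ suc n) s = neg ff
infinityGe -[1+ n ]  s = ff
infinityL (+ zero)  s = at (inL s)
infinityL (+ suc n) s = ff
infinityL -[1+ n ]  s = ff

-- The limit of an atom at + ∞ along the residue class of r
infinity : ∀ {p q} → ℕ → Atom (suc p) q → BF (Atom p q)
infinity r (geZ ℓ)   = infinityGe (headL ℓ) (tailL ℓ)
infinity r (inL ℓ)   = infinityL (headL ℓ) (tailL ℓ)
infinity r (dvd m ℓ) = at (dvd (m ⊗ 0) (substL (constL (+ r)) 0 ℓ))
infinity r (geF ℓ)   = at (geF ℓ)
infinity r QL        = at QL

infiniteZ : ∀ {p q} → BF (Atom (suc p) q) → BF (Atom p q)
infiniteZ φ = and (neg (at QL)) (⋁ (allFin (suc (period φ))) λ r → bind φ (infinity (toℕ r)))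

-- Replacing `x` by `- x` turns the limit at - ∞ into the limit at + ∞.
flipL : ∀ {p} → LF (suc p) → LF (suc p)
flipL (c , a) = c , (ℤ.- a zero) F.∷ (a ∘ suc)

flip : ∀ {p q} → Atom (suc p) q → Atom (suc p) q
flip (geZ ℓ)   = geZ (flipL ℓ)
flip (inL ℓ)   = inL (flipL ℓ)
flip (dvd m ℓ) = dvd m (flipL ℓ)
flip (geF ℓ)   = geF ℓ
flip QL        = QL

elimZ : ∀ {p q} → BF (Atom (suc p) q) → BF (Atom p q)
elimZ φ = or (nearZ φ) (or (infiniteZ φ) (infiniteZ (mapB flip φ)))

infix 3 _↔_
_↔_ : Set → Set → Set
A ↔ B = (A → B) × (B → A)

↔-refl : ∀ {A} → A ↔ A
↔-refl = id , id

↔-sym : ∀ {A B} → A ↔ B → B ↔ A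
↔-sym (f , g) = g , f

↔-trans : ∀ {A B C} → A ↔ B → B ↔ C → A ↔ C
↔-trans (f , g) (h , k) = h ∘ f , g ∘ k

-- Truth of atoms and evaluation at fractions

module Elimination (M : Structure) (isM : IsModel 3G M) where
  open ThreeGroups M isM

  Sat : ∀ {A : Set} → BF A → (A → Set) → Set
  Sat (at a)    v = v a
  Sat ff        v = R
  Sat (neg φ)   v = Sat φ v → R
  Sat (and φ ψ) v = Sat φ v × Sat ψ v
  Sat (or φ ψ)  v = (Sat φ v → R) → (Sat ψ v → R) → R

  Sat-stable : ∀ {A} {v : A → Set} → (∀ a → T (v a) → v a) → ∀ φ → T (Sat φ v) → Sat φ v
  Sat-stable s (at a)    f = s a f
  Sat-stable s ff        f = f id
  Sat-stable s (neg φ)   f x = f λ g → g x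
  Sat-stable s (and φ ψ) f =
    Sat-stable s φ (λ k → f (k ∘ proj₁)) , Sat-stable s ψ (λ k → f (k ∘ proj₂))
  Sat-stable s (or φ ψ)  f g h = f λ k → k g h

  Sat-cong : ∀ {A} {v w : A → Set} φ → (∀ {a} → a ∈ atoms φ → v a ↔ w a) → Sat φ v ↔ Sat φ w
  Sat-cong (at a)    e = e (here ≡.refl)
  Sat-cong ff        e = ↔-refl
  Sat-cong (neg φ)   e with Sat-cong φ e
  ... | f , g = (λ h → h ∘ g) , (λ h → h ∘ f)
  Sat-cong (and φ ψ) e with Sat-cong φ (e ∘ ∈-++⁺ˡ) | Sat-cong ψ (e ∘ ∈-++⁺ʳ (atoms φ))
  ... | f , g | f′ , g′ = (λ { (x , y) → f x , f′ y }) , (λ { (x , y) → g x , g′ y })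
  Sat-cong (or φ ψ)  e with Sat-cong φ (e ∘ ∈-++⁺ˡ) | Sat-cong ψ (e ∘ ∈-++⁺ʳ (atoms φ))
  ... | f , g | f′ , g′ = (λ h k k′ → h (k ∘ f) (k′ ∘ f′)) , (λ h k k′ → h (k ∘ g) (k′ ∘ g′))

  Sat-bind : ∀ {A B} {v : B → Set} (f : A → BF B) φ →
             Sat (bind φ f) v ≡ Sat φ (λ a → Sat (f a) v)
  Sat-bind f (at a)    = ≡.refl
  Sat-bind f ff        = ≡.refl
  Sat-bind f (neg φ)   = ≡.cong (λ X → X → R) (Sat-bind f φ)
  Sat-bind f (and φ ψ) = ≡.cong₂ _×_ (Sat-bind f φ) (Sat-bind f ψ)
  Sat-bind f (or φ ψ)  = ≡.cong₂ (λ X Y → (X → R) → (Y → R) → R) (Sat-bind f φ) (Sat-bind f ψ)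

  Sat-bind-cong : ∀ {A B} {v : B → Set} {w : A → Set} (f : A → BF B) φ →
                  (∀ {a} → a ∈ atoms φ → Sat (f a) v ↔ w a) → Sat (bind φ f) v ↔ Sat φ w
  Sat-bind-cong {v = v} f φ e =
    ≡.subst (λ X → X ↔ _) (≡.sym (Sat-bind {v = v} f φ)) (Sat-cong φ e)

  ⋁-intro : ∀ {A X : Set} {v : A → Set} {xs : List X} (f : X → BF A) {x} →
            x ∈ xs → Sat (f x) v → Sat (⋁ xs f) v
  ⋁-intro         f (here ≡.refl) s g h = g s
  ⋁-intro {v = v} f (there p)     s g h = h (⋁-intro {v = v} f p s)

  ⋁-elim : ∀ {A X : Set} {v : A → Set} xs (f : X → BF A) → Sat (⋁ xs f) v → T (∃[ x ] Sat (f x) v)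
  ⋁-elim         []       f r k = r
  ⋁-elim {v = v} (x ∷ xs) f s k = s (λ y → k (x , y)) (λ y → ⋁-elim {v = v} xs f y k)

  evL : ∀ {p} → LF p → (Fin p → D) → D
  evL (c , a) z = c • 𝟙 ⊕ ev a z

  evL-cong : ∀ {p} (ℓ : LF p) {z w} → (∀ i → z i ≈ w i) → evL ℓ z ≈ evL ℓ w
  evL-cong (c , a) e = ⊕-congˡ (ev-cong (λ _ → ≡.refl) e)

  evL-+ : ∀ {p} (ℓ m : LF p) z → evL (ℓ +L m) z ≈ evL ℓ z ⊕ evL m z
  evL-+ (c , a) (d , b) z = trans (⊕-cong (+-• c d 𝟙) (ev-+ a b z)) (interchange _ _ _ _)

  evL-* : ∀ {p} k (ℓ : LF p) z → evL (k *L ℓ) z ≈ k • evL ℓ z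
  evL-* k (c , a) z = trans (⊕-cong (*-• k c 𝟙) (ev-* k a z)) (sym (•-⊕ k _ _))

  evL-const : ∀ {p} c (z : Fin p → D) → evL (constL c) z ≈ c • 𝟙
  evL-const c z = trans (⊕-congˡ (ev-0 z)) (⊕-identityʳ _)

  evL-var : ∀ {p} (i : Fin p) z → evL (varL i) z ≈ z i
  evL-var i z = trans (⊕-identityˡ _) (ev-unit i z)

  evL-∷ : ∀ {p} (ℓ : LF (suc p)) x z → evL ℓ (x F.∷ z) ≈ headL ℓ • x ⊕ evL (tailL ℓ) z
  evL-∷ (c , a) x z =
    solve 3 (λ c x e → c :+ (x :+ e) ⊜ x :+ (c :+ e)) refl (c • 𝟙) (a zero • x) (ev (a ∘ suc) z)

  •-swap : ∀ k l x → k • (l • x) ≈ l • (k • x)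
  •-swap k l x = trans (sym (*-• k l x)) (trans (•-congʳ x (ℤ.*-comm k l)) (*-• l k x))

  evL-subst : ∀ {p} (τ : LF p) d ℓ {x z} → + suc d • x ≈ evL τ z →
              evL (substL τ d ℓ) z ≈ + suc d • evL ℓ (x F.∷ z)
  evL-subst τ d ℓ {x} {z} e = trans (evL-+ (headL ℓ *L τ) (+ suc d *L tailL ℓ) z)
    (trans (⊕-cong (trans (evL-* (headL ℓ) τ z)
      (trans (•-congˡ (headL ℓ) (sym e)) (•-swap (headL ℓ) (+ suc d) x)))
        (evL-* (+ suc d) (tailL ℓ) z))
      (trans (sym (•-⊕ (+ suc d) _ _)) (•-congˡ (+ suc d) (sym (evL-∷ ℓ x z)))))

  Holds : ∀ {p q} → (Fin p → D) → (Fin q → D) → Atom p q → Set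
  Holds z f (geZ ℓ)   = N (evL ℓ z)
  Holds z f (inL ℓ)   = IsL (evL ℓ z)
  Holds z f (dvd m ℓ) = IsZ (div m (evL ℓ z))
  Holds z f (geF ℓ)   = N (evL ℓ f)
  Holds z f QL        = ∀ x → IsL x

  Holds-stable : ∀ {p q} (z : Fin p → D) (f : Fin q → D) a → T (Holds z f a) → Holds z f a
  Holds-stable z f (geZ ℓ)   = stable-N
  Holds-stable z f (inL ℓ)   = stable-L
  Holds-stable z f (dvd m ℓ) = stable-Z
  Holds-stable z f (geF ℓ)   = stable-N
  Holds-stable z f QL h x    = stable-L λ k → h λ g → k (g x)

  N-↔ : ∀ {x y} → x ≈ y → N x ↔ N y
  N-↔ e = N-resp e , N-resp (sym e)

  L-↔ : ∀ {x y} → x ≈ y → IsL x ↔ IsL y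
  L-↔ e = L-resp e , L-resp (sym e)

  Z-↔ : ∀ {x y} → x ≈ y → IsZ x ↔ IsZ y
  Z-↔ e = Z-resp e , Z-resp (sym e)

  N-scale : ∀ n {x y} → x ≈ + suc n • y → N x ↔ N y
  N-scale n e = (λ h → N-cancel n (N-resp e h)) , (λ h → N-resp (sym e) (N-• (suc n) h))

  L-scale : ∀ n {x y} → x ≈ + suc n • y → IsL x ↔ IsL y
  L-scale n e = (λ h → L-cancel n (L-resp e h)) , (λ h → L-resp (sym e) (L-• (+ suc n) h))

  div-unique : ∀ m {x y} → + suc m • y ≈ x → div m x ≈ y
  div-unique m {x} e = •-cancel m (trans (div-correct m x) (sym e))

  div-cong : ∀ m {x y} → x ≈ y → div m x ≈ div m y
  div-cong m {x} {y} e = div-unique m (trans (div-correct m y) (sym e))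

  ⊗-• : ∀ m n x → + suc (m ⊗ n) • x ≈ + suc m • (+ suc n • x)
  ⊗-• m n x = trans (•-congʳ x (ℤ.pos-* (suc m) (suc n))) (*-• (+ suc m) (+ suc n) x)

  div-⊗ : ∀ m d {x y} → x ≈ + suc d • y → div (m ⊗ d) x ≈ div m y
  div-⊗ m d {x} {y} e = div-unique (m ⊗ d) (trans (⊗-• m d (div m y))
    (trans (•-swap (+ suc m) (+ suc d) (div m y))
      (trans (•-congˡ (+ suc d) (div-correct m y)) (sym e))))

  Holds-cong : ∀ {p q} {z w : Fin p → D} {f g : Fin q → D} →
               (∀ i → z i ≈ w i) → (∀ i → f i ≈ g i) → ∀ a → Holds z f a ↔ Holds w g a
  Holds-cong e e′ (geZ ℓ)   = N-↔ (evL-cong ℓ e)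
  Holds-cong e e′ (inL ℓ)   = L-↔ (evL-cong ℓ e)
  Holds-cong e e′ (dvd m ℓ) = Z-↔ (div-cong m (evL-cong ℓ e))
  Holds-cong e e′ (geF ℓ)   = N-↔ (evL-cong ℓ e′)
  Holds-cong e e′ QL        = ↔-refl

  substZ-correct : ∀ {p q} (τ : LF p) d {x z} {f : Fin q → D} → + suc d • x ≈ evL τ z →
                   ∀ a → Holds z f (substZ τ d a) ↔ Holds (x F.∷ z) f a
  substZ-correct τ d e (geZ ℓ)   = N-scale d (evL-subst τ d ℓ e)
  substZ-correct τ d e (inL ℓ)   = L-scale d (evL-subst τ d ℓ e)
  substZ-correct τ d e (dvd m ℓ) = Z-↔ (div-⊗ m d (evL-subst τ d ℓ e))
  substZ-correct τ d e (geF ℓ)   = ↔-refl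
  substZ-correct τ d e QL        = ↔-refl

  substF-correct : ∀ {p q} (τ : LF q) d {x} {z : Fin p → D} {f} → + suc d • x ≈ evL τ f →
                   ∀ a → Holds z f (substF τ d a) ↔ Holds z (x F.∷ f) a
  substF-correct τ d e (geZ ℓ)   = ↔-refl
  substF-correct τ d e (inL ℓ)   = ↔-refl
  substF-correct τ d e (dvd m ℓ) = ↔-refl
  substF-correct τ d e (geF ℓ)   = N-scale d (evL-subst τ d ℓ e)
  substF-correct τ d e QL        = ↔-refl

  value : ∀ {p} → (Fin p → D) → Point p → D
  value z (τ , d) = div d (evL τ z)

  mid : D → D → D
  mid x y = div 1 (x ⊕ y)

  mid-correct : ∀ {p} (P P′ : Point p) z →
                + suc (midDenominator P P′) • mid (value z P) (value z P′) ≈ evL (midForm P P′) z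
  mid-correct (τ , d) (τ′ , d′) z = trans (⊗-• (d ⊗ d′) 1 _)
    (trans (•-congˡ (+ suc (d ⊗ d′)) (div-correct 1 _))
    (trans (•-⊕ (+ suc (d ⊗ d′)) _ _) (trans (⊕-cong
      (trans (⊗-• d d′ _) (trans (•-swap (+ suc d) (+ suc d′) _)
        (•-congˡ (+ suc d′) (div-correct d _))))
      (trans (⊗-• d d′ _) (•-congˡ (+ suc d) (div-correct d′ _))))
    (sym (trans (evL-+ (+ suc d′ *L τ) (+ suc d *L τ′) z)
      (⊕-cong (evL-* (+ suc d′) τ z) (evL-* (+ suc d) τ′ z)))))))

  -- A positive factor is invisible to `N` and `IsL`, so this reduces both kinds of atoms to the
  -- position of `x` relative to the root.
  root-pos : ∀ {p} n (s : LF p) x z → + suc n • x ⊕ evL s z ≈ + suc n •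
    (x ⊝ value z (root (+ suc n) s))
  root-pos n s x z = trans (⊕-congˡ (trans (solve 1 (λ s → s ⊜ :- (ℤ.-1ℤ :• s)) refl (evL s z))
      (trans (⊖-cong (trans (sym (evL-* ℤ.-1ℤ s z)) (sym (div-correct n _))))
        (sym (•-⊖ (+ suc n) _)))))
    (sym (•-⊕ (+ suc n) _ _))

  root-neg : ∀ {p} n (s : LF p) x z → -[1+ n ] • x ⊕ evL s z ≈ + suc n •
    (value z (root -[1+ n ] s) ⊝ x)
  root-neg n s x z = trans (⊕-comm _ _)
    (trans (⊕-cong (sym (div-correct n _)) (sym (•-⊖ (+ suc n) x)))
    (sym (•-⊕ (+ suc n) _ _)))

-- Position of an element relative to finitely many points

module Positions (M : Structure) (isM : IsModel 3G M) where
  open ThreeGroups M isM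
  open Elimination M isM

  mid-half : ∀ x y → + 2 • (mid x y ⊝ x) ≈ y ⊝ x
  mid-half x y = trans (solve 2 (λ x m → (+ 2) :• (m :- x) ⊜ (+ 2) :• m :- (+ 2) :• x) refl x
    (mid x y))
    (trans (⊕-congʳ (div-correct 1 _)) (solve 2 (λ x y → (x :+ y) :- (+ 2) :• x ⊜ y :- x) refl x y))

  mid-sym : ∀ x y → mid x y ⊝ x ≈ y ⊝ mid x y
  mid-sym x y = •-cancel 1 (trans (mid-half x y) (trans
    (solve 2 (λ x y → y :- x ⊜ (+ 2) :• y :- (x :+ y)) refl x y)
    (trans (⊕-congˡ (⊖-cong (sym (div-correct 1 _))))
      (solve 2 (λ y m → (+ 2) :• y :- (+ 2) :• m ⊜ (+ 2) :• (y :- m)) refl y (mid x y)))))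

  mid-idem : ∀ x → mid x x ≈ x
  mid-idem x = div-unique 1 (solve 1 (λ x → (+ 2) :• x ⊜ x :+ x) refl x)

  infix 4 _≪_ _≼_
  _≼_ _≪_ : D → D → Set
  x ≼ y = N (y ⊝ x)
  x ≪ y = y ≼ x → R

  ≼-trans : ∀ {x y z} → x ≼ y → y ≼ z → x ≼ z
  ≼-trans {x} {y} {z} p q = N-resp (solve 3 (λ x y z → (y :- x) :+ (z :- y) ⊜ z :- x) refl x y z)
    (N-⊕ p q)

  ≼-refl : ∀ {x} → x ≼ x
  ≼-refl {x} = N-≈ refl

  ≼-total : ∀ x y → T (x ≼ y ⊎ y ≼ x)
  ≼-total x y k = N-total (y ⊝ x) λ
    { (inj₁ n) → k (inj₁ n)
    ; (inj₂ n) → k (inj₂ (N-resp (solve 2 (λ x y → :- (y :- x) ⊜ x :- y) refl x y) n)) }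

  ≼-antisym : ∀ {x y} → x ≼ y → y ≼ x → x ≈ y
  ≼-antisym {x} {y} p q = trans (solve 2 (λ x y → x ⊜ (x :- y) :+ y) refl x y)
    (trans (⊕-congʳ (N-antisym q (N-resp (solve 2 (λ x y → y :- x ⊜ :- (x :- y)) refl x y) p)))
      (⊕-identityˡ y))

  ≪⇒≼ : ∀ {x y} → x ≪ y → x ≼ y
  ≪⇒≼ {x} {y} h = stable-N λ k → ≼-total x y λ { (inj₁ p) → k p ; (inj₂ p) → h p }

  ≪-≼-trans : ∀ {x y z} → x ≪ y → y ≼ z → x ≪ z
  ≪-≼-trans h p q = h (≼-trans p q)

  ≼-≪-trans : ∀ {x y z} → x ≼ y → y ≪ z → x ≪ z
  ≼-≪-trans p h q = h (≼-trans q p)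

  ≪-mid : ∀ {x y} → x ≪ y → x ≪ mid x y × mid x y ≪ y
  ≪-mid {x} {y} h = (λ n → h
    (back (N-resp (solve 2 (λ x m → x :- m ⊜ :- (m :- x)) refl x (mid x y)) n)))
                  , (λ n → h (back (N-resp
                    (trans (solve 2 (λ y m → m :- y ⊜ :- (y :- m)) refl y (mid x y))
                      (⊖-cong (sym (mid-sym x y)))) n)))
    where
    back : N (⊖ (mid x y ⊝ x)) → y ≼ x
    back n = N-resp (trans (•-⊖ (+ 2) _) (trans (⊖-cong (mid-half x y))
      (solve 2 (λ x y → :- (y :- x) ⊜ x :- y) refl x y))) (N-• 2 n)

  -- Both comparisons are needed, since a negative leading coefficient reverses the order.
  SameOrder : D → D → D → Set
  SameOrder x y p = (p ≼ x ↔ p ≼ y) × (x ≼ p ↔ y ≼ p)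

  SameCoset : D → D → D → Set
  SameCoset x y p = IsL (x ⊝ p) ↔ IsL (y ⊝ p)

  -- As `x` misses `p`, it lies strictly on one side of it, and the two implications transfer that
  -- side to `y`.
  same-order : ∀ {x y p} → (x ≈ p → R) → (p ≪ x → p ≪ y) → (x ≪ p → y ≪ p) → SameOrder x y p
  same-order {x} {y} {p} x≉p f g =
      ( (λ h → ≪⇒≼ (f λ h′ → x≉p (≼-antisym h′ h)))
      , (λ h → stable-N λ k → ≼-total p x λ { (inj₁ h′) → k h′ ; (inj₂ h′) → em (p ≼ x) λ
          { (inj₁ h″) → k h″ ; (inj₂ h″) → g h″ h } }) )
    , ( (λ h → ≪⇒≼ (g λ h′ → x≉p (≼-antisym h h′)))
      , (λ h → stable-N λ k → em (x ≼ p) λ { (inj₁ h′) → k h′ ; (inj₂ h′) → f h′ h }) )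

  same-coset : ∀ {x y p} → IsL (x ⊝ y) → SameCoset x y p
  same-coset {x} {y} {p} l =
      (λ h → L-resp (solve 3 (λ x y p → (x :- p) :- (x :- y) ⊜ y :- p) refl x y p) (L-⊕ h (L-⊖ l)))
    , (λ h → L-resp (solve 3 (λ x y p → (y :- p) :+ (x :- y) ⊜ x :- p) refl x y p) (L-⊕ h l))

  L-sym : ∀ {x y} → IsL (x ⊝ y) → IsL (y ⊝ x)
  L-sym {x} {y} h = L-resp (solve 2 (λ x y → :- (x :- y) ⊜ y :- x) refl x y) (L-⊖ h)

  L-between : ∀ {x y z} → x ≼ y → y ≼ z → IsL (z ⊝ x) → IsL (y ⊝ x)
  L-between {x} {y} {z} p q = L-convex′ p
    (N-resp (solve 3 (λ x y z → z :- y ⊜ (z :- x) :- (y :- x)) refl x y z) q)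

  L-between′ : ∀ {x y z} → x ≼ y → y ≼ z → IsL (z ⊝ x) → IsL (z ⊝ y)
  L-between′ {x} {y} {z} p q = L-convex′ q
    (N-resp (solve 3 (λ x y z → y :- x ⊜ (z :- x) :- (z :- y)) refl x y z) p)

  module _ {X : Set} (val : X → D) where

    -- Stated for an arbitrary total preorder, so that it gives the nearest point below as well as,
    -- with the order reversed, the nearest point above.
    greatest : (A : X → Set) (_⊑_ : X → X → Set) → (∀ {x y z} → x ⊑ y → y ⊑ z → x ⊑ z) →
               (∀ x y → T (x ⊑ y ⊎ y ⊑ x)) → ∀ ps →
               T ((∀ {p} → p ∈ ps → A p → R) ⊎
                  ∃[ p ] (p ∈ ps × A p × (∀ {p′} → p′ ∈ ps → A p′ → T (p′ ⊑ p))))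
    greatest A _⊑_ tr tot []       k = k (inj₁ λ ())
    greatest A _⊑_ tr tot (x ∷ ps) k = greatest A _⊑_ tr tot ps λ
      { (inj₁ none) → em (A x) λ
        { (inj₁ a)  → k (inj₂ (x , here ≡.refl , a , λ
            { (here ≡.refl) _ l → tot x x λ { (inj₁ s) → l s ; (inj₂ s) → l s }
            ; (there i) a′ _ → none i a′ }))
        ; (inj₂ ¬a) → k (inj₁ λ { (here ≡.refl) → ¬a ; (there i) → none i }) }
      ; (inj₂ (p , i , a , max)) → em (A x) λ
        { (inj₁ a′) → tot x p λ
          { (inj₁ x⊑p) → k (inj₂
            (p , there i , a , λ { (here ≡.refl) _ l → l x⊑p ; (there j) → max j }))
          ; (inj₂ p⊑x) → k (inj₂ (x , here ≡.refl , a′ , λ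
              { (here ≡.refl) _ l → tot x x λ { (inj₁ s) → l s ; (inj₂ s) → l s }
              ; (there j) a″ l → max j a″ λ s → l (tr s p⊑x) })) }
        ; (inj₂ ¬a) → k (inj₂ (p , there i , a , λ
            { (here ≡.refl) a′ _ → ¬a a′ ; (there j) → max j })) } }

    Lower Upper : List X → D → Set
    Lower ps x = (∀ {p} → p ∈ ps → x ≼ val p) ⊎
      ∃[ p ] (p ∈ ps × val p ≪ x × (∀ {p′} → p′ ∈ ps → val p′ ≪ x → val p′ ≼ val p))
    Upper ps x = (∀ {p} → p ∈ ps → val p ≼ x) ⊎
      ∃[ p ] (p ∈ ps × x ≪ val p × (∀ {p′} → p′ ∈ ps → x ≪ val p′ → val p ≼ val p′))

    lower : ∀ ps x → T (Lower ps x)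
    lower ps x k = greatest (λ p → val p ≪ x) (λ p q → val p ≼ val q) ≼-trans
      (λ p q → ≼-total (val p) (val q)) ps λ
      { (inj₁ none) → k (inj₁ λ i → stable-N (none i))
      ; (inj₂ (p , i , a , max)) → k (inj₂ (p , i , a , λ j a′ → stable-N (max j a′))) }

    upper : ∀ ps x → T (Upper ps x)
    upper ps x k = greatest (λ p → x ≪ val p) (λ p q → val q ≼ val p) (λ a b → ≼-trans b a)
      (λ p q → ≼-total (val q) (val p)) ps λ
      { (inj₁ none) → k (inj₁ λ i → stable-N (none i))
      ; (inj₂ (p , i , a , max)) → k (inj₂ (p , i , a , λ j a′ → stable-N (max j a′))) }

    hit : ∀ ps x → T ((∃[ p ] (p ∈ ps × x ≈ val p)) ⊎ (∀ {p} → p ∈ ps → x ≈ val p → R))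
    hit ps x k = k (inj₂ λ i e → k (inj₁ (_ , i , e)))

    -- A point `x` of the list is its own midpoint, so it can be paired with itself. Otherwise the
    -- nearest points on the two sides work: no point of the list separates `x` from their midpoint.
    same-mid : ∀ ps x → (∃[ p ] (p ∈ ps × val p ≼ x)) → (∃[ q ] (q ∈ ps × x ≼ val q)) →
               T (∃[ p ] ∃[ q ] (p ∈ ps × q ∈ ps ×
                  (∀ {p′} → p′ ∈ ps → SameOrder x (mid (val p) (val q)) (val p′))))
    same-mid ps x (p₀ , i₀ , le₀) (q₀ , j₀ , ge₀) k = hit ps x λ
      { (inj₁ (p , i , e)) → k (p , p , i , i , λ {p′} _ →
            same-≈ (trans e (sym (mid-idem (val p)))) (val p′))
      ; (inj₂ miss) → lower ps x λ
        { (inj₁ none) → miss i₀ (≼-antisym (none i₀) le₀)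
        ; (inj₂ (p , i , p≪x , max)) → upper ps x λ
          { (inj₁ none) → miss j₀ (≼-antisym ge₀ (none j₀))
          ; (inj₂ (q , j , x≪q , min)) → let p≪q = ≪-≼-trans p≪x (≪⇒≼ x≪q) in
              k (p , q , i , j , λ i′ → same-order (miss i′)
                (λ h → ≼-≪-trans (max i′ h) (proj₁ (≪-mid p≪q)))
                (λ h → ≪-≼-trans (proj₂ (≪-mid p≪q)) (min i′ h))) } } }
      where
      same-≈ : ∀ {x y} → x ≈ y → ∀ p → SameOrder x y p
      same-≈ e p = N-↔ (⊕-congʳ e) , N-↔ (⊕-congˡ (⊖-cong e))

-- Replacing an integer by a congruent one near a test point

module Integers (M : Structure) (isM : IsModel 3G M) where
  open ThreeGroups M isM
  open Elimination M isM
  open Positions M isM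

  Z-ev : ∀ {p} (ℓ : LF p) {z} → (∀ i → IsZ (z i)) → IsZ (evL ℓ z)
  Z-ev (c , a) h = Z-⊕ (Z-• c Z-𝟙) (go a h)
    where
    go : ∀ {p} (a : Vector ℤ p) {z} → (∀ i → IsZ (z i)) → IsZ (ev a z)
    go {zero}  a h = Z-𝟘
    go {suc p} a h = Z-⊕ (Z-• (a zero) (h zero)) (go (a ∘ suc) (h ∘ suc))

  -- A model may have nonstandard integers, but none between standard ones: by discreteness, an
  -- integer below `m + 1` is below `m` or equal to `m`. This is what makes finite disjunctions
  -- sufficient.
  bounded : ∀ k {w} → IsZ w → 𝟘 ≼ w → w ≪ + k • 𝟙 → T (∃[ j ] w ≈ + toℕ {k} j • 𝟙)
  bounded zero    p n ¬n k = ¬n n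
  bounded (suc m) {w} p n ¬n k = em (+ m • 𝟙 ≼ w) λ
    { (inj₁ h) → k (fromℕ m , trans (≼-antisym upper′ h)
      (•-congʳ 𝟙 (≡.cong +_ (≡.sym (Fin.toℕ-fromℕ m)))))
    ; (inj₂ h) → bounded m p n h λ
      { (j , e) → k (inject₁ j , trans e (•-congʳ 𝟙 (≡.cong +_ (≡.sym (Fin.toℕ-inject₁ j))))) } }
    where
    upper′ : w ≼ + m • 𝟙
    upper′ = N-resp (solve 3 (λ o m w → ((o :+ m) :- w) :- o ⊜ m :- w) refl 𝟙 (+ m • 𝟙) w)
      (Z-least′ (Z-⊕ (Z-⊕ Z-𝟙 (Z-• (+ m) Z-𝟙)) (Z-⊖ p)) λ n → ¬n (N-resp
        (solve 3 (λ o m w → :- ((o :+ m) :- w) ⊜ w :- (o :+ m)) refl 𝟙 (+ m • 𝟙) w) n))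

  fl-mono : ∀ {x} → 𝟘 ≼ x → 𝟘 ≼ fl x
  fl-mono {x} n with floor x
  ... | p , h , ¬h = stable-N λ k → em (𝟘 ≼ fl x) λ
    { (inj₁ g) → k g
    ; (inj₂ g) → ¬h (N-resp
      (solve 3 (λ x f o → (x :- :0) :+ (:- f :- o) ⊜ (x :- f) :- o) refl x (fl x) 𝟙)
        (N-⊕ n (Z-least′ (Z-⊖ p) λ g′ → g
          (N-resp (solve 1 (λ f → :- :- f ⊜ f :- :0) refl (fl x)) g′)))) }

  Congruent : ℕ → D → D → Set
  Congruent m x y = ∃[ w ] (IsZ w × x ⊝ y ≈ + suc m • w)

  -- The least y ≽ t in the congruence class of x
  round : ℕ → D → D → D
  round m t x = x ⊝ + suc m • fl (div m (x ⊝ t))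

  module _ (m : ℕ) (t x : D) where
    private
      u = div m (x ⊝ t)
      s = + suc m

    round-Z : IsZ x → IsZ (round m t x)
    round-Z p = Z-⊕ p (Z-⊖ (Z-• s (proj₁ (floor u))))

    round-≡ : Congruent m x (round m t x)
    round-≡ = fl u , proj₁ (floor u) , solve 2 (λ x y → x :- (x :- y) ⊜ y) refl x (s • fl u)

    private
      round-⊝ : round m t x ⊝ t ≈ s • (u ⊝ fl u)
      round-⊝ = trans (solve 3 (λ x y t → (x :- y) :- t ⊜ (x :- t) :- y) refl x (s • fl u) t)
        (trans (⊕-cong (sym (div-correct m _)) (sym (•-⊖ s _))) (sym (•-⊕ s _ _)))

    round-≽ : t ≼ round m t x
    round-≽ = N-resp (sym round-⊝) (N-• (suc m) (proj₁ (proj₂ (floor u))))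

    round-≪ : round m t x ≪ t ⊕ s • 𝟙
    round-≪ h = proj₂ (proj₂ (floor u)) (N-cancel m (N-resp
      (trans (solve 3 (λ y t o → y :- (t :+ o) ⊜ (y :- t) :- o) refl (round m t x) t (s • 𝟙))
        (trans (⊕-cong round-⊝ (sym (•-⊖ s 𝟙))) (sym (•-⊕ s _ _)))) h))

    -- `x` itself competes for being the least element of its class above `t`. In terms of the
    -- formula, the floor that is subtracted is nonnegative.
    round-≼ : t ≼ x → round m t x ≼ x
    round-≼ h = N-resp (solve 2 (λ x y → y ⊜ x :- (x :- y)) refl x (s • fl u))
      (N-• (suc m) (N-resp (solve 1 (λ f → f :- :0 ⊜ f) refl (fl u)) (fl-mono
        (N-resp (solve 1 (λ f → f ⊜ f :- :0) refl u)
          (N-cancel m (N-resp (sym (div-correct m _)) h))))))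

  Within : D → D → D → Set
  Within r c y = c ⊝ r ≼ y × y ≼ c ⊕ r

  module _ {X : Set} (val : X → D) (m : ℕ) (ps : List X) (x : D) where

    Same : D → Set
    Same y = ∀ {p} → p ∈ ps → SameOrder x y (val p) × SameCoset x y (val p)

    -- In `Near`, `y` replaces `x` and lies within a standard distance of a midpoint, where `p` and
    -- `q` may coincide. In the other two cases no standard distance is available, and only the
    -- limits of the atoms are used.
    Near Above Below : Set
    Near  = ∃[ y ] ∃[ p ] ∃[ q ] (p ∈ ps × q ∈ ps × IsZ y × Congruent m x y ×
              Within (+ suc (suc m) • 𝟙) (mid (val p) (val q)) y × Same y)
    Above = ∀ {p} → p ∈ ps → val p ≪ x × (IsL (x ⊝ val p) → R)
    Below = ∀ {p} → p ∈ ps → x ≪ val p × (IsL (x ⊝ val p) → R)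

    private
      s = + suc m
      r = + suc (suc m) • 𝟙

    within-≈ : ∀ {c c′ y} → c ≈ c′ → Within r c y → Within r c′ y
    within-≈ e (h , h′) = N-resp (⊕-congˡ (⊖-cong (⊕-congʳ e))) h , N-resp (⊕-congʳ (⊕-congʳ e)) h′

    near-self : ∀ {p} → p ∈ ps → IsZ x → Within r (val p) x → Near
    near-self {p} i z w = x , p , p , i , i , z
      , (𝟘 , Z-𝟘 , trans (⊕-inverseʳ x) (sym (•-𝟘 s)))
      , within-≈ (sym (mid-idem (val p))) w , λ _ → (↔-refl , ↔-refl) , ↔-refl

    -- Between `p` and `x` there is no further point, and by convexity everything there lies in one
    -- L-coset. So the least congruent `y` above `val p + 1` can replace `x`; if `x < val p + 1`,
    -- then `x` is close enough itself.
    near-lower : ∀ {p} → IsZ x → (∀ {p} → p ∈ ps → x ≈ val p → R) → p ∈ ps → val p ≪ x →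
                 (∀ {p′} → p′ ∈ ps → val p′ ≪ x → val p′ ≼ val p) → IsL (x ⊝ val p) → T Near
    near-lower {p} z miss i p≪x max l k = em (val p ⊕ 𝟙 ≼ x) λ
      { (inj₁ h) →
        -- Starting at distance 1 keeps `y` strictly above the root, which rounding from `val p`
        -- could hit.
        let t = val p ⊕ 𝟙
            y = round m t x
            p≪y : val p ≪ y
            p≪y g = pos-⊖𝟙 (N-resp
              (solve 3 (λ p y o → (p :- y) :+ (y :- (p :+ o)) ⊜ :- o) refl (val p) y 𝟙)
              (N-⊕ g (round-≽ m t x)))
            y≼x = round-≼ m t x h
        in k (y , p , p , i , i , round-Z m t x z , round-≡ m t x
             , within-≈ (sym (mid-idem (val p)))
                 ( ≼-trans (N-resp (solve 3 (λ p o s → s ⊜ p :- (p :- s)) refl (val p) 𝟙 r)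
                   (N-• (suc (suc m)) N-𝟙)) (≪⇒≼ p≪y)
                 , N-resp (solve 4 (λ p y o s → ((p :+ o) :+ s) :- y ⊜ (p :+ (o :+ s)) :- y) refl
                   (val p) y 𝟙 (s • 𝟙))
                     (≪⇒≼ (round-≪ m t x)))
             , λ j → same-order (miss j) (λ g → ≼-≪-trans (max j g) p≪y) (λ g → ≼-≪-trans y≼x g)
                   , same-coset (L-between′ (≪⇒≼ p≪y) y≼x l))
      ; (inj₂ h) → k (near-self i z
          ( ≼-trans (N-resp (solve 2 (λ p s → s ⊜ p :- (p :- s)) refl (val p) r)
            (N-• (suc (suc m)) N-𝟙)) (≪⇒≼ p≪x)
          , ≼-trans (≪⇒≼ h) (N-resp
            (solve 3 (λ p o s → s ⊜ (p :+ (o :+ s)) :- (p :+ o)) refl (val p) 𝟙 (s • 𝟙))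
              (N-• (suc m) N-𝟙)))) }

    -- The midpoint `c` is off the L-cosets of `p` and `q`: were `c - p` in `L`, so would be its
    -- double `q - p`, hence `x - p`. Being at a standard distance from `c`, `y` inherits this and
    -- stays between `p` and `q`. So neither `x` nor `y` is in the L-coset of any point.
    near-between : ∀ {p q} → IsZ x → (∀ {p} → p ∈ ps → x ≈ val p → R) →
                   p ∈ ps → val p ≪ x → (∀ {p′} → p′ ∈ ps → val p′ ≪ x → val p′ ≼ val p) →
                   q ∈ ps → x ≪ val q → (∀ {p′} → p′ ∈ ps → x ≪ val p′ → val q ≼ val p′) →
                   (IsL (x ⊝ val p) → R) → (IsL (val q ⊝ x) → R) → Near
    near-between {p} {q} z miss i p≪x max j x≪q min ¬lp ¬lq =
      y , p , q , i , j , round-Z m c x z , round-≡ m c x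
      , ( ≼-trans (N-resp (solve 2 (λ c r → r ⊜ c :- (c :- r)) refl c r) (N-• (suc (suc m)) N-𝟙))
        c≼y
        , ≼-trans y≼c+s (N-resp
          (solve 3 (λ c o s → o ⊜ (c :+ (o :+ s)) :- (c :+ s)) refl c 𝟙 (s • 𝟙)) N-𝟙))
      , λ i′ → same-order (miss i′) (λ g → ≼-≪-trans (max i′ g) p≪y)
        (λ g → ≪-≼-trans y≪q (min i′ g))
             , (λ l → absurd (off-x i′ l)) , (λ l → absurd (off-y i′ l))
      where
      c = mid (val p) (val q)
      y = round m c x
      c≼y = round-≽ m c x
      y≼c+s = ≪⇒≼ (round-≪ m c x)
      p≪q = ≪-≼-trans p≪x (≪⇒≼ x≪q)
      absurd : ∀ {a} → R → IsL a
      absurd h = stable-L λ _ → h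
      ¬h : IsL (c ⊝ val p) → R
      ¬h l = ¬lp (L-between (≪⇒≼ p≪x) (≪⇒≼ x≪q) (L-resp (mid-half _ _) (L-• (+ 2) l)))
      L-y-c : IsL (y ⊝ c)
      L-y-c = L-convex′ (N-resp refl c≼y)
        (N-resp (solve 3 (λ c s y → (c :+ s) :- y ⊜ s :- (y :- c)) refl c (s • 𝟙) y) y≼c+s)
          (L-• s L-𝟙)
      p≪y : val p ≪ y
      p≪y = ≪-≼-trans (proj₁ (≪-mid p≪q)) c≼y
      y≪q : y ≪ val q
      y≪q g = ¬h (L-resp (sym (mid-sym _ _)) (L-between (≪⇒≼ (proj₂ (≪-mid p≪q))) g L-y-c))
      ¬ly-p : IsL (y ⊝ val p) → R
      ¬ly-p l = ¬h (L-between (≪⇒≼ (proj₁ (≪-mid p≪q))) c≼y l)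
      ¬lq-y : IsL (val q ⊝ y) → R
      ¬lq-y l = ¬h (L-resp (trans
        (solve 3 (λ q y c → (q :- y) :+ (y :- c) ⊜ q :- c) refl (val q) y c) (sym (mid-sym _ _)))
          (L-⊕ l L-y-c))
      -- If `v` were in the L-coset of a farther point, convexity would put it in the coset of the
      -- neighbour on that side.
      off : ∀ {v} → (IsL (v ⊝ val p) → R) → (IsL (val q ⊝ v) → R) → val p ≼ v → v ≼ val q →
            ∀ {p′} → p′ ∈ ps → IsL (v ⊝ val p′) → R
      off {v} ¬l ¬l′ p≼v v≼q {p′} i′ l = em (val p′ ≪ x) λ
        { (inj₁ h) → ¬l (L-between′ (max i′ h) p≼v l)
        ; (inj₂ h) → em (x ≪ val p′) λ
          { (inj₁ h′) → ¬l′ (L-between v≼q (min i′ h′) (L-sym l))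
          ; (inj₂ h′) → miss i′ (≼-antisym (stable-N h) (stable-N h′)) } }
      off-x : ∀ {p′} → p′ ∈ ps → IsL (x ⊝ val p′) → R
      off-x = off ¬lp ¬lq (≪⇒≼ p≪x) (≪⇒≼ x≪q)
      off-y : ∀ {p′} → p′ ∈ ps → IsL (y ⊝ val p′) → R
      off-y = off ¬ly-p ¬lq-y (≪⇒≼ p≪y) (≪⇒≼ y≪q)

    near-upper : ∀ {q} → IsZ x → (∀ {p} → p ∈ ps → x ≈ val p → R) → q ∈ ps → x ≪ val q →
                 (∀ {p′} → p′ ∈ ps → x ≪ val p′ → val q ≼ val p′) → IsL (val q ⊝ x) → T Near
    near-upper {q} z miss i x≪q min l k = em (x ≼ val q ⊝ 𝟙) λ
      { (inj₁ h) →
        let t = val q ⊝ 𝟙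
            -- Rounding down is rounding up after negation.
            y′ = round m (⊖ t) (⊖ x)
            y = ⊖ y′
            y≼t : y ≼ t
            y≼t = N-resp (solve 2 (λ y t → y :- :- t ⊜ t :- :- y) refl y′ t) (round-≽ m (⊖ t) (⊖ x))
            y≪q : y ≪ val q
            y≪q g = pos-⊖𝟙 (N-resp
              (solve 3 (λ q y o → (y :- q) :+ ((q :- o) :- y) ⊜ :- o) refl (val q) y 𝟙)
              (N-⊕ g y≼t))
            x≼y : x ≼ y
            x≼y = N-resp (solve 2 (λ x y → :- x :- y ⊜ :- y :- x) refl x y′)
              (round-≼ m (⊖ t) (⊖ x) (N-resp (solve 2 (λ x t → t :- x ⊜ :- x :- :- t) refl x t) h))
        in k (y , q , q , i , i , Z-⊖ (round-Z m (⊖ t) (⊖ x) (Z-⊖ z))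
             , (let w , zw , e = round-≡ m (⊖ t) (⊖ x) in
                ⊖ w , Z-⊖ zw , trans (solve 2 (λ x y → x :- :- y ⊜ :- (:- x :- y)) refl x y′)
                  (trans (⊖-cong e) (sym (•-⊖ s w))))
             , within-≈ (sym (mid-idem (val q)))
                 ( N-resp (solve 4 (λ q y o s → (:- (q :- o) :+ s) :- y ⊜ :- y :- (q :- (o :+ s)))
                   refl (val q) y′ 𝟙 (s • 𝟙))
                     (≪⇒≼ (round-≪ m (⊖ t) (⊖ x)))
                 , ≼-trans (≪⇒≼ y≪q) (N-resp (solve 2 (λ q r → r ⊜ (q :+ r) :- q) refl (val q) r)
                   (N-• (suc (suc m)) N-𝟙)))
             , λ j → same-order (miss j) (λ g → ≪-≼-trans g x≼y) (λ g → ≪-≼-trans y≪q (min j g))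
                   , same-coset (L-sym (L-between x≼y (≪⇒≼ y≪q) l)))
      ; (inj₂ h) → k (near-self i z
          ( ≼-trans (N-resp (solve 3 (λ q o s → s ⊜ (q :- o) :- (q :- (o :+ s))) refl (val q) 𝟙
            (s • 𝟙)) (N-• (suc m) N-𝟙)) (≪⇒≼ h)
          , ≼-trans (≪⇒≼ x≪q) (N-resp (solve 2 (λ q r → r ⊜ (q :+ r) :- q) refl (val q) r)
            (N-• (suc (suc m)) N-𝟙)))) }

    -- The nearest points decide: by convexity, a farther point shares the L-coset of `x` only if
    -- the nearest one on its side does. The given member of the list settles the case with no point
    -- strictly on either side, where it would equal `x`.
    position : ∀ {p₀} → p₀ ∈ ps → IsZ x → T (Near ⊎ Above ⊎ Below)
    position i₀ z k = hit val ps x λ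
      { (inj₁ (p , i , e)) → k (inj₁ (near-self i z
            (within-≈ e ( N-resp (solve 2 (λ p r → r ⊜ p :- (p :- r)) refl x r)
              (N-• (suc (suc m)) N-𝟙)
                        , N-resp (solve 2 (λ p r → r ⊜ (p :+ r) :- p) refl x r)
                          (N-• (suc (suc m)) N-𝟙)))))
      ; (inj₂ miss) → lower val ps x λ
        { (inj₁ none) → upper val ps x λ
          { (inj₁ none′) → miss i₀ (≼-antisym (none i₀) (none′ i₀))
          ; (inj₂ (q , j , x≪q , min)) → em (IsL (val q ⊝ x)) λ
            { (inj₁ l) → near-upper z miss j x≪q min l (k ∘ inj₁)
            ; (inj₂ ¬l) → k (inj₂ (inj₂ λ i →
                let x≪ = λ g → miss i (≼-antisym (none i) g) in
                x≪ , λ l → ¬l (L-between (≪⇒≼ x≪q) (min i x≪) (L-sym l)))) } }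
        ; (inj₂ (p , i , p≪x , max)) → em (IsL (x ⊝ val p)) λ
          { (inj₁ l) → near-lower z miss i p≪x max l (k ∘ inj₁)
          ; (inj₂ ¬l) → upper val ps x λ
            { (inj₁ none) → k (inj₂ (inj₁ λ j →
                let ≪x = λ g → miss j (≼-antisym g (none j)) in
                ≪x , λ l → ¬l (L-between′ (max j ≪x) (≪⇒≼ p≪x) l)))
            ; (inj₂ (q , j , x≪q , min)) → em (IsL (val q ⊝ x)) λ
              { (inj₁ l) → near-upper z miss j x≪q min l (k ∘ inj₁)
              ; (inj₂ ¬l′) → k (inj₁ (near-between z miss i p≪x max j x≪q min ¬l ¬l′)) } } } } }

-- Correctness of the eliminations

module Correctness (M : Structure) (isM : IsModel 3G M) where
  open ThreeGroups M isM
  open Elimination M isM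
  open Positions M isM
  open Integers M isM

  Sat-run : ∀ {p q} {z : Fin p → D} {f : Fin q → D} φ → T (Sat φ (Holds z f)) → Sat φ (Holds z f)
  Sat-run {z = z} {f} = Sat-stable (Holds-stable z f)

  root-order : ∀ {p} h (s : LF p) {x y z} → SameOrder x y (value z (root h s)) →
               N (h • x ⊕ evL s z) ↔ N (h • y ⊕ evL s z)
  root-order (+ zero)  s         e = ↔-refl
  root-order (+ suc n) s {x} {y} {z} e =
    ↔-trans (N-scale n (root-pos n s x z))
      (↔-trans (proj₁ e) (↔-sym (N-scale n (root-pos n s y z))))
  root-order -[1+ n ]  s {x} {y} {z} e =
    ↔-trans (N-scale n (root-neg n s x z))
      (↔-trans (proj₂ e) (↔-sym (N-scale n (root-neg n s y z))))

  L-flip : ∀ x y → IsL (x ⊝ y) ↔ IsL (y ⊝ x)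
  L-flip x y = L-sym , L-sym

  root-coset : ∀ {p} h (s : LF p) {x y z} → SameCoset x y (value z (root h s)) →
               IsL (h • x ⊕ evL s z) ↔ IsL (h • y ⊕ evL s z)
  root-coset (+ zero)  s         e = ↔-refl
  root-coset (+ suc n) s {x} {y} {z} e =
    ↔-trans (L-scale n (root-pos n s x z)) (↔-trans e (↔-sym (L-scale n (root-pos n s y z))))
  root-coset -[1+ n ]  s {x} {y} {z} e = ↔-trans (L-scale n (root-neg n s x z))
    (↔-trans (L-flip _ _)
    (↔-trans e (↔-trans (L-flip _ _) (↔-sym (L-scale n (root-neg n s y z))))))

  rootL-order : ∀ {p} (ℓ : LF (suc p)) {x y z} → SameOrder x y (value z (rootL ℓ)) →
                N (evL ℓ (x F.∷ z)) ↔ N (evL ℓ (y F.∷ z))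
  rootL-order ℓ {x} {y} {z} e = ↔-trans (N-↔ (evL-∷ ℓ x z))
    (↔-trans (root-order (headL ℓ) (tailL ℓ) e) (↔-sym (N-↔ (evL-∷ ℓ y z))))

  rootL-coset : ∀ {p} (ℓ : LF (suc p)) {x y z} → SameCoset x y (value z (rootL ℓ)) →
                IsL (evL ℓ (x F.∷ z)) ↔ IsL (evL ℓ (y F.∷ z))
  rootL-coset ℓ {x} {y} {z} e = ↔-trans (L-↔ (evL-∷ ℓ x z))
    (↔-trans (root-coset (headL ℓ) (tailL ℓ) e) (↔-sym (L-↔ (evL-∷ ℓ y z))))

  -- Elimination of a fractional variable

  module _ {p q} (φ : BF (Atom p (suc q))) {z : Fin p → D} {f : Fin q → D} where

    private
      ℓ₀ ℓ₁ : LF (suc q)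
      ℓ₀ = varL zero
      ℓ₁ = varL zero +L constL ℤ.-1ℤ

      ℓ₁-eval : ∀ x → evL ℓ₁ (x F.∷ f) ≈ x ⊝ 𝟙
      ℓ₁-eval x = trans (evL-+ (varL zero) (constL ℤ.-1ℤ) (x F.∷ f))
        (⊕-cong (evL-var zero (x F.∷ f))
        (trans (evL-const ℤ.-1ℤ (x F.∷ f)) (⊖-cong (1-• 𝟙))))

      boxed-correct : ∀ x → Sat (boxed φ) (Holds z (x F.∷ f)) ↔
                            (Sat φ (Holds z (x F.∷ f)) × N x × x ≪ 𝟙)
      boxed-correct x =
          (λ { (s , n , h) → s , N-resp (evL-var zero (x F.∷ f)) n ,
            (λ g → h (N-resp (sym (ℓ₁-eval x)) g)) })
        , (λ { (s , n , h) → s , N-resp (sym (evL-var zero (x F.∷ f))) n ,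
          (λ g → h (N-resp (ℓ₁-eval x) g)) })

      candidate : ∀ P P′ → Sat (mapB (substF (midForm P P′) (midDenominator P P′)) (boxed φ))
        (Holds z f) ↔
                           Sat (boxed φ) (Holds z (mid (value f P) (value f P′) F.∷ f))
      candidate P P′ = Sat-bind-cong _ (boxed φ) λ {a} _ →
        substF-correct (midForm P P′) (midDenominator P P′) (mid-correct P P′ f) a

      same : ∀ {x y} → (∀ {P} → P ∈ pointsF φ → SameOrder x y (value f P)) →
             Sat (boxed φ) (Holds z (x F.∷ f)) ↔ Sat (boxed φ) (Holds z (y F.∷ f))
      same {x} {y} e = Sat-cong (boxed φ) λ {a} i → go a (e (∈-map⁺ rootF i))
        where
        go : ∀ (a : Atom p (suc q)) → SameOrder x y (value f (rootF a)) →
             Holds z (x F.∷ f) a ↔ Holds z (y F.∷ f) a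
        go (geZ ℓ)   _ = ↔-refl
        go (inL ℓ)   _ = ↔-refl
        go (dvd m ℓ) _ = ↔-refl
        go (geF ℓ)   e = rootL-order ℓ e
        go QL        _ = ↔-refl

      low : ∀ {x} → N x → value f (rootL ℓ₀) ≼ x
      low {x} n = proj₁ (N-scale 0 (root-pos 0 (tailL ℓ₀) x f))
        (N-resp (trans (sym (evL-var zero (x F.∷ f))) (evL-∷ ℓ₀ x f)) n)

      high : ∀ {x} → x ≪ 𝟙 → x ≼ value f (rootL ℓ₁)
      high {x} h = ≪⇒≼ λ n → h (N-resp (trans (sym (evL-∷ ℓ₁ x f)) (ℓ₁-eval x))
        (proj₂ (N-scale 0 (root-pos 0 (tailL ℓ₁) x f)) n))

    elimF-correct : Sat (elimF φ) (Holds z f) ↔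
                    T (∃[ x ] (N x × x ≪ 𝟙 × Sat φ (Holds z (x F.∷ f))))
    elimF-correct =
        (λ s k → ⋁-elim (pointsF φ) _ s λ { (P , s) → ⋁-elim (pointsF φ) _ s λ { (P′ , s) →
          let s , n , h = proj₁ (boxed-correct _) (proj₁ (candidate P P′) s) in k (_ , n , h , s)
            } })
      , (λ t → Sat-run (elimF φ) λ k → t λ { (x , n , h , s) →
          same-mid (value f) (pointsF φ) x
            (_ , ∈-map⁺ rootF (∈-++⁺ʳ (atoms φ) (here ≡.refl)) , low n)
            (_ , ∈-map⁺ rootF (∈-++⁺ʳ (atoms φ) (there (here ≡.refl))) , high h)
            λ { (P , P′ , i , j , e) → k (⋁-intro {v = Holds z f} _ i (⋁-intro {v = Holds z f} _ j
              (proj₂ (candidate P P′) (proj₁ (same e) (proj₂ (boxed-correct x) (s , n , h)))))) } })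

  -- Elimination of an integral variable

  ∣-period : ∀ {p q} {a : Atom p q} {as} → a ∈ as → suc (modulus a) ∣ suc (periodOf as)
  ∣-period {as = a ∷ as} (here ≡.refl) = m∣m*n (suc (periodOf as))
  ∣-period {as = a ∷ as} (there i)     = ∣-trans (∣-period i) (n∣m*n (suc (modulus a)))

  Congruent-sym : ∀ {m x y} → Congruent m x y → Congruent m y x
  Congruent-sym {m} {x} {y} (w , zw , e) = ⊖ w , Z-⊖ zw ,
    trans (solve 2 (λ x y → y :- x ⊜ :- (x :- y)) refl x y)
      (trans (⊖-cong e) (sym (•-⊖ (+ suc m) w)))

  Congruent-respʳ : ∀ {m x y y′} → y ≈ y′ → Congruent m x y → Congruent m x y′
  Congruent-respʳ e (w , zw , e′) = w , zw , trans (⊕-congˡ (⊖-cong (sym e))) e′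

  -- The two values of the form differ by its leading coefficient times `x - y`, which is an
  -- integral multiple of `suc n` and hence of `suc m`.
  dvd-shift : ∀ {p} m n (ℓ : LF (suc p)) {x y z} → suc m ∣ suc n → Congruent n x y →
              IsZ (div m (evL ℓ (y F.∷ z))) → IsZ (div m (evL ℓ (x F.∷ z)))
  dvd-shift m n ℓ {x} {y} {z} (divides k eq) (w , zw , e) h =
    Z-resp (sym (div-unique m mult)) (Z-⊕ h (Z-• (headL ℓ) (Z-• (+ k) zw)))
    where
    a = headL ℓ
    s = + suc m
    v = div m (evL ℓ (y F.∷ z))
    mult : s • (v ⊕ a • (+ k • w)) ≈ evL ℓ (x F.∷ z)
    mult = trans (•-⊕ s _ _) (trans (⊕-cong (trans (div-correct m _) (evL-∷ ℓ y z))
        (trans (•-swap s a _) (•-congˡ a (trans (•-swap s (+ k) w) (trans (sym (*-• (+ k) s w))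
          (trans (•-congʳ w (≡.trans (≡.sym (ℤ.pos-* k (suc m))) (≡.cong +_ (≡.sym eq))))
            (sym e)))))))
      (trans (trans (solve 3 (λ y s d → (y :+ s) :+ d ⊜ (y :+ d) :+ s) refl (a • y)
        (evL (tailL ℓ) z) (a • (x ⊝ y)))
        (⊕-congʳ (trans (sym (•-⊕ a y (x ⊝ y)))
          (•-congˡ a (solve 2 (λ x y → y :+ (x :- y) ⊜ x) refl x y)))))
        (sym (evL-∷ ℓ x z))))

  module _ {p q} (φ : BF (Atom (suc p) q)) {z : Fin p → D} {f : Fin q → D} where

    private
      m = period φ

    same-Z : ∀ {x y} → Congruent m x y →
             (∀ {P} → P ∈ pointsZ φ → SameOrder x y (value z P) × SameCoset x y (value z P)) →
             Sat φ (Holds (x F.∷ z) f) ↔ Sat φ (Holds (y F.∷ z) f)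
    same-Z {x} {y} c e = Sat-cong φ λ {a} i → go a (∣-period i) (e (there (∈-map⁺ rootZ i)))
      where
      go : ∀ (a : Atom (suc p) q) → suc (modulus a) ∣ suc m →
           SameOrder x y (value z (rootZ a)) × SameCoset x y (value z (rootZ a)) →
           Holds (x F.∷ z) f a ↔ Holds (y F.∷ z) f a
      go (geZ ℓ)   _ e = rootL-order ℓ (proj₁ e)
      go (inL ℓ)   _ e = rootL-coset ℓ (proj₂ e)
      go (dvd n ℓ) d _ = dvd-shift n m ℓ d (Congruent-sym {m} c) , dvd-shift n m ℓ d c
      go (geF ℓ)   _ _ = ↔-refl
      go QL        _ _ = ↔-refl

    nearPoint-correct : ∀ P P′ j {y} → IsZ y → + suc (midDenominator P P′) • y ≈ evL
      (nearForm φ P P′ j) z →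
                        Sat (nearPoint φ P P′ j) (Holds z f) ↔ Sat φ (Holds (y F.∷ z) f)
    nearPoint-correct P P′ j zy e =
        (λ { (_ , s) → proj₁ subst′ s })
      , (λ s → Z-resp (sym (div-unique (midDenominator P P′) e)) zy , proj₂ subst′ s)
      where
      subst′ = Sat-bind-cong _ φ λ {a} _ →
        substZ-correct (nearForm φ P P′ j) (midDenominator P P′) e a

    nearZ-sound : Sat (nearZ φ) (Holds z f) → T (∃[ x ] (IsZ x × Sat φ (Holds (x F.∷ z) f)))
    nearZ-sound s k = ⋁-elim (pointsZ φ) _ s λ { (P , s) → ⋁-elim (pointsZ φ) _ s λ { (P′ , s) →
      ⋁-elim {v = Holds z f} (allFin (suc (radius φ P P′ ℕ.+ radius φ P P′)))
        (λ j → nearPoint φ P P′ (toℕ j)) s λ { (j , s) → k (_ , proj₁ s ,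
        proj₁ (nearPoint-correct P P′ (toℕ j) (proj₁ s) (div-correct (midDenominator P P′) _)) s)
          } } }

    -- Clearing the denominator of the midpoint turns the distance condition on `y` into bounds on
    -- the integer `w`. So `w` is a standard number between 0 and twice the radius, and this is the
    -- index `j` of the candidate.
    nearZ-complete : (∀ i → IsZ (z i)) → ∀ {x} → Near (value z) m (pointsZ φ) x →
                     Sat φ (Holds (x F.∷ z) f) → Sat (nearZ φ) (Holds z f)
    nearZ-complete zz {x} (y , P , P′ , i , i′ , zy , c , (lo , hi) , same) s =
      Sat-run (nearZ φ) λ k → bounded (suc (B ℕ.+ B)) w-Z w≽ w≪ λ { (j , e) →
        k (⋁-intro {v = Holds z f} _ i
          (⋁-intro {v = Holds z f} _ i′ (⋁-intro {v = Holds z f} _ (∈-allFin j)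
          (proj₂ (nearPoint-correct P P′ (toℕ j) zy (eval j e)) (proj₁ (same-Z c same) s))))) }
      where
      d = + suc (midDenominator P P′)
      B = radius φ P P′
      r = + suc (suc m) • 𝟙
      c₀ = mid (value z P) (value z P′)
      E = evL (midForm P P′) z
      w = (d • y ⊝ E) ⊕ + B • 𝟙
      w-Z : IsZ w
      w-Z = Z-⊕ (Z-⊕ (Z-• d zy) (Z-⊖ (Z-ev (midForm P P′) zz))) (Z-• (+ B) Z-𝟙)
      d•r : d • r ≈ + B • 𝟙
      d•r = trans (sym (*-• d (+ suc (suc m)) 𝟙))
        (•-congʳ 𝟙 (≡.sym (ℤ.pos-* (suc (midDenominator P P′)) (suc (suc m)))))
      d•c : d • c₀ ≈ E
      d•c = mid-correct P P′ z
      w≽ : 𝟘 ≼ w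
      w≽ = N-resp (trans (•-⊕ d y _)
        (trans (⊕-congˡ (trans (•-⊖ d _)
          (⊖-cong (trans (•-⊕ d c₀ (⊖ r)) (⊕-cong d•c (trans (•-⊖ d r) (⊖-cong d•r)))))))
        (solve 3 (λ y e b → y :- (e :- b) ⊜ ((y :- e) :+ b) :- :0) refl (d • y) E (+ B • 𝟙))))
          (N-• (suc (midDenominator P P′)) lo)
      w≼ : w ≼ + B • 𝟙 ⊕ + B • 𝟙
      w≼ = N-resp (trans (•-⊕ d _ _) (trans (⊕-cong (trans (•-⊕ d c₀ r) (⊕-cong d•c d•r)) (•-⊖ d y))
        (solve 3 (λ y e b → (e :+ b) :- y ⊜ (b :+ b) :- ((y :- e) :+ b)) refl (d • y) E
          (+ B • 𝟙)))) (N-• (suc (midDenominator P P′)) hi)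
      w≪ : w ≪ + suc (B ℕ.+ B) • 𝟙
      w≪ h = pos-⊖𝟙 (N-resp (trans (⊕-congʳ (⊕-congˡ (⊖-cong (⊕-congˡ (+-• (+ B) (+ B) 𝟙)))))
        (solve 3 (λ w b o → (w :- (o :+ (b :+ b))) :+ ((b :+ b) :- w) ⊜ :- o) refl w (+ B • 𝟙) 𝟙))
          (N-⊕ h w≼))
      eval : ∀ (j : Fin (suc (B ℕ.+ B))) → w ≈ + toℕ j • 𝟙 → d • y ≈ evL (nearForm φ P P′ (toℕ j)) z
      eval j e = sym (trans (evL-+ (midForm P P′) (constL (+ toℕ j ℤ.+ ℤ.- + B)) z) (trans
        (⊕-congˡ (trans (evL-const (+ toℕ j ℤ.+ ℤ.- + B) z)
          (trans (+-• (+ toℕ j) (ℤ.- + B) 𝟙) (⊕-cong (sym e) (neg-• (+ B) 𝟙)))))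
        (solve 3 (λ y e b → e :+ (((y :- e) :+ b) :- b) ⊜ y) refl (d • y) E (+ B • 𝟙))))

    infinityGe-correct : ∀ h (s : LF p) {x} → value z (root h s) ≪ x →
                         Sat (infinityGe h s) (Holds z f) ↔ N (h • x ⊕ evL s z)
    infinityGe-correct (+ zero)  s {x} lt = N-↔ (sym (⊕-identityˡ _))
    infinityGe-correct (+ suc n) s {x} lt =
      (λ _ → proj₂ (N-scale n (root-pos n s x z)) (≪⇒≼ lt)) , (λ _ r → r)
    infinityGe-correct -[1+ n ]  s {x} lt =
      (λ r → stable-N λ _ → r) , (λ h → lt (proj₁ (N-scale n (root-neg n s x z)) h))

    infinityL-correct : ∀ h (s : LF p) {x} → (IsL (x ⊝ value z (root h s)) → R) →
                        Sat (infinityL h s) (Holds z f) ↔ IsL (h • x ⊕ evL s z)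
    infinityL-correct (+ zero)  s {x} ¬l = L-↔ (sym (⊕-identityˡ _))
    infinityL-correct (+ suc n) s {x} ¬l =
      (λ r → stable-L λ _ → r) , (λ h → ¬l (proj₁ (L-scale n (root-pos n s x z)) h))
    infinityL-correct -[1+ n ]  s {x} ¬l =
      (λ r → stable-L λ _ → r) , (λ h → ¬l (L-sym (proj₁ (L-scale n (root-neg n s x z)) h)))

    infinity-correct : ∀ {x} r → Congruent m x (+ r • 𝟙) → Above (value z) m (pointsZ φ) x →
                       Sat (bind φ (infinity r)) (Holds z f) ↔ Sat φ (Holds (x F.∷ z) f)
    infinity-correct {x} r c above = Sat-bind-cong (infinity r) φ λ {a} i →
        go a (∣-period i) (above (there (∈-map⁺ rootZ i)))
      where
      go : ∀ (a : Atom (suc p) q) → suc (modulus a) ∣ suc m →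
           value z (rootZ a) ≪ x × (IsL (x ⊝ value z (rootZ a)) → R) →
           Sat (infinity r a) (Holds z f) ↔ Holds (x F.∷ z) f a
      go (geZ ℓ)   _ (h , _) = ↔-trans (infinityGe-correct (headL ℓ) (tailL ℓ) h)
        (N-↔ (sym (evL-∷ ℓ x z)))
      go (inL ℓ)   _ (_ , h) = ↔-trans (infinityL-correct (headL ℓ) (tailL ℓ) h)
        (L-↔ (sym (evL-∷ ℓ x z)))
      go (dvd n ℓ) d _       = ↔-trans
        (Z-↔ (div-⊗ n 0 (evL-subst (constL (+ r)) 0 ℓ {+ r • 𝟙} {z}
          (trans (1-• _) (sym (evL-const (+ r) z))))))
        (dvd-shift n m ℓ d c , dvd-shift n m ℓ d (Congruent-sym {m} c))
      go (geF ℓ)   _ _       = ↔-refl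
      go QL        _ _       = ↔-refl

    residue : ∀ {x} → IsZ x → T (∃[ r ] Congruent m x (+ toℕ {suc m} r • 𝟙))
    residue {x} zx k = bounded (suc m) (round-Z m 𝟘 x zx) (round-≽ m 𝟘 x)
      (λ h → round-≪ m 𝟘 x (N-resp (⊕-congˡ (⊖-cong (sym (⊕-identityˡ _)))) h))
      λ { (r , e) → k (r , Congruent-respʳ {m} e (round-≡ m 𝟘 x)) }

    infiniteZ-complete : ∀ {x} → IsZ x → Above (value z) m (pointsZ φ) x →
                         Sat φ (Holds (x F.∷ z) f) → Sat (infiniteZ φ) (Holds z f)
    infiniteZ-complete {x} zx above s = Sat-run (infiniteZ φ) λ k → residue zx λ { (r , c) →
      k ((λ ql → proj₂ (above (here ≡.refl)) (ql _))
        , ⋁-intro {v = Holds z f} _ (∈-allFin r) (proj₂ (infinity-correct (toℕ r) c above) s)) }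

    outside : ((∀ x → IsL x) → R) → T (∃[ e ] (N e × (IsL e → R)))
    outside ¬ql k = ¬ql λ x → stable-L λ ¬l → N-total x λ
      { (inj₁ n) → k (x , n , ¬l)
      ; (inj₂ n) → k (⊖ x , n , λ l → ¬l (L-resp (solve 1 (λ x → :- :- x ⊜ x) refl x) (L-⊖ l))) }

    bound : ∀ e (ps : List (Point p)) → T (∃[ b ] (∀ {P} → P ∈ ps → value z P ⊕ e ≼ b))
    bound e []       k = k (𝟘 , λ ())
    bound e (P ∷ ps) k = bound e ps λ { (b , h) → ≼-total b (value z P ⊕ e) λ
      { (inj₁ le) → k (_ , λ { (here ≡.refl) → ≼-refl ; (there i) → ≼-trans (h i) le })
      ; (inj₂ le) → k (b , λ { (here ≡.refl) → le ; (there i) → h i }) } }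

    -- Let `e ≥ 0` be outside `L`. Rounding up from a bound for all points shifted by `e` gives an
    -- `x` in the residue class of `r` with `x - p ≥ e` for each point `p`; by convexity `x - p` is
    -- not in `L`, since otherwise `e` would be.
    infiniteZ-sound : Sat (infiniteZ φ) (Holds z f) → T (∃[ x ] (IsZ x × Sat φ (Holds (x F.∷ z) f)))
    infiniteZ-sound (¬ql , s) k = ⋁-elim (allFin (suc m)) _ s λ
      { (r , s) → outside ¬ql λ { (e , ne , ¬le) →
      bound e (pointsZ φ) λ { (b , h) →
        let x = round m b (+ toℕ r • 𝟙)
            above : Above (value z) m (pointsZ φ) x
            above = λ {P} i →
              let le = ≼-trans (h i) (round-≽ m b (+ toℕ r • 𝟙))
                  ne′ = N-resp (solve 1 (λ e → e ⊜ e :- :0) refl e) ne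
                  le′ : e ≼ x ⊝ value z P
                  le′ = N-resp (solve 3 (λ x p e → x :- (p :+ e) ⊜ (x :- p) :- e) refl x
                    (value z P) e) le
                  ¬l : IsL (x ⊝ value z P) → R
                  ¬l = λ l → ¬le (L-convex′ ne le′ l)
              in (λ g → ¬l (L-resp (sym (≼-antisym {x ⊝ value z P} {𝟘}
                    (N-resp (solve 2 (λ x p → p :- x ⊜ :0 :- (x :- p)) refl x (value z P)) g)
                      (≼-trans ne′ le′))) L-𝟘))
               , ¬l
        in k (x , round-Z m b _ (Z-• (+ toℕ r) Z-𝟙)
             , proj₁ (infinity-correct (toℕ r) (Congruent-sym {m} (round-≡ m b _)) above) s) } } }

  flipL-eval : ∀ {p} (ℓ : LF (suc p)) x z → evL (flipL ℓ) (x F.∷ z) ≈ evL ℓ (⊖ x F.∷ z)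
  flipL-eval ℓ x z = trans (evL-∷ (flipL ℓ) x z)
    (trans (⊕-congʳ (trans (neg-• (headL ℓ) x) (sym (•-⊖ (headL ℓ) x))))
    (sym (evL-∷ ℓ (⊖ x) z)))

  flip-correct : ∀ {p q} {x} {z : Fin p → D} {f : Fin q → D} a → Holds (x F.∷ z) f (flip a) ↔
    Holds (⊖ x F.∷ z) f a
  flip-correct (geZ ℓ)   = N-↔ (flipL-eval ℓ _ _)
  flip-correct (inL ℓ)   = L-↔ (flipL-eval ℓ _ _)
  flip-correct (dvd m ℓ) = Z-↔ (div-cong m (flipL-eval ℓ _ _))
  flip-correct (geF ℓ)   = ↔-refl
  flip-correct QL        = ↔-refl

  value-0 : ∀ {p} (z : Fin p → D) → value z (constL 0ℤ , 0) ≈ 𝟘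
  value-0 z = div-unique 0 (trans (1-• 𝟘) (sym (evL-const 0ℤ z)))

  value-0-⊖ : ∀ {p} (z : Fin p → D) → value z (constL 0ℤ , 0) ≈ ⊖ value z (constL 0ℤ , 0)
  value-0-⊖ z = trans (value-0 z) (trans (solve 0 (:0 ⊜ :- :0) refl) (⊖-cong (sym (value-0 z))))

  root-flip : ∀ {p} h (s : LF p) z → value z (root (ℤ.- h) s) ≈ ⊖ value z (root h s)
  root-flip (+ zero)  s z = value-0-⊖ z
  root-flip (+ suc n) s z = div-unique n
    (trans (•-⊖ (+ suc n) _) (trans (⊖-cong (trans (div-correct n _) (evL-* ℤ.-1ℤ s z)))
    (solve 1 (λ s → :- (ℤ.-1ℤ :• s) ⊜ s) refl (evL s z))))
  root-flip -[1+ n ]  s z = div-unique n (trans (•-⊖ (+ suc n) _) (trans (⊖-cong (div-correct n _))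
    (trans (solve 1 (λ s → :- s ⊜ ℤ.-1ℤ :• s) refl (evL s z)) (sym (evL-* ℤ.-1ℤ s z)))))

  rootZ-flip : ∀ {p q} (a : Atom (suc p) q) z → value z (rootZ (flip a)) ≈ ⊖ value z (rootZ a)
  rootZ-flip (geZ ℓ)   z = root-flip (headL ℓ) (tailL ℓ) z
  rootZ-flip (inL ℓ)   z = root-flip (headL ℓ) (tailL ℓ) z
  rootZ-flip (dvd m ℓ) z = value-0-⊖ z
  rootZ-flip (geF ℓ)   z = value-0-⊖ z
  rootZ-flip QL        z = value-0-⊖ z

  module _ {p q} (φ : BF (Atom (suc p) q)) {z : Fin p → D} {f : Fin q → D}
    (zz : ∀ i → IsZ (z i)) where

    private
      φ⁻ = mapB flip φ

      negated : ∀ {P} → P ∈ pointsZ φ⁻ → ∃[ P′ ] (P′ ∈ pointsZ φ × value z P ≈ ⊖ value z P′)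
      negated (here ≡.refl) = _ , here ≡.refl , value-0-⊖ z
      negated (there i) with ∈-map⁻ rootZ i
      ... | a , j , ≡.refl with ∈-map⁻ flip (≡.subst (a ∈_) (atoms-mapB flip φ) j)
      ... | b , l , ≡.refl = _ , there (∈-map⁺ rootZ l) , rootZ-flip b z

      below⇒above : ∀ {x} → Below (value z) (period φ) (pointsZ φ) x →
                    Above (value z) (period φ⁻) (pointsZ φ⁻) (⊖ x)
      below⇒above {x} below i with negated i
      ... | P′ , j , e =
          (λ g → proj₁ (below j)
            (N-resp (trans (⊕-congʳ e)
              (solve 2 (λ x p → :- p :- :- x ⊜ x :- p) refl x (value z P′))) g))
        , (λ l → proj₂ (below j)
          (L-sym (L-resp (trans (⊕-congˡ (⊖-cong e))
            (solve 2 (λ x p → :- x :- :- p ⊜ p :- x) refl x (value z P′))) l)))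

      flipped : ∀ x → Sat φ⁻ (Holds (x F.∷ z) f) ↔ Sat φ (Holds (⊖ x F.∷ z) f)
      flipped x = Sat-bind-cong _ φ λ {a} _ → flip-correct a

      involution : ∀ x → Sat φ (Holds (⊖ ⊖ x F.∷ z) f) ↔ Sat φ (Holds (x F.∷ z) f)
      involution x = Sat-cong φ λ {a} _ → Holds-cong
        (λ { zero → solve 1 (λ x → :- :- x ⊜ x) refl x ; (suc i) → refl }) (λ _ → refl) a

    elimZ-correct : Sat (elimZ φ) (Holds z f) ↔ T (∃[ x ] (IsZ x × Sat φ (Holds (x F.∷ z) f)))
    elimZ-correct =
        (λ s k → s (λ s → nearZ-sound φ s k) λ s → s (λ s → infiniteZ-sound φ s k)
          λ s → infiniteZ-sound φ⁻ s λ { (x , zx , s) → k (⊖ x , Z-⊖ zx , proj₁ (flipped x) s) })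
      , (λ t → Sat-run (elimZ φ) λ k → t λ { (x , zx , s) →
          position (value z) (period φ) (pointsZ φ) x (here ≡.refl) zx λ
            { (inj₁ near)         → k λ h _ → h (nearZ-complete φ zz near s)
            ; (inj₂ (inj₁ above)) → k λ _ h → h λ h _ → h (infiniteZ-complete φ zx above s)
            ; (inj₂ (inj₂ below)) → k λ _ h → h λ _ h → h
              (infiniteZ-complete φ⁻ (Z-⊖ zx) (below⇒above below)
                (proj₂ (flipped (⊖ x)) (proj₂ (involution x) s))) } })

-- Separation of floors and fractional parts

norm : ∀ {n} → Vector ℤ n → ℕ
norm {zero}  a = 0
norm {suc n} a = ℤ.∣ a zero ∣ ℕ.+ norm (a ∘ suc)

linear : ∀ {n} → Term n → LF n
linear (var i) = varL i
linear `0      = constL 0ℤ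
linear `1      = constL 1ℤ
linear (s + t) = linear s +L linear t

difference : ∀ {n} → Term n → Term n → LF n
difference s t = linear s +L ℤ.-1ℤ *L linear t

fractional-part : ∀ {n} → LF n → LF n
fractional-part (c , a) = 0ℤ , a

-- The value of the j-th candidate for the floor of Σᵢ aᵢ {xᵢ}
shifted : ∀ {n} → LF n → ℕ → ℤ
shifted (c , a) j = + j ℤ.+ ℤ.- + norm a

-- The sum of the `aᵢ {xᵢ}` lies between `- norm a` and `norm a`, hence so does its floor, for which
-- this counts the possible values.
width : ∀ {n} → LF n → ℕ
width (c , a) = suc (norm a ℕ.+ norm a)

-- Σᵢ aᵢ xᵢ + c ≥ 0 iff some integer j satisfies Σᵢ aᵢ {xᵢ} ≥ j and Σᵢ aᵢ ⌊xᵢ⌋ + c + j ≥ 0.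
nonnegative : ∀ {n} → LF n → BF (Atom n n)
nonnegative ℓ = ⋁ (allFin (width ℓ)) λ j →
  and (at (geF (fractional-part ℓ +L constL (ℤ.- shifted ℓ (toℕ j)))))
      (at (geZ (ℓ +L constL (shifted ℓ (toℕ j)))))

-- Floors and constant contribute an integer, so the fractional sum has to be an integer too; one
-- inequality in each direction fixes it to a candidate.
integer : ∀ {n} → LF n → BF (Atom n n)
integer ℓ = ⋁ (allFin (width ℓ)) λ j →
  and (at (geF (fractional-part ℓ +L constL (ℤ.- shifted ℓ (toℕ j)))))
      (at (geF (ℤ.-1ℤ *L fractional-part ℓ +L constL (shifted ℓ (toℕ j)))))

eliminate : ∀ {n} → Formula n → BF (Atom n n)
eliminate (s ≐ t) = and (nonnegative (difference s t)) (nonnegative (difference t s))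
eliminate (s < t) = neg (nonnegative (difference s t))
eliminate (Z t)   = integer (linear t)
-- This form is evaluated at the floors only: the fractional parts contribute a bounded amount,
-- which lies in `L`.
eliminate (L t)   = at (inL (linear t))
eliminate ⊥       = ff
eliminate (φ ∧ ψ) = and (eliminate φ) (eliminate ψ)
eliminate (φ ∨ ψ) = or (eliminate φ) (eliminate ψ)
eliminate (φ ⇒ ψ) = neg (and (eliminate φ) (neg (eliminate ψ)))
-- The bound variable owns index 0 in both blocks of variables: first its fractional part is
-- eliminated, then its floor.
eliminate (∀̇ φ)   = neg (elimZ (elimF (neg (eliminate φ))))
eliminate (∃̇ φ)   = elimZ (elimF (eliminate φ))

formula : ∀ {n} {A : Set} → (A → Formula n) → BF A → Formula n
formula g (at a)    = g a
-- Special formulas have no constant for falsity, so a contradiction between special formulas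
-- replaces it.
formula g ff        = (∀̇ L x₀) ∧ ¬ (∀̇ L x₀)
formula g (neg φ)   = ¬ formula g φ
formula g (and φ ψ) = formula g φ ∧ formula g ψ
formula g (or φ ψ)  = formula g φ ∨ formula g ψ

formula-special : ∀ {n} {A : Set} {g : A → Formula n} → (∀ a → Special (g a)) → ∀ φ → Special
  (formula g φ)
formula-special s (at a)    = s a
formula-special s ff        = and Q=L (not Q=L)
formula-special s (neg φ)   = not (formula-special s φ)
formula-special s (and φ ψ) = and (formula-special s φ) (formula-special s ψ)
formula-special s (or φ ψ)  = or (formula-special s φ) (formula-special s ψ)

-- m + 1 divides c + Σᵢ aᵢ ⌊xᵢ⌋, in terms of the residues of the ⌊xᵢ⌋
divisibleConst : ∀ {A : Set} → ℕ → BF A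
divisibleConst zero    = neg ff
divisibleConst (suc _) = ff

divisible : ∀ m {k n} → (Fin k → Fin n) → LF k → BF (Fin n × Fin (suc m))
divisible m {zero}  g (c , a) = divisibleConst (c ℤ.%ℕ suc m)
divisible m {suc k} g (c , a) = ⋁ (allFin (suc m)) λ r →
  -- Modulo `suc m` the first floor may be replaced by its residue `r`, whose multiple joins the
  -- constant.
  and (at (g zero , r)) (divisible m (g ∘ suc) (a zero ℤ.* + toℕ r ℤ.+ c , a ∘ suc))

residueFormula : ∀ {n} m → Fin n × Fin m → Formula n
residueFormula m (i , r) = ∃̇ (x₀ ≐⌊ wkT (var i) ⌋ ∧ x₀ ≡ toℕ r mod m)

atomFormula : ∀ {n} → Atom n n → Formula n
atomFormula {n} (geZ (c , a)) = ∃^ n (⋀ (λ i → new n i ≐⌊ old n i ⌋) ∧ Σ[ a , new n ]≥ (ℤ.- c))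
atomFormula     (inL (c , a)) = Σ[ a , var ]∈L
atomFormula     (dvd m ℓ)     = formula (residueFormula (suc m)) (divisible m id ℓ)
atomFormula {n} (geF (c , a)) = ∃^ n (⋀ (λ i → new n i ≐｛ old n i ｝) ∧ Σ[ a , new n ]≥ (ℤ.- c))
atomFormula     QL            = ∀̇ L x₀

atomFormula-special : ∀ {n} (a : Atom n n) → Special (atomFormula a)
atomFormula-special (geZ (c , a)) = integral a (ℤ.- c)
atomFormula-special (inL (c , a)) = in-L a
atomFormula-special (dvd m ℓ)     =
  formula-special (λ { (i , r) → congruence i (suc m) r }) (divisible m id ℓ)
atomFormula-special (geF (c , a)) = fractional a (ℤ.- c)
atomFormula-special QL            = Q=L

-- Correctness of the translation into atoms

module Translation (M : Structure) (isM : IsModel 3G M) where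
  open ThreeGroups M isM
  open Elimination M isM
  open Positions M isM
  open Integers M isM
  open Correctness M isM

  linear-eval : ∀ {n} (t : Term n) ρ → ⟦ t ⟧ₜ ρ ≈ evL (linear t) ρ
  linear-eval (var i) ρ = sym (evL-var i ρ)
  linear-eval `0      ρ = sym (evL-const 0ℤ ρ)
  linear-eval `1      ρ = sym (trans (evL-const 1ℤ ρ) (1-• 𝟙))
  linear-eval (s + t) ρ =
    trans (⊕-cong (linear-eval s ρ) (linear-eval t ρ)) (sym (evL-+ (linear s) (linear t) ρ))

  difference-eval : ∀ {n} (s t : Term n) ρ → evL (difference s t) ρ ≈ ⟦ s ⟧ₜ ρ ⊝ ⟦ t ⟧ₜ ρ
  difference-eval s t ρ = trans (evL-+ (linear s) (ℤ.-1ℤ *L linear t) ρ)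
    (⊕-cong (sym (linear-eval s ρ)) (trans (evL-* ℤ.-1ℤ (linear t) ρ)
      (⊖-cong (trans (1-• _) (sym (linear-eval t ρ))))))

  module _ {n} (ρ : Fin n → D) where

    split : ∀ ℓ → evL ℓ ρ ≈ evL ℓ (fl ∘ ρ) ⊕ evL (fractional-part ℓ) (fr ∘ ρ)
    split (c , a) = trans (⊕-congˡ (go a ρ))
      (solve 3 (λ c x y → c :+ (x :+ y) ⊜ (c :+ x) :+ (:0 :+ y)) refl (c • 𝟙) (ev a (fl ∘ ρ))
        (ev a (fr ∘ ρ)))
      where
      go : ∀ {n} (a : Vector ℤ n) ρ → ev a ρ ≈ ev a (fl ∘ ρ) ⊕ ev a (fr ∘ ρ)
      go {zero}  a ρ = sym (⊕-identityˡ 𝟘)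
      go {suc n} a ρ = trans (⊕-cong (trans (•-congˡ (a zero)
          (solve 2 (λ x f → x ⊜ f :+ (x :- f)) refl (ρ zero) (fl (ρ zero)))) (•-⊕ (a zero) _ _))
            (go (a ∘ suc) (ρ ∘ suc)))
        (interchange _ _ _ _)

    fr≽ : ∀ x → 𝟘 ≼ fr x
    fr≽ x = N-resp (solve 1 (λ x → x ⊜ x :- :0) refl (fr x)) (proj₁ (proj₂ (floor x)))

    fr≼ : ∀ x → fr x ≼ 𝟙
    fr≼ x = ≪⇒≼ (proj₂ (proj₂ (floor x)))

    bounds : ∀ {n} (a : Vector ℤ n) (f : Fin n → D) → (∀ i → 𝟘 ≼ f i) → (∀ i → f i ≼ 𝟙) →
             N (ev a f ⊕ + norm a • 𝟙) × N (+ norm a • 𝟙 ⊝ ev a f)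
    bounds {zero}  a f p q = N-resp (solve 0 (:0 ⊜ :0 :+ :0) refl) N-𝟘 , N-resp
      (solve 0 (:0 ⊜ :0 :- :0) refl) N-𝟘
    bounds {suc n} a f p q with bounds (a ∘ suc) (f ∘ suc) (p ∘ suc) (q ∘ suc) | one (a zero)
      (p zero) (q zero)
      where
      one : ∀ k {x} → 𝟘 ≼ x → x ≼ 𝟙 → N (k • x ⊕ + ℤ.∣ k ∣ • 𝟙) × N (+ ℤ.∣ k ∣ • 𝟙 ⊝ k • x)
      one (+ n) {x} p q =
          N-⊕ (N-• n (N-resp (solve 1 (λ x → x :- :0 ⊜ x) refl x) p)) (N-• n N-𝟙)
        , N-resp (trans (•-⊕ (+ n) _ _) (⊕-congˡ (•-⊖ (+ n) x))) (N-• n q)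
      one -[1+ n ] {x} p q =
          N-resp (trans (•-⊕ (+ suc n) _ _) (trans (⊕-congˡ (•-⊖ (+ suc n) x)) (⊕-comm _ _)))
            (N-• (suc n) q)
        , N-resp (solve 2 (λ o x → o :+ x ⊜ o :- (:- x)) refl (+ suc n • 𝟙) (+ suc n • x))
            (N-⊕ (N-• (suc n) N-𝟙) (N-• (suc n) (N-resp (solve 1 (λ x → x :- :0 ⊜ x) refl x) p)))
    ... | l , u | l′ , u′ =
        N-resp (trans (interchange _ _ _ _)
          (⊕-congˡ (sym (+-• (+ ℤ.∣ a zero ∣) (+ norm (a ∘ suc)) 𝟙)))) (N-⊕ l′ l)
      , N-resp (trans (solve 4 (λ o x p y → (o :- x) :+ (p :- y) ⊜ (o :+ p) :- (x :+ y)) refl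
            (+ ℤ.∣ a zero ∣ • 𝟙) (a zero • f zero) (+ norm (a ∘ suc) • 𝟙) (ev (a ∘ suc) (f ∘ suc)))
          (⊕-congʳ (sym (+-• (+ ℤ.∣ a zero ∣) (+ norm (a ∘ suc)) 𝟙)))) (N-⊕ u′ u)

    private
      Fp : LF n → D
      Fp ℓ = evL (fractional-part ℓ) (fr ∘ ρ)

      Fp-≈ : ∀ ℓ → Fp ℓ ≈ ev (proj₂ ℓ) (fr ∘ ρ)
      Fp-≈ ℓ = ⊕-identityˡ _

      B : LF n → D
      B (c , a) = + norm a • 𝟙

      lo : ∀ ℓ → N (Fp ℓ ⊕ B ℓ)
      lo ℓ@(c , a) = N-resp (⊕-congʳ (sym (Fp-≈ ℓ))) (proj₁ (bounds a (fr ∘ ρ) (fr≽ ∘ ρ) (fr≼ ∘ ρ)))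

      hi : ∀ ℓ → N (B ℓ ⊝ Fp ℓ)
      hi ℓ@(c , a) = N-resp (⊕-congˡ (⊖-cong (sym (Fp-≈ ℓ))))
        (proj₂ (bounds a (fr ∘ ρ) (fr≽ ∘ ρ) (fr≼ ∘ ρ)))

      L-Fp : ∀ ℓ → IsL (Fp ℓ)
      L-Fp ℓ@(c , a) = L-resp (solve 2 (λ f b → (f :+ b) :- b ⊜ f) refl (Fp ℓ) (B ℓ))
        (L-⊕ (L-convex′ (lo ℓ)
          (N-resp (solve 2 (λ f b → b :- f ⊜ (b :+ b) :- (f :+ b)) refl (Fp ℓ) (B ℓ)) (hi ℓ))
          (L-⊕ (L-• (+ norm a) L-𝟙) (L-• (+ norm a) L-𝟙))) (L-⊖ (L-• (+ norm a) L-𝟙)))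

      shifted-eval : ∀ ℓ j → shifted ℓ j • 𝟙 ≈ + j • 𝟙 ⊝ B ℓ
      shifted-eval (c , a) j = trans (+-• (+ j) (ℤ.- + norm a) 𝟙) (⊕-congˡ (neg-• (+ norm a) 𝟙))

      -- After adding `norm a`, the floor is an integer between 0 and `2 * norm a`, hence standard
      -- by `bounded`.
      floor-Fp : ∀ ℓ → T (∃[ j ] fl (Fp ℓ) ≈ shifted ℓ (toℕ {width ℓ} j) • 𝟙)
      floor-Fp ℓ@(c , a) k = let zf , n , _ = floor (Fp ℓ) in
        bounded (suc (norm a ℕ.+ norm a)) {fl (Fp ℓ) ⊕ B ℓ} (Z-⊕ zf (Z-• (+ norm a) Z-𝟙))
          (low (floor (Fp ℓ)))
          (λ h → pos-⊖𝟙 (N-resp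
            (trans (⊕-congʳ (⊕-congʳ (⊕-congˡ (⊖-cong (⊕-congˡ (+-• (+ norm a) (+ norm a) 𝟙))))))
              (solve 4 (λ f g b o → (((g :+ b) :- (o :+ (b :+ b))) :+ (f :- g)) :+ (b :- f) ⊜ :-
                o) refl (Fp ℓ) (fl (Fp ℓ)) (B ℓ) 𝟙))
            (N-⊕ (N-⊕ h n) (hi ℓ))))
          λ { (j , e) → k (j , trans (solve 2 (λ g b → g ⊜ (g :+ b) :- b) refl (fl (Fp ℓ)) (B ℓ))
              (trans (⊕-congʳ e) (sym (shifted-eval ℓ (toℕ j))))) }
        where
        low : Floor (fl (Fp ℓ)) (Fp ℓ) → 𝟘 ≼ fl (Fp ℓ) ⊕ B ℓ
        low (zf , _ , ¬n) = stable-N λ k → em (𝟘 ≼ fl (Fp ℓ) ⊕ B ℓ) λ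
          { (inj₁ h) → k h
          ; (inj₂ h) → ¬n (N-resp
            (solve 4 (λ f g b o → (f :+ b) :+ (:- (g :+ b) :- o) ⊜ (f :- g) :- o) refl (Fp ℓ)
              (fl (Fp ℓ)) (B ℓ) 𝟙)
              (N-⊕ (lo ℓ) (Z-least′ (Z-⊖ (Z-⊕ zf (Z-• (+ norm a) Z-𝟙)))
                λ g → h (N-resp (solve 1 (λ x → :- :- x ⊜ x :- :0) refl (fl (Fp ℓ) ⊕ B ℓ)) g)))) }

    private
      zs : Fin n → D
      zs = fl ∘ ρ
      fs : Fin n → D
      fs = fr ∘ ρ

      zs-Z : ∀ i → IsZ (zs i)
      zs-Z i = proj₁ (floor (ρ i))

      geF-eval : ∀ ℓ k → evL (fractional-part ℓ +L constL (ℤ.- k)) fs ≈ Fp ℓ ⊝ k • 𝟙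
      geF-eval ℓ k = trans (evL-+ (fractional-part ℓ) (constL (ℤ.- k)) fs)
        (⊕-congˡ (trans (evL-const (ℤ.- k) fs) (neg-• k 𝟙)))

      geF-eval′ : ∀ ℓ k → evL (ℤ.-1ℤ *L fractional-part ℓ +L constL k) fs ≈ k • 𝟙 ⊝ Fp ℓ
      geF-eval′ ℓ k = trans (evL-+ (ℤ.-1ℤ *L fractional-part ℓ) (constL k) fs)
        (trans (⊕-cong (trans (evL-* ℤ.-1ℤ (fractional-part ℓ) fs) (⊖-cong (1-• _)))
          (evL-const k fs)) (⊕-comm _ _))

      geZ-eval : ∀ ℓ k → evL (ℓ +L constL k) zs ≈ evL ℓ zs ⊕ k • 𝟙
      geZ-eval ℓ k = trans (evL-+ ℓ (constL k) zs) (⊕-congˡ (evL-const k zs))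

    Atomic : Atom n n → Set
    Atomic = Holds zs fs

    -- For the converse, `j` comes from the floor of the fractional sum. The remaining part of the
    -- value is an integer, so rounding the fractional sum down cannot make a nonnegative total
    -- negative.
    nonnegative-correct : ∀ ℓ → Sat (nonnegative ℓ) Atomic ↔ N (evL ℓ ρ)
    nonnegative-correct ℓ =
        (λ s → stable-N λ k → ⋁-elim {v = Atomic} (allFin (width ℓ)) _ s λ
          { (j , h , h′) → let c = shifted ℓ (toℕ j) in
          k (N-resp (trans (⊕-cong (geF-eval ℓ c) (geZ-eval ℓ c))
              (trans (solve 3 (λ f c z → (f :- c) :+ (z :+ c) ⊜ z :+ f) refl (Fp ℓ) (c • 𝟙)
                (evL ℓ zs)) (sym (split ℓ))))
            (N-⊕ h h′)) })
      , (λ h → Sat-run (nonnegative ℓ) λ k → floor-Fp ℓ λ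
        { (j , e) → let c = shifted ℓ (toℕ j); _ , n , ¬n = floor (Fp ℓ) in
          k (⋁-intro {v = Atomic} _ (∈-allFin j)
            ( N-resp (trans (⊕-congˡ (⊖-cong e)) (sym (geF-eval ℓ c))) n
            , N-resp (trans (⊕-congˡ e) (sym (geZ-eval ℓ c)))
              (rounded ℓ (floor (Fp ℓ)) (N-resp (split ℓ) h)))) })
      where
      rounded : ∀ ℓ → Floor (fl (Fp ℓ)) (Fp ℓ) → N (evL ℓ zs ⊕ Fp ℓ) → N (evL ℓ zs ⊕ fl (Fp ℓ))
      rounded ℓ (zf , _ , ¬n) h = stable-N λ k → em (N (evL ℓ zs ⊕ fl (Fp ℓ))) λ
        { (inj₁ g) → k g
        ; (inj₂ g) → ¬n (N-resp
          (solve 4 (λ z f g o → (z :+ f) :+ (:- (z :+ g) :- o) ⊜ (f :- g) :- o) refl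
              (evL ℓ zs) (Fp ℓ) (fl (Fp ℓ)) 𝟙)
            (N-⊕ h (Z-least′ (Z-⊖ (Z-⊕ (Z-ev ℓ zs-Z) zf))
              λ g′ → g (N-resp (solve 1 (λ x → :- :- x ⊜ x) refl (evL ℓ zs ⊕ fl (Fp ℓ))) g′)))) }

    integer-correct : ∀ ℓ → Sat (integer ℓ) Atomic ↔ IsZ (evL ℓ ρ)
    integer-correct ℓ =
        (λ s → stable-Z λ k → ⋁-elim {v = Atomic} (allFin (width ℓ)) _ s λ
          { (j , h , h′) → let c = shifted ℓ (toℕ j) in
          k (Z-resp (trans (⊕-congˡ
            (≼-antisym (N-resp (geF-eval ℓ c) h) (N-resp (geF-eval′ ℓ c) h′))) (sym (split ℓ)))
            (Z-⊕ (Z-ev ℓ zs-Z) (Z-• c Z-𝟙))) })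
      , (λ h → Sat-run (integer ℓ) λ k → floor-Fp ℓ λ { (j , e) →
          let c = shifted ℓ (toℕ j)
              zF : IsZ (Fp ℓ)
              zF = Z-resp (trans (⊕-congʳ (split ℓ))
                (solve 2 (λ z f → (z :+ f) :- z ⊜ f) refl (evL ℓ zs) (Fp ℓ)))
                     (Z-⊕ h (Z-⊖ (Z-ev ℓ zs-Z)))
              e′ : Fp ℓ ≈ c • 𝟙
              e′ = trans (floor-unique
                (zF , N-≈ refl , λ g → pos-⊖𝟙
                  (N-resp (solve 2 (λ f o → (f :- f) :- o ⊜ :- o) refl (Fp ℓ) 𝟙) g))
                     (floor (Fp ℓ))) e
          in k (⋁-intro {v = Atomic} _ (∈-allFin j)
               ( N-resp (sym (geF-eval ℓ c)) (N-≈ (sym e′))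
               , N-resp (sym (geF-eval′ ℓ c)) (N-≈ e′))) })

    inL-correct : ∀ ℓ → IsL (evL ℓ zs) ↔ IsL (evL ℓ ρ)
    inL-correct ℓ =
        (λ h → L-resp (sym (split ℓ)) (L-⊕ h (L-Fp ℓ)))
      , (λ h → L-resp (trans (⊕-congʳ (split ℓ))
        (solve 2 (λ z f → (z :+ f) :- f ⊜ z) refl (evL ℓ zs) (Fp ℓ)))
          (L-⊕ h (L-⊖ (L-Fp ℓ))))

  Valid : ∀ {n} → BF (Atom n n) → (Fin n → D) → Set
  Valid φ ρ = Sat φ (Holds (fl ∘ ρ) (fr ∘ ρ))

  -- An element `d` amounts to the pair of `fl d` and `fr d`: conversely, `z + f` has floor `z`
  -- whenever `z` is in `Z` and `0 ≤ f < 1`.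
  exists-correct : ∀ {n} (φ : BF (Atom (suc n) (suc n))) (ρ : Fin n → D) →
                   Valid (elimZ (elimF φ)) ρ ↔ T (∃[ d ] Valid φ (d F.∷ ρ))
  exists-correct φ ρ =
      (λ s k → proj₁ (elimZ-correct (elimF φ) zz) s λ
        { (z , zZ , s) → proj₁ (elimF-correct φ) s λ { (f , nf , f≪ , s) →
        k (z ⊕ f , proj₂ (Sat-cong φ λ {a} _ → Holds-cong
          (λ { zero → whole zZ nf f≪ ; (suc i) → refl })
          (λ { zero → trans (⊕-congˡ (⊖-cong (whole zZ nf f≪)))
            (solve 2 (λ z f → (z :+ f) :- z ⊜ f) refl z f) ; (suc i) → refl }) a) s) } })
    , (λ t → proj₂ (elimZ-correct (elimF φ) zz) λ k → t λ { (d , s) → let zd , n , ¬n = floor d in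
        k (fl d , zd , proj₂ (elimF-correct φ) λ k → k
          (fr d , n , ¬n , proj₁ (Sat-cong φ λ {a} _ → Holds-cong
          (λ { zero → refl ; (suc i) → refl }) (λ { zero → refl ; (suc i) → refl }) a) s)) })
    where
    zz : ∀ i → IsZ (fl (ρ i))
    zz i = proj₁ (floor (ρ i))
    whole : ∀ {z f} → IsZ z → N f → f ≪ 𝟙 → fl (z ⊕ f) ≈ z
    whole {z} {f} zZ nf f≪ = floor-unique (floor (z ⊕ f))
      (zZ , N-resp (solve 2 (λ z f → f ⊜ (z :+ f) :- z) refl z f) nf
      , λ h → f≪ (N-resp (⊕-congʳ (solve 2 (λ z f → (z :+ f) :- z ⊜ f) refl z f)) h))

  eliminate-correct : ∀ {n} (φ : Formula n) ρ → ⟦ φ ⟧ ρ ↔ Valid (eliminate φ) ρ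
  eliminate-correct (s ≐ t) ρ =
      (λ e → proj₂ (nonnegative-correct ρ (difference s t))
        (N-resp (sym (difference-eval s t ρ)) (N-≈ (sym e)))
           , proj₂ (nonnegative-correct ρ (difference t s))
             (N-resp (sym (difference-eval t s ρ)) (N-≈ e)))
    , (λ { (h , h′) → ≼-antisym
          (N-resp (difference-eval t s ρ) (proj₁ (nonnegative-correct ρ (difference t s)) h′))
          (N-resp (difference-eval s t ρ) (proj₁ (nonnegative-correct ρ (difference s t)) h)) })
  eliminate-correct (s < t) ρ =
      (λ lt h → Lt⇒¬N lt (N-resp (difference-eval s t ρ)
        (proj₁ (nonnegative-correct ρ (difference s t)) h)))
    , (λ h → ¬N⇒Lt λ n → h
      (proj₂ (nonnegative-correct ρ (difference s t)) (N-resp (sym (difference-eval s t ρ)) n)))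
  eliminate-correct (Z t)   ρ = ↔-trans (Z-↔ (linear-eval t ρ))
    (↔-sym (integer-correct ρ (linear t)))
  eliminate-correct (L t)   ρ = ↔-trans (L-↔ (linear-eval t ρ)) (↔-sym (inL-correct ρ (linear t)))
  eliminate-correct ⊥       ρ = ↔-refl
  eliminate-correct (φ ∧ ψ) ρ with eliminate-correct φ ρ | eliminate-correct ψ ρ
  ... | f , g | f′ , g′ = (λ { (x , y) → f x , f′ y }) , (λ { (x , y) → g x , g′ y })
  eliminate-correct (φ ∨ ψ) ρ with eliminate-correct φ ρ | eliminate-correct ψ ρ
  ... | f , g | f′ , g′ = (λ h k k′ → h (k ∘ f) (k′ ∘ f′)) , (λ h k k′ → h (k ∘ g) (k′ ∘ g′))
  eliminate-correct (φ ⇒ ψ) ρ with eliminate-correct φ ρ | eliminate-correct ψ ρ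
  ... | f , g | f′ , g′ = (λ { h (x , y) → y (f′ (h (g x))) })
                        , (λ h x → stable ψ ρ λ k → h (f x , k ∘ g′))
  eliminate-correct (∀̇ φ)   ρ =
      (λ h s → proj₁ (exists-correct (neg (eliminate φ)) ρ) s λ
        { (d , ¬s) → ¬s (proj₁ (eliminate-correct φ (d F.∷ ρ)) (h d)) })
    , (λ h d → stable φ (d F.∷ ρ) λ k → h (proj₂ (exists-correct (neg (eliminate φ)) ρ) λ k′ →
        k′ (d , λ s → k (proj₂ (eliminate-correct φ (d F.∷ ρ)) s))))
  eliminate-correct (∃̇ φ)   ρ =
      (λ h → proj₂ (exists-correct (eliminate φ) ρ) λ k → h λ d a → k
        (d , proj₁ (eliminate-correct φ (d F.∷ ρ)) a))
    , (λ s k → proj₁ (exists-correct (eliminate φ) ρ) s λ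
      { (d , s) → k d (proj₂ (eliminate-correct φ (d F.∷ ρ)) s) })

-- From atoms to special formulas

module SpecialFormulas (M : Structure) (isM : IsModel 3G M) where
  open ThreeGroups M isM
  open Elimination M isM
  open Positions M isM
  open Integers M isM
  open Correctness M isM
  open Translation M isM

  formula-correct : ∀ {n} {A : Set} (g : A → Formula n) φ ρ →
                    ⟦ formula g φ ⟧ ρ ↔ Sat φ (λ a → ⟦ g a ⟧ ρ)
  formula-correct g (at a)    ρ = ↔-refl
  formula-correct g ff        ρ = (λ { (h , ¬h) → ¬h h }) ,
    (λ r → (λ d → stable-L λ _ → r) , λ _ → r)
  formula-correct g (neg φ)   ρ with formula-correct g φ ρ
  ... | f , h = (λ k → k ∘ h) , (λ k → k ∘ f)
  formula-correct g (and φ ψ) ρ with formula-correct g φ ρ | formula-correct g ψ ρ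
  ... | f , g | f′ , g′ = (λ { (x , y) → f x , f′ y }) , (λ { (x , y) → g x , g′ y })
  formula-correct g (or φ ψ)  ρ with formula-correct g φ ρ | formula-correct g ψ ρ
  ... | f , g | f′ , g′ = (λ h k k′ → h (k ∘ f) (k′ ∘ f′)) , (λ h k k′ → h (k ∘ g) (k′ ∘ g′))

  append : ∀ k {n} → (Fin k → D) → (Fin n → D) → Fin (k ℕ.+ n) → D
  append zero    v ρ = ρ
  append (suc k) v ρ = v zero F.∷ append k (v ∘ suc) ρ

  append-ˡ : ∀ {k n} (v : Fin k → D) (ρ : Fin n → D) i → append k v ρ (i ↑ˡ n) ≡ v i
  append-ˡ v ρ zero    = ≡.refl
  append-ˡ v ρ (suc i) = append-ˡ (v ∘ suc) ρ i

  append-ʳ : ∀ k {n} (v : Fin k → D) (ρ : Fin n → D) i → append k v ρ (k ↑ʳ i) ≡ ρ i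
  append-ʳ zero    v ρ i = ≡.refl
  append-ʳ (suc k) v ρ i = append-ʳ k (v ∘ suc) ρ i

  ∃^-correct : ∀ k {n} (φ : Formula (k ℕ.+ n)) ρ → ⟦ ∃^ k φ ⟧ ρ ↔ T (∃[ v ] ⟦ φ ⟧ (append k v ρ))
  ∃^-correct zero    φ ρ = (λ h k → k (ε , h)) , (λ h → stable φ ρ λ k → h λ { (_ , s) → k s })
  ∃^-correct (suc k) φ ρ =
      (λ h c → proj₁ (∃^-correct k (∃̇ φ) ρ) h λ { (v , e) → e λ d s → c ((d F.∷ v) , s) })
    , (λ t → proj₂ (∃^-correct k (∃̇ φ) ρ) λ c → t λ
      { (v , s) → c (v ∘ suc , λ c′ → c′ (v zero) s) })

  ⋀-correct : ∀ {k n} (φ : Vector (Formula n) k) ρ → ⟦ ⋀ φ ⟧ ρ ↔ (∀ i → ⟦ φ i ⟧ ρ)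
  ⋀-correct {zero}  φ ρ = (λ _ ()) , (λ _ r → r)
  ⋀-correct {suc k} φ ρ with ⋀-correct (φ ∘ suc) ρ
  ... | f , g = (λ { (x , y) zero → x ; (x , y) (suc i) → f y i }) , (λ h → h zero , g (h ∘ suc))

  parts : ∀ k x → + (k ⁺) • x ⊝ + (k ⁻) • x ≈ k • x
  parts (+ zero)  x = solve 0 (:0 :- :0 ⊜ :0) refl
  parts (+ suc n) x = solve 1 (λ x → x :- :0 ⊜ x) refl (+ suc n • x)
  parts -[1+ n ]  x = solve 1 (λ x → :0 :- x ⊜ :- x) refl (+ suc n • x)

  Σ-parts : ∀ {k n} (a : Vector ℤ k) (t : Vector (Term n) k) ρ →
            ⟦ Σ⁺ a t ⟧ₜ ρ ⊝ ⟦ Σ⁻ a t ⟧ₜ ρ ≈ ev a (λ i → ⟦ t i ⟧ₜ ρ)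
  Σ-parts {zero}  a t ρ = solve 0 (:0 :- :0 ⊜ :0) refl
  Σ-parts {suc k} a t ρ = trans
    (solve 4 (λ p P q Q → (p :+ P) :- (q :+ Q) ⊜ (p :- q) :+ (P :- Q)) refl _ _ _ _)
    (⊕-cong (trans (⊕-cong (reflexive (⟦·⟧ (a zero ⁺) (t zero) ρ))
        (⊖-cong (reflexive (⟦·⟧ (a zero ⁻) (t zero) ρ)))) (parts (a zero) _))
      (Σ-parts (a ∘ suc) (t ∘ suc) ρ))

  Σ≥-correct : ∀ {k n} (a : Vector ℤ k) (t : Vector (Term n) k) c ρ →
               ⟦ Σ[ a , t ]≥ c ⟧ ρ ↔ N (ev a (λ i → ⟦ t i ⟧ₜ ρ) ⊝ c • 𝟙)
  Σ≥-correct a t c ρ = (λ h → N-resp e (Le⇒N h)) , (λ h → N⇒Le (N-resp (sym e) h))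
    where
    e : (⟦ Σ⁺ a t ⟧ₜ ρ ⊕ ⟦ (c ⁻) · `1 ⟧ₜ ρ) ⊝ (⟦ Σ⁻ a t ⟧ₜ ρ ⊕ ⟦ (c ⁺) · `1 ⟧ₜ ρ) ≈ ev a
      (λ i → ⟦ t i ⟧ₜ ρ) ⊝ c • 𝟙
    e = trans (solve 4 (λ P q Q p → (P :+ q) :- (Q :+ p) ⊜ (P :- Q) :- (p :- q)) refl _ _ _ _)
      (⊕-cong (Σ-parts a t ρ) (⊖-cong (trans (⊕-cong (reflexive (⟦·⟧ (c ⁺) `1 ρ))
        (⊖-cong (reflexive (⟦·⟧ (c ⁻) `1 ρ)))) (parts c 𝟙))))

  wkT-eval : ∀ {n} (t : Term n) d ρ → ⟦ wkT t ⟧ₜ (d F.∷ ρ) ≡ ⟦ t ⟧ₜ ρ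
  wkT-eval (var i) d ρ = ≡.refl
  wkT-eval `0      d ρ = ≡.refl
  wkT-eval `1      d ρ = ≡.refl
  wkT-eval (s + t) d ρ = ≡.cong₂ _⊕_ (wkT-eval s d ρ) (wkT-eval t d ρ)

  -- The fresh variables have their values determined by `h`, so the existential block amounts to a
  -- substitution. Taking `fl` or `fr` for `h` covers both kinds of inequalities.
  defined : ∀ {n} (δ : Vector (Formula (n ℕ.+ n)) n) (h : D → D) (a : Vector ℤ n) c ρ →
            (∀ v → (∀ i → ⟦ δ i ⟧ (append n v ρ)) ↔ (∀ i → v i ≈ h (ρ i))) →
            ⟦ ∃^ n (⋀ δ ∧ Σ[ a , new n ]≥ (ℤ.- c)) ⟧ ρ ↔ N (evL (c , a) (h ∘ ρ))
  defined {n} δ h a c ρ e = ↔-trans (∃^-correct n _ ρ)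
    ( (λ t → stable-N λ k → t λ
      { (v , d , s) → k (N-resp (eq (proj₁ (e v) (proj₁ (⋀-correct δ _) d)))
          (proj₁ (Σ≥-correct a (new n) (ℤ.- c) _) s)) })
    , (λ s k → k (h ∘ ρ , proj₂ (⋀-correct δ _) (proj₂ (e (h ∘ ρ)) (λ _ → refl))
        , proj₂ (Σ≥-correct a (new n) (ℤ.- c) _) (N-resp (sym (eq (λ _ → refl))) s))) )
    where
    eq : ∀ {v} → (∀ i → v i ≈ h (ρ i)) →
         ev a (λ i → ⟦ new n i ⟧ₜ (append n v ρ)) ⊝ (ℤ.- c) • 𝟙 ≈ evL (c , a) (h ∘ ρ)
    eq {v} p = trans (⊕-cong (ev-cong (λ _ → ≡.refl) λ i → trans (reflexive (append-ˡ v ρ i)) (p i))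
        (⊖-cong (neg-• c 𝟙)))
      (solve 2 (λ x c → x :- (:- c) ⊜ c :+ x) refl (ev a (h ∘ ρ)) (c • 𝟙))

  floor-correct : ∀ {n} (s t : Term n) ρ → ⟦ s ≐⌊ t ⌋ ⟧ ρ ↔ ⟦ s ⟧ₜ ρ ≈ fl (⟦ t ⟧ₜ ρ)
  floor-correct s t ρ =
      (λ h → floor-unique (Floor⇐ h) (floor _))
    , (λ e → let p , n , ¬n = floor (⟦ t ⟧ₜ ρ) in Floor⇒
        ( Z-resp (sym e) p , N-resp (⊕-congˡ (⊖-cong (sym e))) n
        , λ g → ¬n (N-resp (⊕-congʳ (⊕-congˡ (⊖-cong e))) g)))

  frac-correct : ∀ {n} (i j : Fin n) ρ → ⟦ var i ≐｛ var j ｝ ⟧ ρ ↔ ρ i ≈ fr (ρ j)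
  frac-correct i j ρ =
      (λ h → stable-Eq λ k → h λ
        { d (g , e) → k (trans (solve 2 (λ x d → x ⊜ (x :+ d) :- d) refl (ρ i) d)
        (⊕-cong e (⊖-cong (proj₁ (floor-correct x₀ (var (suc j)) (d F.∷ ρ)) g)))) })
    , (λ e k → k (fl (ρ j)) (proj₂ (floor-correct x₀ (var (suc j)) (fl (ρ j) F.∷ ρ)) refl
        , trans (⊕-congʳ e) (solve 2 (λ x f → (x :- f) :+ f ⊜ x) refl (ρ j) (fl (ρ j)))))

  old-new : ∀ {n} (h : D → D) → (∀ {x y} → x ≡ y → h x ≈ h y) → ∀ (v ρ : Fin n → D) i →
            (append n v ρ (i ↑ˡ n) ≈ h (append n v ρ (n ↑ʳ i))) ↔ (v i ≈ h (ρ i))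
  old-new {n} h c v ρ i rewrite append-ˡ v ρ i | append-ʳ n v ρ i = ↔-refl

  ∀-↔ : ∀ {X : Set} {A B : X → Set} → (∀ i → A i ↔ B i) → (∀ i → A i) ↔ (∀ i → B i)
  ∀-↔ e = (λ h i → proj₁ (e i) (h i)) , (λ h i → proj₂ (e i) (h i))

  -- The special formula omits the constant and speaks of the `xᵢ` rather than their floors; both
  -- changes alter the value by an element of `L`.
  in-L-correct : ∀ {n} (a : Vector ℤ n) c ρ → ⟦ Σ[ a , var ]∈L ⟧ ρ ↔ IsL (evL (c , a) (fl ∘ ρ))
  in-L-correct a c ρ = ↔-trans
    ( (λ h → stable-L λ k → h λ { d (l , e) → k (L-resp (sym (trans (sym (Σ-parts a var ρ))
          (trans (⊕-cong (reflexive (≡.sym (wkT-eval (Σ⁺ a var) d ρ)))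
            (⊖-cong (reflexive (≡.sym (wkT-eval (Σ⁻ a var) d ρ)))))
            (trans (⊕-congʳ (sym e))
              (solve 2 (λ d m → (d :+ m) :- m ⊜ d) refl d (⟦ wkT (Σ⁻ a var) ⟧ₜ (d F.∷ ρ))))))) l) })
    , (λ l k → k (ev a ρ) (l , trans (⊕-congˡ (reflexive (wkT-eval (Σ⁻ a var) (ev a ρ) ρ)))
          (trans (⊕-congʳ (sym (Σ-parts a var ρ)))
          (trans (solve 2 (λ p m → (p :- m) :+ m ⊜ p) refl (⟦ Σ⁺ a var ⟧ₜ ρ) (⟦ Σ⁻ a var ⟧ₜ ρ))
            (reflexive (≡.sym (wkT-eval (Σ⁺ a var) (ev a ρ) ρ)))))) ))
    (↔-trans
      ( (λ l → L-⊕ (L-• c L-𝟙) l)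
      , (λ l → L-resp (solve 2 (λ c x → (c :+ x) :- c ⊜ x) refl (c • 𝟙) (ev a ρ))
        (L-⊕ l (L-⊖ (L-• c L-𝟙)))))
      (↔-sym (inL-correct ρ (c , a))))

  residue-correct : ∀ {n} m (i : Fin n) (r : Fin (suc m)) ρ →
                    ⟦ residueFormula (suc m) (i , r) ⟧ ρ ↔ IsZ (div m (fl (ρ i) ⊝ + toℕ r • 𝟙))
  residue-correct m i r ρ =
      (λ h → stable-Z λ k → h λ { d (g , e) → e λ { w (zw , e) → k (Z-resp (sym (div-unique m
          (trans (solve 2 (λ s c → s ⊜ (s :+ c) :- c) refl (+ suc m • w) (+ toℕ r • 𝟙))
            (⊕-congʳ (trans (sym (trans e
              (⊕-cong (reflexive (⟦·⟧ (suc m) x₀ (w F.∷ d F.∷ ρ)))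
                (reflexive (⟦·⟧ (toℕ r) `1 (w F.∷ d F.∷ ρ))))))
              (proj₁ (floor-correct x₀ (var (suc i)) (d F.∷ ρ)) g)))))) zw) } })
    , (λ zw k → let d = fl (ρ i); w = div m (d ⊝ + toℕ r • 𝟙) in
        k d (proj₂ (floor-correct x₀ (var (suc i)) (d F.∷ ρ)) refl , λ k′ → k′ w (zw ,
          trans (solve 2 (λ d c → d ⊜ (d :- c) :+ c) refl d (+ toℕ r • 𝟙))
            (⊕-cong (trans (sym (div-correct m _))
              (reflexive (≡.sym (⟦·⟧ (suc m) x₀ (w F.∷ d F.∷ ρ)))))
              (reflexive (≡.sym (⟦·⟧ (toℕ r) `1 (w F.∷ d F.∷ ρ))))))))

  -- With a nonzero remainder, an integral quotient minus `q` would be an element `u` of `Z` whose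
  -- multiple by `suc m` is the remainder. Then `0 < u < 1`, against the leastness of 1.
  divisibleConst-correct : ∀ {A} {v : A → Set} m c → Sat (divisibleConst (c ℤ.%ℕ suc m)) v ↔ IsZ
    (div m (c • 𝟙))
  divisibleConst-correct {v = v} m c = go (c ℤ.%ℕ suc m) (ℤ.n%ℕd<d c (suc m))
    (ℤ.a≡a%ℕn+[a/ℕn]*n c (suc m))
    where
    q = c ℤ./ℕ suc m
    s = + suc m
    go : ∀ r → r ℕ.< suc m → c ≡ + r ℤ.+ q ℤ.* s → Sat (divisibleConst r) v ↔ IsZ (div m (c • 𝟙))
    go zero r<m e =
      (λ _ → Z-resp (sym (div-unique m
        (trans (sym (*-• s q 𝟙))
          (•-congʳ 𝟙 (≡.trans (ℤ.*-comm s q) (≡.trans (≡.sym (ℤ.+-identityˡ _)) (≡.sym e)))))))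
        (Z-• q Z-𝟙)) , (λ _ r → r)
    go (suc r) (ℕ.s≤s r<m) e = (λ r → stable-Z λ _ → r) , λ h →
      let u = div m (c • 𝟙) ⊝ q • 𝟙
          su : s • u ≈ + suc r • 𝟙
          su = trans (•-⊕ s _ _)
            (trans (⊕-cong (trans (div-correct m _)
              (trans (•-congʳ 𝟙 e) (+-• (+ suc r) (q ℤ.* s) 𝟙)))
                 (trans (•-⊖ s _) (⊖-cong (trans (sym (*-• s q 𝟙)) (•-congʳ 𝟙 (ℤ.*-comm s q))))))
               (solve 2 (λ x y → (x :+ y) :- y ⊜ x) refl (+ suc r • 𝟙) ((q ℤ.* s) • 𝟙)))
          u>0 : N (⊖ u) → R
          u>0 = λ n → pos-⊖𝟙 (N-resp (trans (⊕-congʳ (trans (•-⊖ s u) (⊖-cong su)))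
            (solve 2 (λ o r → :- (o :+ r) :+ r ⊜ :- o) refl 𝟙 (+ r • 𝟙)))
              (N-⊕ (N-• (suc m) n) (N-• r N-𝟙)))
      in pos-⊖𝟙 (N-resp (final r<m su)
        (N-⊕ (N-• (suc m) (Z-least′ (Z-⊕ h (Z-⊖ (Z-• q Z-𝟙))) u>0)) (N-• (m ℕ.∸ suc r) N-𝟙)))
      where
      final : ∀ {r u} → suc r ℕ.≤ m → s • u ≈ + suc r • 𝟙 → s • (u ⊝ 𝟙) ⊕ + (m ℕ.∸ suc r) • 𝟙 ≈ ⊖ 𝟙
      final {r} {u} r<m su = trans (⊕-congʳ (trans (•-⊕ s u _) (⊕-cong su (•-⊖ s 𝟙))))
        (trans (solve 3 (λ x y z → (x :- y) :+ z ⊜ (z :+ x) :- y) refl (+ suc r • 𝟙) (s • 𝟙)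
          (+ (m ℕ.∸ suc r) • 𝟙))
        (trans (⊕-congʳ (trans (sym (+-• (+ (m ℕ.∸ suc r)) (+ suc r) 𝟙))
          (•-congʳ 𝟙 (≡.cong +_ (ℕ.m∸n+n≡m r<m)))))
          (solve 2 (λ o x → x :- (o :+ x) ⊜ :- o) refl 𝟙 (+ m • 𝟙))))

  divisible-correct : ∀ {n} m {k} (g : Fin k → Fin n) ℓ (z : Fin n → D) → (∀ i → IsZ (z i)) →
    Sat (divisible m g ℓ) (λ (i , r) → IsZ (div m (z i ⊝ + toℕ r • 𝟙))) ↔ IsZ
      (div m (evL ℓ (z ∘ g)))
  divisible-correct m {zero}  g (c , a) z zz = ↔-trans (divisibleConst-correct m c)
    (Z-↔ (div-cong m (sym (⊕-identityʳ _))))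
  divisible-correct m {suc k} g (c , a) z zz =
      (λ s → stable-Z λ k′ → ⋁-elim {v = V} (allFin (suc m)) _ s λ { (r , h , s) →
        k′ (dvd-shift m m (c , a) ∣-refl (congr r h)
          (Z-resp (div-cong m (instantiate r)) (proj₁ (divisible-correct m (g ∘ suc) _ z zz) s))) })
    , (λ h → Sat-stable (λ _ → stable-Z) (divisible m g (c , a)) λ k′ → bounded (suc m)
        (round-Z m 𝟘 x (zz (g zero))) (round-≽ m 𝟘 x)
        (λ h → round-≪ m 𝟘 x (N-resp (⊕-congˡ (⊖-cong (sym (⊕-identityˡ _)))) h))
        λ { (r , e) → let cg = Congruent-respʳ {m} e (round-≡ m 𝟘 x) in
          k′ (⋁-intro {v = V} _ (∈-allFin r)
            (Z-resp (sym (div-unique m (sym (proj₂ (proj₂ cg))))) (proj₁ (proj₂ cg))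
            , proj₂ (divisible-correct m (g ∘ suc) _ z zz)
              (Z-resp (div-cong m (sym (instantiate r)))
                (dvd-shift m m (c , a) ∣-refl (Congruent-sym {m} cg) h)))) })
    where
    V : Fin _ × Fin (suc m) → Set
    V (i , r) = IsZ (div m (z i ⊝ + toℕ r • 𝟙))
    x = z (g zero)
    congr : ∀ r → V (g zero , r) → Congruent m x (+ toℕ r • 𝟙)
    congr r h = _ , h , sym (div-correct m _)
    instantiate : ∀ r → evL (a zero ℤ.* + toℕ r ℤ.+ c , a ∘ suc) (z ∘ g ∘ suc) ≈ evL (c , a)
      ((+ toℕ r • 𝟙) F.∷ (z ∘ g ∘ suc))
    instantiate r = trans
      (⊕-congʳ (trans (+-• (a zero ℤ.* + toℕ r) c 𝟙) (⊕-congʳ (*-• (a zero) (+ toℕ r) 𝟙))))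
      (trans (⊕-assoc _ _ _) (sym (evL-∷ (c , a) (+ toℕ r • 𝟙) (z ∘ g ∘ suc))))

  atomFormula-correct : ∀ {n} (a : Atom n n) ρ → ⟦ atomFormula a ⟧ ρ ↔ Holds (fl ∘ ρ) (fr ∘ ρ) a
  atomFormula-correct {n} (geZ (c , a)) ρ = defined _ fl a c ρ λ v → ∀-↔ λ i →
    ↔-trans (floor-correct (new n i) (old n i) (append n v ρ))
      (old-new fl (λ { ≡.refl → refl }) v ρ i)
  atomFormula-correct (inL (c , a)) ρ = in-L-correct a c ρ
  atomFormula-correct (dvd m ℓ) ρ = ↔-trans
    (formula-correct (residueFormula (suc m)) (divisible m id ℓ) ρ)
    (↔-trans (Sat-cong (divisible m id ℓ) λ { {i , r} _ → residue-correct m i r ρ })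
      (divisible-correct m id ℓ (fl ∘ ρ) (λ i → proj₁ (floor (ρ i)))))
  atomFormula-correct {n} (geF (c , a)) ρ = defined _ fr a c ρ λ v → ∀-↔ λ i →
    ↔-trans (frac-correct (i ↑ˡ n) (n ↑ʳ i) (append n v ρ)) (old-new fr (λ { ≡.refl → refl }) v ρ i)
  atomFormula-correct QL ρ = ↔-refl

theorem4p4 : ∀ {n : ℕ} (φ : Formula n) → ∃[ ψ ] (Special ψ × (3G ∣ [] ⊢ (φ ⇔ ψ)))
theorem4p4 φ = ψ , formula-special atomFormula-special (eliminate φ)
  , completeness (φ ⇔ ψ) λ M isM ρ →
      let open Elimination M isM using (Sat-cong)
          open Translation M isM using (eliminate-correct)
          open SpecialFormulas M isM using (formula-correct; atomFormula-correct)
      in ↔-trans (eliminate-correct φ ρ)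
        (↔-sym (↔-trans (formula-correct atomFormula (eliminate φ) ρ)
           (Sat-cong (eliminate φ) λ {a} _ → atomFormula-correct a ρ)))
  where ψ = formula atomFormula (eliminate φ)
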